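{- Let $l_1,\ldots,l_m$ be positive integers and let $\alpha_1,\ldots,\alpha_m$ be distinct variables. Denote $\overline{\alpha}=(\alpha_1,\ldots,\alpha_m)^T$, $\overline{l}=(l_1,\ldots,l_m)^T$, $L:=l_1+\ldots+l_m$. Let $\mathcal{V}(\overline{\alpha})$ be the $L\times(L+1)$ matrix over $\mathbb{Z}[\alpha_1,\ldots,\alpha_m]$ whose rows are indexed by the pairs $(j,i)$ with $j=1,\ldots,m$, $i=1,\ldots,l_j$ (ordered lexicographically), whose columns are indexed by $h=0,1,\ldots,L$, and whose entry in row $(j,i)$ and column $h$ is $\binom{L+i}{h}\alpha_j^{L-h}$. For $h=0,\ldots,L$ let $\mathcal{V}[h]$ be the $L\times L$ minor of $\mathcal{V}(\overline{\alpha})$ obtained by removing the column with index $h$. Put $$ T(\overline{l},\overline{\alpha}):=\alpha_1^{\binom{l_1}{2}}\cdots\alpha_m^{\binom{l_m}{2}}\prod_{1\le i<j\le m}(\alpha_i-\alpha_j)^{\min\{l_i^2,\,l_j^2\}} . $$ Then there exist non-zero polynomials $B_{\overline{l},j}(t,\overline{\alpha})\in\mathbb{Q}[t,\overline{\alpha}]$, $j=0,1,\ldots,m$, and remainders $S_{\overline{l},j}(t,\overline{\alpha})$, $j=1,\ldots,m$, such that $$ B_{\overline{l},0}(t,\overline{\alpha})e^{\alpha_j t}-B_{\overline{l},j}(t,\overline{\alpha})=S_{\overline{l},j}(t,\overline{\alpha}),\quad j=1,\ldots,m, $$ where $$ \begin{cases}\deg_t B_{\overline{l},j}(t,\overline{\alpha})\le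 L, & j=0,\ldots,m;\\ L+l_j+1\le \operatorname{ord}_{t=0} S_{\overline{l},j}(t,\overline{\alpha})<\infty, & j=1,\ldots,m.\end{cases} $$ Moreover, $$ B_{\overline{l},0}(t,\overline{\alpha})=\sum_{i=0}^{L}\frac{L!}{i!}\,\tau_i(\overline{l},\overline{\alpha})\,t^i,\qquad \tau_i(\overline{l},\overline{\alpha})=\frac{(-1)^i\,\mathcal{V}[i]}{T(\overline{l},\overline{\alpha})}\in\mathbb{Z}[\overline{\alpha}], $$ where $T(\overline{l},\overline{\alpha})$ is a common factor of the $L\times L$ minors $\mathcal{V}[i]$, $i=0,\ldots,L$, of the matrix $\mathcal{V}(\overline{\alpha})$.
   Context: The exponential is the formal power series $e^{\alpha_j t}=\sum_{n\ge0}\alpha_j^n t^n/n!\in\mathbb{Q}[\overline{\alpha}][[t]]$, and the remainders are elements of $\mathbb{Q}[\overline{\alpha}][[t]]$. $\operatorname{ord}_{t=0}S$ is the smallest exponent of $t$ occurring with non-zero coefficient in $S$ ($\infty$ if $S=0$). $\deg_t$ is the degree in $t$. -}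

module Defs where

open import Algebra.Bundles.Raw using (RawRing)
import Algebra.Definitions.RawMonoid as RawMonoidDefs
import Algebra.Definitions.RawSemiring as RawSemiringDefs
open import Data.Bool.Base using (if_then_else_)
open import Data.Fin.Base using (Fin; zero; suc; toℕ; punchIn; splitAt)
open import Data.Fin.Properties using (_<?_)
open import Data.Integer.Base as ℤ using (ℤ; +_)
open import Data.List.Base using (List; []; _∷_; map)
open import Data.Nat.Base using (ℕ; zero; suc; _+_; _∸_; _*_; _<_; _⊓_; _!; +-0-rawMonoid)
open import Data.Nat.Combinatorics using (_C_)
open import Data.Nat.Properties using (_!≢0)
open import Data.Product.Base using (Σ; _×_; _,_)
open import Data.Rational.Base as ℚ using (ℚ)
open import Data.Sum.Base using (inj₁; inj₂)
open import Data.Vec.Functional using (Vector; tail)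
open import Relation.Nullary using (¬_; does)

-- A polynomial is its list of coefficients, lowest degree first.  Trailing
-- zeros are allowed, so equality is equality of all coefficients.

module PolyOps {c ℓ} (R : RawRing c ℓ) where
  private module R = RawRing R

  coeff : List R.Carrier → ℕ → R.Carrier
  coeff []      n       = R.0#
  coeff (a ∷ p) zero    = a
  coeff (a ∷ p) (suc n) = coeff p n

  add : List R.Carrier → List R.Carrier → List R.Carrier
  add []      q       = q
  add (a ∷ p) []      = a ∷ p
  add (a ∷ p) (b ∷ q) = (a R.+ b) ∷ add p q

  mul : List R.Carrier → List R.Carrier → List R.Carrier
  mul []      q = []
  mul (a ∷ p) q = add (map (a R.*_) q) (R.0# ∷ mul p q)

  const : R.Carrier → List R.Carrier
  const a = a ∷ []

  X : List R.Carrier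
  X = R.0# ∷ R.1# ∷ []

Poly : ∀ {c ℓ} → RawRing c ℓ → RawRing c ℓ
Poly R = record
  { Carrier = List R.Carrier
  ; _≈_     = λ p q → ∀ n → coeff p n R.≈ coeff q n
  ; _+_     = add
  ; _*_     = mul
  ; -_      = map R.-_
  ; 0#      = []
  ; 1#      = const R.1#
  }
  where
  module R = RawRing R
  open PolyOps R

PowerSeries : ∀ {c ℓ} → RawRing c ℓ → RawRing c ℓ
PowerSeries R = record
  { Carrier = ℕ → R.Carrier
  ; _≈_     = λ f g → ∀ n → f n R.≈ g n
  ; _+_     = λ f g n → f n R.+ g n
  ; _*_     = λ f g n → sum {suc n} λ i → f (toℕ i) R.* g (n ∸ toℕ i)
  ; -_      = λ f n → R.- f n
  ; 0#      = λ _ → R.0#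
  ; 1#      = λ { zero → R.1# ; (suc _) → R.0# }
  }
  where
  module R = RawRing R
  open RawMonoidDefs R.+-rawMonoid using (sum)

module _ {c ℓ} (R : RawRing c ℓ) where
  private module R = RawRing R
  open PolyOps R using (coeff)

  -- The degree is an exact one, so the zero polynomial has none.

  IsDegree : RawRing.Carrier (Poly R) → ℕ → Set ℓ
  IsDegree p d = ¬ (coeff p d R.≈ R.0#) × (∀ n → d < n → coeff p n R.≈ R.0#)

  -- Only series of finite order have an order in this sense: the order of
  -- 0 is ∞, and ord f < ∞ reads as the existence of some d with
  -- IsOrder f d.

  IsOrder : RawRing.Carrier (PowerSeries R) → ℕ → Set ℓ
  IsOrder f d = ¬ (f d R.≈ R.0#) × (∀ n → n < d → f n R.≈ R.0#)

  -- q = a / b in the field of fractions, for R an integral domain.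

  IsQuotient : (q a b : R.Carrier) → Set ℓ
  IsQuotient q a b = ¬ (b R.≈ R.0#) × (q R.* b R.≈ a)

-- R[α₁, …, αₘ] as the iterated polynomial ring R[αₘ]⋯[α₁].

MPoly : ∀ {c ℓ} → RawRing c ℓ → ℕ → RawRing c ℓ
MPoly R zero    = R
MPoly R (suc m) = Poly (MPoly R m)

scalar : ∀ {c ℓ} (R : RawRing c ℓ) m →
         RawRing.Carrier R → RawRing.Carrier (MPoly R m)
scalar R zero    a = a
scalar R (suc m) a = PolyOps.const (MPoly R m) (scalar R m a)

var : ∀ {c ℓ} (R : RawRing c ℓ) m → Fin m → RawRing.Carrier (MPoly R m)
var R (suc m) zero    = PolyOps.X (MPoly R m)
var R (suc m) (suc j) = PolyOps.const (MPoly R m) (var R m j)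

ℤ[α] ℚ[α] ℚ[t,α] ℚ[α]⟦t⟧ : ℕ → RawRing _ _
ℤ[α] m    = MPoly ℤ.+-*-rawRing m
ℚ[α] m    = MPoly ℚ.+-*-rawRing m
ℚ[t,α] m  = Poly (ℚ[α] m)
ℚ[α]⟦t⟧ m = PowerSeries (ℚ[α] m)

ι : ∀ m → RawRing.Carrier (ℤ[α] m) → RawRing.Carrier (ℚ[α] m)
ι zero    z = z ℚ./ 1
ι (suc m) p = map (ι m) p

toSeries : ∀ m → RawRing.Carrier (ℚ[t,α] m) → RawRing.Carrier (ℚ[α]⟦t⟧ m)
toSeries m = PolyOps.coeff (ℚ[α] m)

infix 7 _/!_
_/!_ : ℕ → ℕ → ℚ
a /! n = (+ a) ℚ./ (n !)
  where instance _ = n !≢0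

exp : ∀ m → Fin m → RawRing.Carrier (ℚ[α]⟦t⟧ m)
exp m j n = scalar ℚ.+-*-rawRing m (1 /! n) · var ℚ.+-*-rawRing m j ^ n
  where
  open RawRing (ℚ[α] m) using (rawSemiring) renaming (_*_ to infixl 7 _·_)
  open RawSemiringDefs rawSemiring using (_^_)

-- Laplace expansion along the first row.

det : ∀ {c ℓ} (R : RawRing c ℓ) {n} →
      (Fin n → Fin n → RawRing.Carrier R) → RawRing.Carrier R
det R {zero}  M = RawRing.1# R
det R {suc n} M =
  sum λ k → (- 1#) ^ toℕ k ·
            (M zero k · det R λ r c → M (suc r) (punchIn k c))
  where
  open RawRing R using (1#; -_; rawSemiring) renaming (_*_ to infixr 7 _·_)
  open RawSemiringDefs rawSemiring using (_^_; sum)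

total : ∀ {m} → Vector ℕ m → ℕ
total = RawMonoidDefs.sum +-0-rawMonoid

-- The r-th pair (j , i) in lexicographic order; here i : Fin (l j) stands
-- for the row index i + 1.

rowIndex : ∀ {m} (l : Vector ℕ m) → Fin (total l) → Σ (Fin m) λ j → Fin (l j)
rowIndex {suc m} l r with splitAt (l zero) r
... | inj₁ i  = zero , i
... | inj₂ r′ with rowIndex (tail l) r′
...   | j , i = suc j , i

module _ {m} (l : Vector ℕ m) where
  private
    open module A = RawRing (ℤ[α] m)
      using (Carrier; 1#; -_; rawSemiring)
      renaming (_+_ to infixl 6 _⊕_; _*_ to infixl 7 _·_)
    open RawSemiringDefs rawSemiring using (_^_; product)

    α : Fin m → Carrier
    α = var ℤ.+-*-rawRing m

    L : ℕ
    L = total l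

  𝒱 : Fin L → Fin (suc L) → Carrier
  𝒱 r h with rowIndex l r
  ... | j , i =
    scalar ℤ.+-*-rawRing m (+ ((L + suc (toℕ i)) C toℕ h)) · α j ^ (L ∸ toℕ h)

  𝒱-minor : Fin (suc L) → Carrier
  𝒱-minor h = det (ℤ[α] m) λ r k → 𝒱 r (punchIn h k)

  T : Carrier
  T = product (λ j → α j ^ (l j C 2))
    · product λ i → product λ j →
        if does (i <? j)
        then (α i ⊕ - α j) ^ ((l i * l i) ⊓ (l j * l j))
        else 1#

module Submission where

-- The vector τ of signed maximal minors lies in the kernel of 𝒱, and 𝒱 τ = 0
-- says exactly that the coefficients of t^(L+1), …, t^(L+lⱼ) in B₀ e^(αⱼ t)
-- vanish.  The coefficient of t^N is, up to a unit and a power of αⱼ, the value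
-- at N of a polynomial of degree at most L, so it cannot vanish at L + 1
-- consecutive N unless τ = 0; this bounds the orders of the remainders.
--
-- T divides the minors: let u = αᵢ − αⱼ and k = min(lᵢ, lⱼ).  Multiplied by
-- u^κ and an integer, the first k rows of the blocks i and j become
-- combinations Σ_s u^s c_s W_s of common rows W_s, where κ runs through
-- 0, …, k − 1 in each block.  An alternating multilinear function only sees
-- terms with pairwise different s, so u^(C(2k,2)) divides u^(2 C(k,2)) times an
-- integer times the minor, and C(2k,2) − 2 C(k,2) = k².  The powers of αⱼ arise
-- in the same way, and the factors of T are powers of non-associated primes.
--
-- The last minor is not zero: after taking iterated differences of the rows of
-- the first block, its leading coefficient in α₁ is a non-zero integer times
-- the last minor for (l₂, …, lₘ).

-- The obstacle to the factor αᵢ - αⱼ is that the rows of a block differ in the upper index of a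
-- binomial coefficient, so that rows of two blocks share no obvious common expansion. The identity
-- C(L+k, κ) C(L+a+1, h) = C(L+k, h) C(L-h+k, κ) with κ = k - a - 1 removes it: the first factor on
-- the right is the same for all the rows used, and the second meets the column only through p = L -
-- h, the exponent of the variable. Vandermonde's identity expands C(p+k, κ) in C(p, t) with t ≤ κ,
-- and u^κ pays the u^t that the t-th term needs. The common rows are C(p, s) αⱼ^(p-s), the Taylor
-- coefficients of x^p at αⱼ, weighted by C(L+k, h). The integers C(L+k, κ) do no harm, since αᵢ -
-- αⱼ divides no non-zero integer in ℤ[α].
--
-- Unique factorisation is avoided: each prime generates the kernel of a substitution, and
-- coprimality is used only in the form "X ∣ Y Q implies X ∣ Q". Degrees and orders are claimed as
-- exact numbers, so they are found by bounded search, which is why `IsDomain` includes a decision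
-- of x ≈ 0.

open import Defs
open import Algebra.Bundles using (CommutativeRing; Semiring)
open import Algebra.Bundles.Raw using (RawRing)
import Algebra.Definitions.RawSemiring as RawSemiringDefs
import Algebra.Morphism.Construct.Composition as Composition
open import Algebra.Morphism.Structures using (IsRingHomomorphism)
import Algebra.Properties.CommutativeMonoid.Sum as CommutativeMonoidSum
import Algebra.Properties.CommutativeSemiring.Exp as CommutativeSemiringExp
import Algebra.Properties.Ring as RingProperties
import Algebra.Properties.Semiring.Divisibility as SemiringDivisibility
import Algebra.Properties.Semiring.Mult as SemiringMult
import Algebra.Properties.Semiring.Sum as SemiringSum
import Algebra.Solver.Ring.NaturalCoefficients.Default as RingSolver
open import Algebra.Structures using (IsCommutativeRing)
open import Data.Bool.Base using (if_then_else_)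
open import Data.Fin.Base as Fin using (Fin; zero; suc; toℕ; fromℕ; fromℕ<; inject≤; join; lift;
    opposite; punchIn; punchOut; splitAt; _↑ˡ_; _↑ʳ_)
open import Data.Fin.Properties as Fin using (_≟_; _<?_; <⇒≢; any?; fromℕ<-injective; join-splitAt;
    opposite-prop; pigeonhole; punchIn-injective; punchIn-punchOut; punchInᵢ≢i; splitAt-↑ˡ;
    splitAt-↑ʳ; toℕ-fromℕ<; toℕ-inject≤; toℕ-injective; toℕ-↑ʳ; toℕ<n; toℕ≤pred[n])
open import Data.Integer.Base as ℤ using (ℤ; +_)
import Data.Integer.Properties as ℤ
open import Data.Integer.Solver using () renaming (module +-*-Solver to ℤSolver)
open import Data.Nat.Base as ℕ using (ℕ; zero; suc; s≤s; z≤n; _!)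
open import Data.Nat.Combinatorics using (_C_; k>n⇒nCk≡0; nC1≡n; nCk+nC[k+1]≡[n+1]C[k+1];
    nCk≡nC[n∸k]; nCk≡n!/k![n-k]!; nCn≡1; k![n∸k]!∣n!)
open import Data.Nat.DivMod using (m/n*n≡m)
import Data.Nat.Properties as ℕ
open import Data.Nat.Solver using (module +-*-Solver)
open import Data.Product.Base as Product using (Σ; ∃; _×_; _,_; proj₁; proj₂)
import Data.Rational.Base as ℚ
open ℚ using (ℚ)
import Data.Rational.Properties as ℚ
open import Data.Rational.Unnormalised.Base as ℚᵘ using (mkℚᵘ; *≡*)
import Data.Rational.Unnormalised.Properties as ℚᵘ
open import Data.Sum.Base as Sum using (_⊎_; inj₁; inj₂; map₁; map₂; [_,_]′)
open import Data.Unit.Polymorphic.Base using (⊤; tt)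
open import Data.Vec.Functional as Vector using (Vector; tail)
open import Function.Base using (_∘_; id)
open import Function.Definitions using (Injective)
open import Level using (_⊔_)
open import Relation.Binary.Bundles using (Setoid)
open import Relation.Binary.PropositionalEquality as ≡ using (_≡_; _≢_; _≗_)
import Relation.Binary.Reasoning.Setoid as SetoidReasoning
open import Relation.Nullary using (Dec; yes; no; ¬_; ¬?; contradiction; decidable-stable; does;
    _×-dec_)
open import Relation.Nullary.Decidable using (map′)
open import Relation.Unary using (Decidable)

-- Determinants as alternating multilinear functions of the rows

module Determinants {c ℓ} (R : CommutativeRing c ℓ) where
  open Vector using (_∷_; head)
  open CommutativeRing R hiding (zero)
  open RingProperties ring using (-‿involutive; -1*x≈-x)
  open SemiringSum semiring using (sum; sum-cong-≋; ∑-distrib-+; *-distribˡ-sum; sum-replicate-zero)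
  open CommutativeMonoidSum *-commutativeMonoid public using ()
    renaming ( sum to product ; sum-cong-≋ to product-cong
             ; sum-remove to product-remove ; ∑-distrib-+ to product-* )
  open CommutativeSemiringExp commutativeSemiring using (_^_)
  open SetoidReasoning setoid
  open RingSolver commutativeSemiring using (solve; _:+_; _:*_; _:=_; con)

  sum-zero : ∀ {n} {f : Vector Carrier n} → (∀ i → f i ≈ 0#) → sum f ≈ 0#
  sum-zero {n} e = trans (sum-cong-≋ e) (sum-replicate-zero n)

  Row : ℕ → Set c
  Row k = Vector Carrier k

  Rows : ℕ → ℕ → Set c
  Rows n k = Vector (Row k) n

  infix 4 _≐_ _≐₂_
  _≐_ : ∀ {k} → Row k → Row k → Set ℓ
  v ≐ w = ∀ i → v i ≈ w i

  _≐₂_ : ∀ {n k} → Rows n k → Rows n k → Set ℓ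
  M ≐₂ N = ∀ r → M r ≐ N r

  Functional : ℕ → ℕ → Set c
  Functional n k = Rows n k → Carrier

  Congruent : ∀ {n k} → Functional n k → Set (c ⊔ ℓ)
  Congruent F = ∀ {M N} → M ≐₂ N → F M ≈ F N

  record Linear {k} (f : Row k → Carrier) : Set (c ⊔ ℓ) where
    field
      additive    : ∀ v w → f (λ i → v i + w i) ≈ f v + f w
      homogeneous : ∀ a v → f (λ i → a * v i) ≈ a * f v
  open Linear

  Multilinear : ∀ {n k} → Functional n k → Set (c ⊔ ℓ)
  Multilinear {zero}  F = ⊤
  Multilinear {suc n} F = (∀ N → Linear λ v → F (v ∷ N)) × (∀ v → Multilinear λ N → F (v ∷ N))

  -- Only neighbouring equal rows are mentioned, since this is what Laplace expansion yields by
  -- recursion; arbitrary pairs of equal rows follow in `rows-repeated`.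
  Alternating : ∀ {n k} → Functional n k → Set (c ⊔ ℓ)
  Alternating {zero}        F = ⊤
  Alternating {suc zero}    F = ⊤
  Alternating {suc (suc n)} F =
    (∀ v N → F (v ∷ v ∷ N) ≈ 0#) × (∀ v → Alternating λ N → F (v ∷ N))

  record IsVolume {n k} (F : Functional n k) : Set (c ⊔ ℓ) where
    constructor mkVolume
    field
      cong        : Congruent F
      multilinear : Multilinear F
      alternating : Alternating F

  ∷-cong : ∀ {n k} {v w : Row k} {M N : Rows n k} → v ≐ w → M ≐₂ N → (v ∷ M) ≐₂ (w ∷ N)
  ∷-cong e f zero    = e
  ∷-cong e f (suc r) = f r

  ∷-η : ∀ {n k} (M : Rows (suc n) k) → (head M ∷ tail M) ≐₂ M
  ∷-η M zero    i = refl
  ∷-η M (suc r) i = refl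

  fix : ∀ {n k} {F : Functional (suc n) k} → IsVolume F → ∀ v → IsVolume (λ N → F (v ∷ N))
  fix {zero} (mkVolume c m a) v = mkVolume (λ e → c (∷-cong (λ _ → refl) e)) (proj₂ m v) tt
  fix {suc n} (mkVolume c m a) v =
    mkVolume (λ e → c (∷-cong (λ _ → refl) e)) (proj₂ m v) (proj₂ a v)

  module _ {k} {f : Row k → Carrier} (f-cong : ∀ {v w} → v ≐ w → f v ≈ f w) (lin : Linear f) where
    linear-zero : f (λ _ → 0#) ≈ 0#
    linear-zero = begin
      f (λ _ → 0#)        ≈⟨ f-cong (λ i → zeroˡ 0#) ⟨
      f (λ _ → 0# * 0#)   ≈⟨ homogeneous lin 0# (λ _ → 0#) ⟩
      0# * f (λ _ → 0#)   ≈⟨ zeroˡ _ ⟩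
      0#                  ∎

    linear-sum : ∀ {K} (a : Vector Carrier K) (v : Vector (Row k) K) →
                 f (λ i → sum λ s → a s * v s i) ≈ sum λ s → a s * f (v s)
    linear-sum {zero}  a v = linear-zero
    linear-sum {suc K} a v = begin
      f (λ i → a zero * v zero i + sum λ s → a (suc s) * v (suc s) i)
        ≈⟨ additive lin _ _ ⟩
      f (λ i → a zero * v zero i) + f (λ i → sum λ s → a (suc s) * v (suc s) i)
        ≈⟨ +-cong (homogeneous lin _ _) (linear-sum (a ∘ suc) (v ∘ suc)) ⟩
      a zero * f (v zero) + sum (λ s → a (suc s) * f (v (suc s))) ∎

  -- For a fixed first row, Laplace expansion presents a minor as such a combination of smaller
  -- minors of the remaining rows, so the properties of minors follow by recursion.
  combination-multilinear : ∀ {n k K} (a : Vector Carrier K) (F : Fin K → Functional n k) →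
    (∀ s → Multilinear (F s)) → Multilinear λ N → sum λ s → a s * F s N
  combination-multilinear {zero}  a F m = tt
  combination-multilinear {suc n} {K = K} a F m = lin , λ v →
    combination-multilinear a (λ s N → F s (v ∷ N)) (λ s → proj₂ (m s) v)
    where
    lin : ∀ N → Linear λ v → sum λ s → a s * F s (v ∷ N)
    additive (lin N) v w = begin
      sum (λ s → a s * F s ((λ i → v i + w i) ∷ N))
        ≈⟨ sum-cong-≋ {n = K} (λ s → trans (*-congˡ (additive (proj₁ (m s) N) v w))
            (distribˡ _ _ _)) ⟩
      sum (λ s → a s * F s (v ∷ N) + a s * F s (w ∷ N))
        ≈⟨ ∑-distrib-+ {n = K} (λ s → a s * F s (v ∷ N)) (λ s → a s * F s (w ∷ N)) ⟩
      sum (λ s → a s * F s (v ∷ N)) + sum (λ s → a s * F s (w ∷ N)) ∎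
    homogeneous (lin N) b v = begin
      sum (λ s → a s * F s ((λ i → b * v i) ∷ N))
        ≈⟨ sum-cong-≋ {n = K} (λ s → trans (*-congˡ (homogeneous (proj₁ (m s) N) b v))
             (solve 3 (λ x y z → x :* (y :* z) := y :* (x :* z)) refl (a s) b _)) ⟩
      sum (λ s → b * (a s * F s (v ∷ N))) ≈⟨ *-distribˡ-sum {n = K} b (λ s → a s * F s (v ∷ N)) ⟨
      b * sum (λ s → a s * F s (v ∷ N)) ∎

  combination-alternating : ∀ {n k K} (a : Vector Carrier K) (F : Fin K → Functional n k) →
    (∀ s → Alternating (F s)) → Alternating λ N → sum λ s → a s * F s N
  combination-alternating {zero}        a F m = tt
  combination-alternating {suc zero}    a F m = tt
  combination-alternating {suc (suc n)} {K = K} a F m =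
    (λ v N → sum-zero {n = K} λ s → trans (*-congˡ (proj₁ (m s) v N)) (zeroʳ _)) ,
    λ v → combination-alternating a (λ s N → F s (v ∷ N)) (λ s → proj₂ (m s) v)

  det-cong : ∀ {n} {M N : Rows n n} → M ≐₂ N → det rawRing M ≈ det rawRing N
  det-cong {zero}  e = refl
  det-cong {suc n} e = sum-cong-≋ λ k →
    *-congˡ {x = (- 1#) ^ toℕ k} (*-cong (e zero k) (det-cong λ r c → e (suc r) (punchIn k c)))

  -- `σ` selects the columns. Deleting a column is composition with `punchIn i`, so all submatrices
  -- met in a Laplace expansion are again minors of the same rows.
  minor : ∀ {n k} → (Fin n → Fin k) → Functional n k
  minor σ M = det rawRing λ r i → M r (σ i)

  minor-cong : ∀ {n k} (σ : Fin n → Fin k) → Congruent (minor σ)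
  minor-cong σ e = det-cong λ r i → e r (σ i)

  sign : ∀ {n} → Fin n → Carrier
  sign i = (- 1#) ^ toℕ i

  minor-∷ : ∀ {n k} (σ : Fin (suc n) → Fin k) v N →
            sum {suc n} (λ i → (sign i * v (σ i)) * minor (σ ∘ punchIn i) N) ≈ minor σ (v ∷ N)
  minor-∷ {n} σ v N = sum-cong-≋ {n = suc n} λ i →
    *-assoc (sign i) (v (σ i)) (minor (σ ∘ punchIn i) N)

  multilinear-resp : ∀ {n k} {F G : Functional n k} → (∀ N → F N ≈ G N) → Multilinear F →
    Multilinear G
  multilinear-resp {zero}  e m = tt
  multilinear-resp {suc n} {F = F} {G} e (lin , m) =
    lin′ , λ v → multilinear-resp (λ N → e (v ∷ N)) (m v)
    where
    lin′ : ∀ N → Linear λ v → G (v ∷ N)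
    additive    (lin′ N) v w =
      trans (sym (e _)) (trans (additive (lin N) v w) (+-cong (e _) (e _)))
    homogeneous (lin′ N) a v =
      trans (sym (e _)) (trans (homogeneous (lin N) a v) (*-congˡ (e _)))

  alternating-resp : ∀ {n k} {F G : Functional n k} → (∀ N → F N ≈ G N) → Alternating F →
    Alternating G
  alternating-resp {zero}        e a = tt
  alternating-resp {suc zero}    e a = tt
  alternating-resp {suc (suc n)} e (z , a) =
    (λ v N → trans (sym (e _)) (z v N)) , λ v → alternating-resp (λ N → e (v ∷ N)) (a v)

  minor-multilinear : ∀ {n k} (σ : Fin n → Fin k) → Multilinear (minor σ)
  minor-multilinear {zero}  σ = tt
  minor-multilinear {suc n} σ = lin , λ v →
    multilinear-resp (minor-∷ σ v)
      (combination-multilinear (λ i → sign i * v (σ i)) (λ i → minor (σ ∘ punchIn i))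
        λ i → minor-multilinear (σ ∘ punchIn i))
    where
    lin : ∀ N → Linear λ v → minor σ (v ∷ N)
    additive (lin N) v w = begin
      sum {suc n} (λ i → sign i * ((v (σ i) + w (σ i)) * D i))
        ≈⟨ sum-cong-≋ {n = suc n} (λ i → solve 4 (λ s x y d → s :* ((x :+ y) :* d) :=
             s :* (x :* d) :+ s :* (y :* d)) refl (sign i) (v (σ i)) (w (σ i)) (D i)) ⟩
      sum {suc n} (λ i → sign i * (v (σ i) * D i) + sign i * (w (σ i) * D i))
        ≈⟨ ∑-distrib-+ {n = suc n} (λ i → sign i * (v (σ i) * D i))
            (λ i → sign i * (w (σ i) * D i)) ⟩
      sum {suc n} (λ i → sign i * (v (σ i) * D i)) + sum {suc n} (λ i → sign i * (w (σ i) * D i)) ∎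
      where D = λ i → minor (σ ∘ punchIn i) N
    homogeneous (lin N) b v = begin
      sum {suc n} (λ i → sign i * (b * v (σ i) * D i))
        ≈⟨ sum-cong-≋ {n = suc n} (λ i → solve 4 (λ s b x d → s :* (b :* x :* d) :=
             b :* (s :* (x :* d))) refl (sign i) b (v (σ i)) (D i)) ⟩
      sum {suc n} (λ i → b * (sign i * (v (σ i) * D i)))
        ≈⟨ *-distribˡ-sum {n = suc n} b (λ i → sign i * (v (σ i) * D i)) ⟨
      b * sum {suc n} (λ i → sign i * (v (σ i) * D i)) ∎
      where D = λ i → minor (σ ∘ punchIn i) N

  -- Column selections are functions that are known to agree only pointwise, so the cofactors have
  -- to be assumed to respect this.
  Respectful : ∀ {n k} → ((Fin n → Fin k) → Carrier) → Set ℓ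
  Respectful H = ∀ {σ τ} → σ ≗ τ → H σ ≈ H τ

  -- This identifies the terms that avoid column 0 twice with a double expansion on one column less,
  -- whose cofactors are composed with `lift 1`.
  lift-punchIn : ∀ {n} (i : Fin (suc (suc n))) (j : Fin (suc n)) →
    punchIn (suc i) ∘ punchIn (suc j) ≗ lift 1 (punchIn i ∘ punchIn j)
  lift-punchIn i j zero    = ≡.refl
  lift-punchIn i j (suc c) = ≡.refl

  -- The terms with (i , j) and (punchIn i j , …) of the double Laplace
  -- expansion cancel; pairs involving column 0 are matched directly and the
  -- others are handled by induction on the number of columns.
  double-expansion : ∀ {n} (v : Row (suc (suc n))) (H : (Fin n → Fin (suc (suc n))) → Carrier) →
    Respectful H →
    sum {suc (suc n)} (λ i → sum {suc n} λ j →
      (sign i * sign j) * ((v i * v (punchIn i j)) * H (punchIn i ∘ punchIn j))) ≈ 0#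
  double-expansion {n} v H H-resp = begin
    sum {suc n} (λ j → t zero j) + sum {suc n} (λ i → sum {suc n} λ j → t (suc i) j)
      ≈⟨ +-congˡ {x = sum {suc n} (λ j → t zero j)}
          (∑-distrib-+ {n = suc n} (λ i → t (suc i) zero) (λ i → sum {n} λ j → t (suc i) (suc j))) ⟩
    sum {suc n} (λ j → t zero j) + (sum {suc n} (λ i → t (suc i) zero) + sum {suc n}
      (λ i → sum {n} λ j → t (suc i) (suc j)))
      ≈⟨ +-assoc (sum {suc n} (λ j → t zero j)) _ _ ⟨
    (sum {suc n} (λ j → t zero j) + sum {suc n} (λ i → t (suc i) zero)) + sum {suc n}
      (λ i → sum {n} λ j → t (suc i) (suc j))
      ≈⟨ +-cong (trans (sym (∑-distrib-+ {n = suc n} (t zero) (λ i → t (suc i) zero)))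
          (sum-zero {suc n} cancel)) (rest n H H-resp v) ⟩
    0# + 0# ≈⟨ +-identityˡ 0# ⟩
    0# ∎
    where
    t : Fin (suc (suc n)) → Fin (suc n) → Carrier
    t i j = (sign i * sign j) * ((v i * v (punchIn i j)) * H (punchIn i ∘ punchIn j))

    cancel : ∀ i → t zero i + t (suc i) zero ≈ 0#
    cancel i = begin
      (1# * s) * ((v zero * v (suc i)) * h) + ((- 1# * s) * 1#) *
        ((v (suc i) * v zero) * H (punchIn (suc i) ∘ suc))
        ≈⟨ +-congˡ (*-congˡ (*-congˡ (H-resp {punchIn (suc i) ∘ suc} {suc ∘ punchIn i} λ _ →
            ≡.refl))) ⟩
      (1# * s) * ((v zero * v (suc i)) * h) + ((- 1# * s) * 1#) * ((v (suc i) * v zero) * h)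
        ≈⟨ solve 5 (λ m s x y h → (con 1 :* s) :* ((x :* y) :* h) :+ ((m :* s) :* con 1) :*
            ((y :* x) :* h)
             := (con 1 :+ m) :* (s :* (x :* y :* h))) refl (- 1#) s (v zero) (v (suc i)) h ⟩
      (1# + - 1#) * (s * (v zero * v (suc i) * h)) ≈⟨ *-congʳ (-‿inverseʳ 1#) ⟩
      0# * (s * (v zero * v (suc i) * h)) ≈⟨ zeroˡ _ ⟩
      0# ∎
      where
      s = sign i
      h = H (suc ∘ punchIn i)

    rest : ∀ n (H : (Fin n → Fin (suc (suc n))) → Carrier) → Respectful H →
      (v : Row (suc (suc n))) →
      sum {suc n} (λ i → sum {n} λ j → (sign (suc i) * sign (suc j)) *
        ((v (suc i) * v (suc (punchIn i j))) * H (punchIn (suc i) ∘ punchIn (suc j)))) ≈ 0#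
    rest zero    H H-resp v = sum-zero {1} λ i → refl
    rest (suc n) H H-resp v = trans
      (sum-cong-≋ {n = suc (suc n)} λ i → sum-cong-≋ {n = suc n} λ j → trans
        (*-cong (solve 3 (λ m s t → (m :* s) :* (m :* t) := (m :* m) :* (s :* t)) refl (- 1#)
          (sign i) (sign j))
                (*-congˡ {x = v (suc i) * v (suc (punchIn i j))} (H-resp (lift-punchIn i j))))
        (trans (*-congʳ (trans (*-congʳ (trans (-1*x≈-x (- 1#)) (-‿involutive 1#)))
          (*-identityˡ _))) refl))
      (double-expansion {n} (v ∘ suc) (λ e → H (lift 1 e))
        λ {e} {e′} eq → H-resp {lift 1 e} {lift 1 e′}
          λ { zero → ≡.refl ; (suc c) → ≡.cong suc (eq c) })

  minor-alternating : ∀ {n k} (σ : Fin n → Fin k) → Alternating (minor σ)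
  minor-alternating {zero}        σ = tt
  minor-alternating {suc zero}    σ = tt
  minor-alternating {suc (suc n)} σ = twice , λ v →
    alternating-resp (minor-∷ σ v)
      (combination-alternating (λ i → sign i * v (σ i)) (λ i → minor (σ ∘ punchIn i))
        λ i → minor-alternating (σ ∘ punchIn i))
    where
    twice : ∀ v N → minor σ (v ∷ v ∷ N) ≈ 0#
    twice v N = trans
      (sum-cong-≋ {n = suc (suc n)} λ i → trans
        (sym (*-assoc (sign i) (v (σ i)) (minor (σ ∘ punchIn i) (v ∷ N))))
        (trans (*-distribˡ-sum {n = suc n} (sign i * v (σ i))
          (λ j → sign j * (v (σ (punchIn i j)) * minor (σ ∘ punchIn i ∘ punchIn j) N)))
          (sum-cong-≋ {n = suc n} λ j → solve 5 (λ s x t y d → (s :* x) :* (t :* (y :* d)) :=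
             (s :* t) :* ((x :* y) :* d)) refl (sign i) (v (σ i)) (sign j) (v (σ (punchIn i j)))
               (minor (σ ∘ punchIn i ∘ punchIn j) N))))
      (double-expansion {n} (v ∘ σ) (λ e → minor (σ ∘ e) N)
        λ {e} {e′} eq → det-cong λ r c → reflexive (≡.cong (λ x → N r (σ x)) (eq c)))

  minor-volume : ∀ {n k} (σ : Fin n → Fin k) → IsVolume (minor σ)
  minor-volume σ = mkVolume (minor-cong σ) (minor-multilinear σ) (minor-alternating σ)

-- Row operations on alternating multilinear functions

module Volumes {c ℓ} (R : CommutativeRing c ℓ) where
  open Vector using (_∷_; head)
  open CommutativeRing R hiding (zero)
  open Determinants R
  open IsVolume
  open Linear
  open RingProperties ring using (+-inverseˡ-unique; -0#≈0#)
  open SemiringSum semiring using (sum; sum-cong-≋; *-distribˡ-sum)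
  open SemiringDivisibility semiring using (_∣_; _,_; ∣ʳ-respʳ-≈; _∣0)
  open SetoidReasoning setoid
  open RingSolver commutativeSemiring using (solve; _:*_; _:=_)

  private
    ≐-refl : ∀ {k} {v : Row k} → v ≐ v
    ≐-refl i = refl

    ≐₂-refl : ∀ {n k} {M : Rows n k} → M ≐₂ M
    ≐₂-refl r i = refl

  -- Expand `F` with the row v + w in both places: the value is 0, and so are the two terms with
  -- equal rows.
  swap-rows : ∀ {n k} {F : Functional (suc (suc n)) k} → IsVolume F →
              ∀ v w N → F (v ∷ w ∷ N) ≈ - F (w ∷ v ∷ N)
  swap-rows {F = F} vol v w N = +-inverseˡ-unique _ _ (begin
    G v w + G w v
      ≈⟨ +-cong (+-identityˡ _) (+-identityʳ _) ⟨
    (0# + G v w) + (G w v + 0#)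
      ≈⟨ +-cong (+-congʳ (G-alt v)) (+-congˡ (G-alt w)) ⟨
    (G v v + G v w) + (G w v + G w w)
      ≈⟨ +-cong (G-add v) (G-add w) ⟨
    G v (v ⊕ w) + G w (v ⊕ w)
      ≈⟨ additive (proj₁ (multilinear vol) ((v ⊕ w) ∷ N)) v w ⟨
    G (v ⊕ w) (v ⊕ w)
      ≈⟨ G-alt (v ⊕ w) ⟩
    0# ∎)
    where
    _⊕_ = λ (x y : Row _) i → x i + y i
    G = λ x y → F (x ∷ y ∷ N)
    G-alt = λ x → proj₁ (alternating vol) x N
    G-add = λ x → additive (proj₁ (proj₂ (multilinear vol) x) N) v w

  ∷∷-η : ∀ {n k} (M : Rows (suc (suc n)) k) → M ≐₂ (M zero ∷ M (suc zero) ∷ tail (tail M))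
  ∷∷-η M zero          i = refl
  ∷∷-η M (suc zero)    i = refl
  ∷∷-η M (suc (suc r)) i = refl

  -- The first row is swapped downwards, one neighbour at a time, until it meets its copy; the row
  -- that it passes is then fixed.
  first-row-repeated : ∀ {n k} {F : Functional (suc n) k} → IsVolume F →
    ∀ M j → M zero ≐ M (suc j) → F M ≈ 0#
  first-row-repeated {suc n} {F = F} vol M zero    e = begin
    F M                                        ≈⟨ cong vol (∷∷-η M) ⟩
    F (M zero ∷ M (suc zero) ∷ tail (tail M))
      ≈⟨ cong vol (∷-cong ≐-refl (∷-cong (λ i → sym (e i)) ≐₂-refl)) ⟩
    F (M zero ∷ M zero ∷ tail (tail M))        ≈⟨ proj₁ (alternating vol) _ _ ⟩
    0#                                         ∎
  first-row-repeated {suc n} {F = F} vol M (suc j) e = begin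
    F M                                         ≈⟨ cong vol (∷∷-η M) ⟩
    F (M zero ∷ M (suc zero) ∷ tail (tail M))   ≈⟨ swap-rows vol _ _ _ ⟩
    - F (M (suc zero) ∷ M zero ∷ tail (tail M))
      ≈⟨ -‿cong (first-row-repeated (fix vol (M (suc zero))) (M zero ∷ tail (tail M)) j e) ⟩
    - 0#                                        ≈⟨ -0#≈0# ⟩
    0#                                          ∎

  rows-repeated : ∀ {n k} {F : Functional n k} → IsVolume F →
    ∀ M i j → i ≢ j → M i ≐ M j → F M ≈ 0#
  rows-repeated vol M zero    zero    i≢j e = contradiction ≡.refl i≢j
  rows-repeated vol M zero    (suc j) i≢j e = first-row-repeated vol M j e
  rows-repeated vol M (suc i) zero    i≢j e = first-row-repeated vol M i (λ h → sym (e h))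
  rows-repeated vol M (suc i) (suc j) i≢j e = trans (sym (cong vol (∷-η M)))
    (rows-repeated (fix vol (head M)) (tail M) i j (i≢j ∘ ≡.cong suc) e)

  scale-rows : ∀ {n k} {F : Functional n k} → IsVolume F → ∀ (e : Vector Carrier n) M →
    F (λ r i → e r * M r i) ≈ product e * F M
  scale-rows {zero} vol e M = trans (cong vol (λ ())) (sym (*-identityˡ _))
  scale-rows {suc n} {F = F} vol e M = begin
    F (λ r i → e r * M r i)
      ≈⟨ cong vol (∷-η (λ r i → e r * M r i)) ⟨
    F ((λ i → e zero * M zero i) ∷ (λ r i → e (suc r) * M (suc r) i))
      ≈⟨ homogeneous (proj₁ (multilinear vol) _) (e zero) (M zero) ⟩
    e zero * F (M zero ∷ (λ r i → e (suc r) * M (suc r) i))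
      ≈⟨ *-congˡ (scale-rows (fix vol (M zero)) (e ∘ suc) (tail M)) ⟩
    e zero * (product (e ∘ suc) * F (M zero ∷ tail M))
      ≈⟨ *-assoc _ _ _ ⟨
    product e * F (M zero ∷ tail M)
      ≈⟨ *-congˡ (cong vol (∷-η M)) ⟩
    product e * F M ∎

  -- Multilinearity is available in the rows only, so this goes through Laplace expansion: the entry
  -- of the first row supplies the factor of the deleted column, and `product-remove` restores the
  -- full product.
  scale-columns : ∀ {n} (d : Vector Carrier n) (M : Rows n n) →
    det rawRing (λ r i → d i * M r i) ≈ product d * det rawRing M
  scale-columns {zero}  d M = sym (*-identityˡ 1#)
  scale-columns {suc n} d M = begin
    sum {suc n} (λ k → sign k * (d k * M zero k * det rawRing
      (λ r i → d (punchIn k i) * M (suc r) (punchIn k i))))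
      ≈⟨ sum-cong-≋ {n = suc n} (λ k → *-congˡ {x = sign k} (*-congˡ {x = d k * M zero k}
           (scale-columns (d ∘ punchIn k) (λ r i → M (suc r) (punchIn k i))))) ⟩
    sum {suc n} (λ k → sign k * (d k * M zero k * (product (d ∘ punchIn k) * D k)))
      ≈⟨ sum-cong-≋ {n = suc n} (λ k → solve 5
          (λ s x m p y → s :* (x :* m :* (p :* y)) := (x :* p) :* (s :* (m :* y)))
           refl (sign k) (d k) (M zero k) (product (d ∘ punchIn k)) (D k)) ⟩
    sum {suc n} (λ k → (d k * product (d ∘ punchIn k)) * (sign k * (M zero k * D k)))
      ≈⟨ sum-cong-≋ {n = suc n} (λ k → *-congʳ {x = sign k * (M zero k * D k)}
          (product-remove {i = k} d)) ⟨
    sum {suc n} (λ k → product d * (sign k * (M zero k * D k)))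
      ≈⟨ *-distribˡ-sum {n = suc n} (product d) (λ k → sign k * (M zero k * D k)) ⟨
    product d * det rawRing M ∎
    where D = λ k → det rawRing (λ r i → M (suc r) (punchIn k i))

  -- The sum is the Laplace expansion of the square matrix in which row `r` is repeated on top.
  maximal-minors-in-kernel : ∀ {n} (M : Rows n (suc n)) r →
    sum {suc n} (λ k → sign k * (M r k * minor (punchIn k) M)) ≈ 0#
  maximal-minors-in-kernel M r =
    first-row-repeated (minor-volume id) (M r ∷ M) r ≐-refl

  ∣-sum : ∀ {n d} (f : Vector Carrier n) → (∀ i → d ∣ f i) → d ∣ sum f
  ∣-sum {zero}  {d} f h = d ∣0
  ∣-sum {suc n} {d} f h with h zero | ∣-sum (f ∘ suc) (h ∘ suc)
  ... | q , e | q′ , e′ = q + q′ , trans (distribʳ d q q′) (+-cong e e′)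

  module _ {k K : ℕ} {d : Carrier} where
    -- Expand the rows one after the other. `c` collects the coefficients of the rows already
    -- expanded and `φ` records the summand chosen in each row; stating only divisibility avoids a
    -- sum over all `φ`.
    ∣-expansion : ∀ {n} {F : Functional n k} → IsVolume F → ∀ c
      (a : Fin n → Fin K → Carrier) (V : Fin n → Fin K → Row k) (M : Rows n k) →
      (∀ r → M r ≐ λ i → sum λ s → a r s * V r s i) →
      (∀ (φ : Fin n → Fin K) → d ∣ (c * product λ r → a r (φ r)) * F λ r → V r (φ r)) →
      d ∣ c * F M
    ∣-expansion {zero} vol c a V M e h =
      ∣ʳ-respʳ-≈ (*-cong (*-identityʳ c) (cong vol λ ())) (h λ ())
    ∣-expansion {suc n} {F} vol c a V M e h = ∣ʳ-respʳ-≈ (sym (begin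
      c * F M
        ≈⟨ *-congˡ (trans (sym (cong vol (∷-η M))) (cong vol (∷-cong (e zero) ≐₂-refl))) ⟩
      c * F ((λ i → sum λ s → a zero s * V zero s i) ∷ tail M)
        ≈⟨ *-congˡ (linear-sum (λ eq → cong vol (∷-cong eq ≐₂-refl))
            (proj₁ (multilinear vol) (tail M)) (a zero) (V zero)) ⟩
      c * sum (λ s → a zero s * F (V zero s ∷ tail M))
        ≈⟨ *-distribˡ-sum {n = K} c (λ s → a zero s * F (V zero s ∷ tail M)) ⟩
      sum (λ s → c * (a zero s * F (V zero s ∷ tail M)))
        ≈⟨ sum-cong-≋ {n = K} (λ s → *-assoc c (a zero s) (F (V zero s ∷ tail M))) ⟨
      sum (λ s → (c * a zero s) * F (V zero s ∷ tail M)) ∎))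
      (∣-sum {n = K} _ λ s → ∣-expansion (fix vol (V zero s)) (c * a zero s) (a ∘ suc) (V ∘ suc)
        (tail M) (e ∘ suc)
        λ φ → ∣ʳ-respʳ-≈ (*-cong (sym (*-assoc c (a zero s) _)) (cong vol (∷-η′ s φ))) (h (s ∷ φ)))
      where
      ∷-η′ : ∀ s φ → (λ r → V r ((s ∷ φ) r)) ≐₂ (V zero s ∷ λ r → V (suc r) (φ r))
      ∷-η′ s φ zero    i = refl
      ∷-η′ s φ (suc r) i = refl

  -- The rows `A` are indexed by ℕ, so that shifts and iterated differences never leave the index
  -- range.
  stack : ∀ {b k} a → (ℕ → Row k) → Rows b k → Rows (a ℕ.+ b) k
  stack zero    A N = N
  stack (suc a) A N = A 0 ∷ stack a (A ∘ suc) N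

  stack-splitAt : ∀ {b k} a A (N : Rows b k) r → stack a A N r ≡ [ A ∘ toℕ , N ]′ (splitAt a r)
  stack-splitAt zero    A N r       = ≡.refl
  stack-splitAt (suc a) A N zero    = ≡.refl
  stack-splitAt (suc a) A N (suc r) with splitAt a r | stack-splitAt a (A ∘ suc) N r
  ... | inj₁ i | e = e
  ... | inj₂ i | e = e

  stack-map : ∀ {b k k′} a A (N : Rows b k) (σ : Fin k′ → Fin k) →
    (λ r → stack a A N r ∘ σ) ≐₂ stack a (λ i → A i ∘ σ) (λ r → N r ∘ σ)
  stack-map zero    A N σ r       i = refl
  stack-map (suc a) A N σ zero    i = refl
  stack-map (suc a) A N σ (suc r) i = stack-map a (A ∘ suc) N σ r i

  -- The work goes from the bottom up: `A i` is still present when `A (suc i)` is replaced by its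
  -- difference to it.
  adjacent-differences : ∀ {b k} a {F : Functional (suc a ℕ.+ b) k} → IsVolume F →
    ∀ (A D : ℕ → Row k) N → (∀ i → A (suc i) ≐ λ h → A i h + D i h) →
    F (stack (suc a) A N) ≈ F (A 0 ∷ stack a D N)
  adjacent-differences zero    vol A D N e = refl
  adjacent-differences (suc a) {F} vol A D N e = begin
    F (A 0 ∷ A 1 ∷ stack a (λ i → A (suc (suc i))) N)
      ≈⟨ adjacent-differences a (fix vol (A 0)) (A ∘ suc) (D ∘ suc) N (e ∘ suc) ⟩
    F (A 0 ∷ A 1 ∷ rest)
      ≈⟨ cong vol (∷-cong ≐-refl (∷-cong (e 0) ≐₂-refl)) ⟩
    F (A 0 ∷ (λ h → A 0 h + D 0 h) ∷ rest)
      ≈⟨ additive (proj₁ (proj₂ (multilinear vol) (A 0)) rest) (A 0) (D 0) ⟩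
    F (A 0 ∷ A 0 ∷ rest) + F (A 0 ∷ D 0 ∷ rest)
      ≈⟨ +-congʳ (proj₁ (alternating vol) (A 0) rest) ⟩
    0# + F (A 0 ∷ D 0 ∷ rest) ≈⟨ +-identityˡ _ ⟩
    F (A 0 ∷ D 0 ∷ rest) ∎
    where rest = stack a (D ∘ suc) N

  -- `q i` is the i-th difference of `q 0`. One round of subtractions leaves the first row and turns
  -- the others into first differences, to which the recursion applies.
  iterated-differences : ∀ {b k} a {F : Functional (a ℕ.+ b) k} → IsVolume F →
    ∀ (q : ℕ → ℕ → Row k) N → (∀ i z → q i (suc z) ≐ λ h → q i z h + q (suc i) z h) →
    ∀ z → F (stack a (λ i → q 0 (i ℕ.+ z)) N) ≈ F (stack a (λ i → q i z) N)
  iterated-differences zero    vol q N e z = refl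
  iterated-differences (suc a) {F} vol q N e z = trans
    (adjacent-differences a vol (λ i → q 0 (i ℕ.+ z)) (λ i → q 1 (i ℕ.+ z)) N λ i → e 0 (i ℕ.+ z))
    (iterated-differences a (fix vol (q 0 z)) (q ∘ suc) N (e ∘ suc) z)

  -- Each of the first `a` rows has at most one non-zero entry, so its Laplace expansion has a
  -- single term. The entries of `N` in the first `a` columns are deleted on the way and may be
  -- arbitrary.
  det-diagonal-block : ∀ {b} a (A : ℕ → Row (a ℕ.+ b)) (N : Rows b (a ℕ.+ b)) (u : ℕ → Carrier) →
    (∀ i h → toℕ h ≢ i → A i h ≈ 0#) → (∀ i h → toℕ h ≡ i → A i h ≈ u i) →
    det rawRing (stack a A N) ≈ product {a} (u ∘ toℕ) * det rawRing (λ r i → N r (a ↑ʳ i))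
  det-diagonal-block zero    A N u off on = sym (*-identityˡ _)
  det-diagonal-block {b} (suc a) A N u off on = begin
    1# * (A 0 zero * D zero) + sum {a ℕ.+ b} (λ k → sign (suc k) * (A 0 (suc k) * D (suc k)))
      ≈⟨ +-cong (trans (*-identityˡ _) (*-cong (on 0 zero ≡.refl) ih))
           (sum-zero {a ℕ.+ b} λ k → trans (*-congˡ
             (trans (*-congʳ (off 0 (suc k) λ ())) (zeroˡ _))) (zeroʳ _)) ⟩
    u 0 * (product {a} (u ∘ suc ∘ toℕ) * det rawRing (λ r i → N r (suc a ↑ʳ i))) + 0#
      ≈⟨ trans (+-identityʳ _) (sym (*-assoc _ _ _)) ⟩
    (u 0 * product {a} (u ∘ suc ∘ toℕ)) * det rawRing (λ r i → N r (suc a ↑ʳ i)) ∎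
    where
    D = λ k → det rawRing (λ r i → stack a (A ∘ suc) N r (punchIn k i))
    ih = trans (det-cong (stack-map a (A ∘ suc) N suc))
      (det-diagonal-block a (λ i → A (suc i) ∘ suc) (λ r → N r ∘ suc) (u ∘ suc)
        (λ i h ne → off (suc i) (suc h) (ne ∘ ℕ.suc-injective))
          (λ i h eq → on (suc i) (suc h) (≡.cong suc eq)))

-- Sums of pairwise different exponents

module _ where
  open CommutativeMonoidSum ℕ.+-0-commutativeMonoid using (sum-remove)

  injective⇒some-large : ∀ {q} (φ : Vector ℕ (suc q)) → Injective _≡_ _≡_ φ → ∃ λ i → q ℕ.≤ φ i
  injective⇒some-large {q} φ inj with any? (λ i → q ℕ.≤? φ i)
  ... | yes found = found
  ... | no  none  = contradiction (inj (fromℕ<-injective _ _ (bound i) (bound j) eq)) (<⇒≢ i<j)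
    where
    bound : ∀ i → φ i ℕ.< q
    bound i = ℕ.≰⇒> λ q≤φi → none (i , q≤φi)
    collision = pigeonhole (ℕ.n<1+n q) (λ i → fromℕ< (bound i))
    i = proj₁ collision
    j = proj₁ (proj₂ collision)
    i<j = proj₁ (proj₂ (proj₂ collision))
    eq = proj₂ (proj₂ (proj₂ collision))

  -- Among q + 1 different values one is at least q; removing it leaves q different values, and the
  -- bounds q, q - 1, ..., 0 add up.
  injective⇒qC2≤total : ∀ {q} (φ : Vector ℕ q) → Injective _≡_ _≡_ φ → q C 2 ℕ.≤ total φ
  injective⇒qC2≤total {zero}  φ inj = z≤n
  injective⇒qC2≤total {suc q} φ inj with injective⇒some-large φ inj
  ... | i , q≤φi = begin
    suc q C 2                            ≡⟨ nCk+nC[k+1]≡[n+1]C[k+1] q 1 ⟨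
    q C 1 ℕ.+ q C 2                      ≡⟨ ≡.cong (ℕ._+ q C 2) (nC1≡n q) ⟩
    q ℕ.+ q C 2
      ≤⟨ ℕ.+-mono-≤ q≤φi (injective⇒qC2≤total (φ ∘ punchIn i) (punchIn-injective i _ _ ∘ inj)) ⟩
    φ i ℕ.+ total (φ ∘ punchIn i)        ≡⟨ sum-remove {i = i} φ ⟨
    total φ                              ∎
    where open ℕ.≤-Reasoning

module _ {a} {X : Set a} {q n} (ρ : Fin q → Fin n) (f : Fin q → X) (d : Fin n → X) where
  -- Serves to extend the expansion of some chosen rows of a matrix to all its rows, with a trivial
  -- expansion elsewhere.
  extend : Fin n → X
  extend r with any? (λ k → ρ k ≟ r)
  ... | yes (k , _) = f k
  ... | no  _       = d r

  extend-image : Injective _≡_ _≡_ ρ → ∀ k → extend (ρ k) ≡ f k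
  extend-image inj k with any? (λ i → ρ i ≟ ρ k)
  ... | yes (i , e) = ≡.cong f (inj e)
  ... | no  none    = contradiction (k , ≡.refl) none

  extend-outside : ∀ r → (∀ k → ρ k ≢ r) → extend r ≡ d r
  extend-outside r out with any? (λ k → ρ k ≟ r)
  ... | yes (k , e) = contradiction e (out k)
  ... | no  _       = ≡.refl

  extend-elim : ∀ {p} (P : Fin n → X → Set p) →
    (∀ k → P (ρ k) (f k)) → (∀ r → P r (d r)) → ∀ r → P r (extend r)
  extend-elim P onImage onOthers r with any? (λ k → ρ k ≟ r)
  ... | yes (k , ≡.refl) = onImage k
  ... | no  _            = onOthers r

-- Divisibility by powers from weighted expansions of the rows

module Weights {c ℓ} (R : CommutativeRing c ℓ) where
  open CommutativeRing R hiding (zero)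
  open Determinants R
  open Volumes R
  open IsVolume
  open SemiringSum semiring using (sum)
  open CommutativeMonoidSum *-commutativeMonoid using () renaming
      (sum-replicate-zero to product-replicate-1)
  open CommutativeSemiringExp commutativeSemiring using (_^_; ^-homo-*)
  open SemiringDivisibility semiring using (_∣_; module _∣ʳ_; _,_; ∣ʳ-respʳ-≈; _∣0)
  open SetoidReasoning setoid
  open RingSolver commutativeSemiring using (solve; _:*_; _:=_)

  product-^ : ∀ {n} u (φ : Vector ℕ n) → product (λ i → u ^ φ i) ≈ u ^ total φ
  product-^ {zero}  u φ = refl
  product-^ {suc n} u φ = trans (*-congˡ (product-^ u (φ ∘ suc))) (sym (^-homo-* u (φ zero) _))

  ^-∣ : ∀ u {m n} → m ℕ.≤ n → u ^ m ∣ u ^ n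
  ^-∣ u {m} {n} m≤n = u ^ (n ℕ.∸ m) , (begin
    u ^ (n ℕ.∸ m) * u ^ m    ≈⟨ ^-homo-* u (n ℕ.∸ m) m ⟨
    u ^ (n ℕ.∸ m ℕ.+ m)      ≡⟨ ≡.cong (u ^_) (ℕ.m∸n+n≡m m≤n) ⟩
    u ^ n                    ∎)

  -- Splitting off the position `ρ zero` leaves the other values of `ρ` in its complement, where
  -- `punchOut` renumbers them.
  product-image : ∀ {q n} (ρ : Fin q → Fin n) → Injective _≡_ _≡_ ρ → (f : Vector Carrier n) →
    (∀ r → (∀ k → ρ k ≢ r) → f r ≈ 1#) → product f ≈ product (f ∘ ρ)
  product-image {zero}  {n} ρ inj f out =
    trans (product-cong {n} λ r → out r λ ()) (product-replicate-1 n)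
  product-image {suc q} {zero} ρ inj f out with ρ zero
  ... | ()
  product-image {suc q} {suc n} ρ inj f out = begin
    product f
      ≈⟨ product-remove {i = ρ zero} f ⟩
    f (ρ zero) * product (f ∘ punchIn (ρ zero))
      ≈⟨ *-congˡ (product-image ρ′ ρ′-injective (f ∘ punchIn (ρ zero)) out′) ⟩
    f (ρ zero) * product (f ∘ punchIn (ρ zero) ∘ ρ′)
      ≈⟨ *-congˡ (product-cong λ k → reflexive (≡.cong f (ρ′-spec k))) ⟩
    f (ρ zero) * product (f ∘ ρ ∘ suc) ∎
    where
    distinct : ∀ k → ρ zero ≢ ρ (suc k)
    distinct k e with inj e
    ... | ()
    ρ′ : Fin q → Fin n
    ρ′ k = punchOut (distinct k)
    ρ′-spec : ∀ k → punchIn (ρ zero) (ρ′ k) ≡ ρ (suc k)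
    ρ′-spec k = punchIn-punchOut (distinct k)
    ρ′-injective : Injective _≡_ _≡_ ρ′
    ρ′-injective {i} {j} e = suc-inj (inj (≡.trans (≡.sym (ρ′-spec i))
      (≡.trans (≡.cong (punchIn (ρ zero)) e) (ρ′-spec j))))
      where
      suc-inj : ∀ {m} {i j : Fin m} → Fin.suc i ≡ suc j → i ≡ j
      suc-inj ≡.refl = ≡.refl
    out′ : ∀ r → (∀ k → ρ′ k ≢ r) → f (punchIn (ρ zero) r) ≈ 1#
    out′ r h = out (punchIn (ρ zero) r) λ
      { zero    e → punchInᵢ≢i (ρ zero) r (≡.sym e)
      ; (suc k) e → h k (punchIn-injective (ρ zero) _ _ (≡.trans (ρ′-spec k) e)) }

  -- After expanding the rows ρ k into the W s, only terms with pairwise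
  -- different W s survive, and q different exponents s add up to at least
  -- 0 + 1 + … + (q − 1).
  u^qC2∣ : ∀ {n k q K} {F : Functional n k} → IsVolume F → ∀ u
    (ρ : Fin q → Fin n) → Injective _≡_ _≡_ ρ →
    (e : Vector Carrier q) (W : Fin (suc K) → Row k) (c : Fin q → Fin (suc K) → Carrier)
      (M : Rows n k) →
    (∀ p → (λ i → e p * M (ρ p) i) ≐ λ i → sum {suc K} λ s → (u ^ toℕ s * c p s) * W s i) →
    u ^ (q C 2) ∣ product e * F M
  u^qC2∣ {n} {k} {q} {K} {F} vol u ρ inj e W c M expand = ∣ʳ-respʳ-≈ (begin
    1# * F M′            ≈⟨ *-identityˡ _ ⟩
    F M′                 ≈⟨ scale-rows vol E M ⟩
    product E * F M
      ≈⟨ *-congʳ (trans (product-image ρ inj E E-out)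
          (product-cong λ p → reflexive (≡.cong proj₁ (extend-image ρ special other inj p)))) ⟩
    product e * F M      ∎)
    (∣-expansion vol 1# a V M′
      (extend-elim ρ special other (λ r x → (λ i → proj₁ x * M r i) ≐ λ i → sum {suc K} λ s →
        proj₁ (proj₂ x) s * proj₂ (proj₂ x) s i)
        expand default-expand)
      terms)
    where
    X = Carrier × (Fin (suc K) → Carrier) × (Fin (suc K) → Row k)
    -- A row outside the image of `ρ` is its own expansion, padded with zero rows; having `suc K`
    -- summands guarantees room for it.
    default : Fin n → Fin (suc K) → Row k
    default r zero    = M r
    default r (suc s) = λ _ → 0#
    special : Fin q → X
    special p = e p , (λ s → u ^ toℕ s * c p s) , W
    other : Fin n → X
    other r = 1# , (λ _ → 1#) , default r
    E : Vector Carrier n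
    E = proj₁ ∘ extend ρ special other
    a : Fin n → Fin (suc K) → Carrier
    a r = proj₁ (proj₂ (extend ρ special other r))
    V : Fin n → Fin (suc K) → Row k
    V r = proj₂ (proj₂ (extend ρ special other r))
    M′ : Rows n k
    M′ r i = E r * M r i

    E-out : ∀ r → (∀ p → ρ p ≢ r) → E r ≈ 1#
    E-out r out = reflexive (≡.cong proj₁ (extend-outside ρ special other r out))

    default-expand : ∀ r → (λ i → 1# * M r i) ≐ λ i → sum {suc K} λ s → 1# * default r s i
    default-expand r i = begin
      1# * M r i                                   ≈⟨ +-identityʳ _ ⟨
      1# * M r i + 0#                              ≈⟨ +-congˡ (sum-zero {K} λ s → zeroʳ 1#) ⟨
      1# * M r i + sum {K} (λ s → 1# * 0#)         ∎

    terms : ∀ φ → u ^ (q C 2) ∣ (1# * product λ r → a r (φ r)) * F λ r → V r (φ r)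
    terms φ with any? (λ i → any? λ j → ¬? (i ≟ j) ×-dec (φ (ρ i) ≟ φ (ρ j)))
    ... | yes (i , j , i≢j , eq) = ∣ʳ-respʳ-≈
      (sym (trans (*-congˡ (rows-repeated vol _ (ρ i) (ρ j) (i≢j ∘ inj) same)) (zeroʳ _))) (_ ∣0)
      where
      V-special : ∀ p → V (ρ p) ≡ W
      V-special p = ≡.cong (proj₂ ∘ proj₂) (extend-image ρ special other inj p)
      same : V (ρ i) (φ (ρ i)) ≐ V (ρ j) (φ (ρ j))
      same h = reflexive (≡.cong-app
        (≡.trans (≡.cong-app (V-special i) _) (≡.trans (≡.cong W eq)
          (≡.sym (≡.cong-app (V-special j) _)))) h)
    ... | no none = quotient * (product γ * D) , (begin
      (quotient * (product γ * D)) * u ^ (q C 2)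
        ≈⟨ solve 4 (λ x y z w → (x :* (y :* z)) :* w := (x :* w) :* y :* z) refl quotient
            (product γ) D (u ^ (q C 2)) ⟩
      (quotient * u ^ (q C 2)) * product γ * D
        ≈⟨ *-congʳ (*-congʳ (trans equality (sym (product-^ u (toℕ ∘ φ ∘ ρ))))) ⟩
      product (λ p → u ^ toℕ (φ (ρ p))) * product γ * D
        ≈⟨ *-congʳ (product-* {q} _ _) ⟨
      product (λ p → u ^ toℕ (φ (ρ p)) * γ p) * D
        ≈⟨ *-congʳ (product-cong {q} λ p → reflexive
            (≡.cong (λ x → proj₁ (proj₂ x) (φ (ρ p))) (extend-image ρ special other inj p))) ⟨
      product (λ p → a (ρ p) (φ (ρ p))) * D
        ≈⟨ *-congʳ (product-image ρ inj (λ r → a r (φ r)) λ r out →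
             reflexive (≡.cong (λ x → proj₁ (proj₂ x) (φ r))
               (extend-outside ρ special other r out))) ⟨
      product (λ r → a r (φ r)) * D
        ≈⟨ *-congʳ (*-identityˡ _) ⟨
      (1# * product (λ r → a r (φ r))) * D ∎)
      where
      D = F λ r → V r (φ r)
      γ = λ p → c p (φ (ρ p))
      φρ-injective : Injective _≡_ _≡_ (toℕ ∘ φ ∘ ρ)
      φρ-injective {i} {j} eq = decidable-stable (i ≟ j) λ i≢j →
        none (i , j , i≢j , toℕ-injective eq)
      open _∣ʳ_ (^-∣ u (injective⇒qC2≤total (toℕ ∘ φ ∘ ρ) φρ-injective))

-- Divisibility of alternating functions of the rows of 𝒱

nC0≡1 : ∀ n → n C 0 ≡ 1
nC0≡1 n = ≡.trans (nCk≡nC[n∸k] {0} {n} z≤n) (nCn≡1 n)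

0C[1+k]≡0 : ∀ k → 0 C suc k ≡ 0
0C[1+k]≡0 k = k>n⇒nCk≡0 (s≤s (z≤n {k}))

[1+n]C[1+k] : ∀ n k → suc n C suc k ≡ n C k ℕ.+ n C suc k
[1+n]C[1+k] n k = ≡.sym (nCk+nC[k+1]≡[n+1]C[k+1] n k)

[a+b]Ca*a!*b!≡[a+b]! : ∀ a b → ((a ℕ.+ b) C a) ℕ.* (a ! ℕ.* b !) ≡ (a ℕ.+ b) !
[a+b]Ca*a!*b!≡[a+b]! a b = begin
  ((a ℕ.+ b) C a) ℕ.* (a ! ℕ.* b !)
    ≡⟨ ≡.cong (λ x → ((a ℕ.+ b) C a) ℕ.* (a ! ℕ.* x !)) (ℕ.m+n∸m≡n a b) ⟨
  ((a ℕ.+ b) C a) ℕ.* (a ! ℕ.* (a ℕ.+ b ℕ.∸ a) !)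
    ≡⟨ ≡.cong (ℕ._* (a ! ℕ.* (a ℕ.+ b ℕ.∸ a) !)) (nCk≡n!/k![n-k]! a≤a+b) ⟩
  ((a ℕ.+ b) ! ℕ./ (a ! ℕ.* (a ℕ.+ b ℕ.∸ a) !)) ℕ.* (a ! ℕ.* (a ℕ.+ b ℕ.∸ a) !)
    ≡⟨ m/n*n≡m (k![n∸k]!∣n! a≤a+b) ⟩
  (a ℕ.+ b) ! ∎
  where
  open ≡.≡-Reasoning
  a≤a+b = ℕ.m≤m+n a b
  instance _ = (a ℕ.!* (a ℕ.+ b ℕ.∸ a) !≢0)

-- Both sides are the trinomial coefficient n! / (a! b! c!), n = a + b + c.
C-trinomial : ∀ a b c →
  ((a ℕ.+ (b ℕ.+ c)) C a) ℕ.* ((b ℕ.+ c) C b) ≡ ((b ℕ.+ (a ℕ.+ c)) C b) ℕ.* ((a ℕ.+ c) C a)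
C-trinomial a b c = ℕ.*-cancelʳ-≡ _ _ (a ! ℕ.* (b ! ℕ.* c !)) (begin
  (n₁ C a) ℕ.* ((b ℕ.+ c) C b) ℕ.* (a ! ℕ.* (b ! ℕ.* c !))
    ≡⟨ solve 5 (λ p q x y z → p :* q :* (x :* (y :* z)) := p :* (x :* (q :* (y :* z)))) ≡.refl
        (n₁ C a) ((b ℕ.+ c) C b) (a !) (b !) (c !) ⟩
  (n₁ C a) ℕ.* (a ! ℕ.* (((b ℕ.+ c) C b) ℕ.* (b ! ℕ.* c !)))
    ≡⟨ ≡.cong (λ x → (n₁ C a) ℕ.* (a ! ℕ.* x)) ([a+b]Ca*a!*b!≡[a+b]! b c) ⟩
  (n₁ C a) ℕ.* (a ! ℕ.* (b ℕ.+ c) !)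
    ≡⟨ [a+b]Ca*a!*b!≡[a+b]! a (b ℕ.+ c) ⟩
  n₁ !
    ≡⟨ ≡.cong _! (ℕsolve a b c) ⟩
  n₂ !
    ≡⟨ [a+b]Ca*a!*b!≡[a+b]! b (a ℕ.+ c) ⟨
  (n₂ C b) ℕ.* (b ! ℕ.* (a ℕ.+ c) !)
    ≡⟨ ≡.cong (λ x → (n₂ C b) ℕ.* (b ! ℕ.* x)) ([a+b]Ca*a!*b!≡[a+b]! a c) ⟨
  (n₂ C b) ℕ.* (b ! ℕ.* (((a ℕ.+ c) C a) ℕ.* (a ! ℕ.* c !)))
    ≡⟨ solve 5 (λ p q x y z → p :* q :* (x :* (y :* z)) := p :* (y :* (q :* (x :* z)))) ≡.refl
        (n₂ C b) ((a ℕ.+ c) C a) (a !) (b !) (c !) ⟨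
  (n₂ C b) ℕ.* ((a ℕ.+ c) C a) ℕ.* (a ! ℕ.* (b ! ℕ.* c !)) ∎)
  where
  open ≡.≡-Reasoning
  open +-*-Solver
  n₁ = a ℕ.+ (b ℕ.+ c)
  n₂ = b ℕ.+ (a ℕ.+ c)
  ℕsolve : ∀ a b c → a ℕ.+ (b ℕ.+ c) ≡ b ℕ.+ (a ℕ.+ c)
  ℕsolve = solve 3 (λ a b c → a :+ (b :+ c) := b :+ (a :+ c)) ≡.refl
  instance
    _ = b ℕ.!* c !≢0
    _ = ℕ.m*n≢0 (a !) (b ! ℕ.* c !) {{a ℕ.!≢0}}

-- This is `C-trinomial` with the parts κ, h and L - h + a + 1 of L + k. It moves the row index a
-- out of the coefficient of column h and leaves it only in κ.
C-regroup : ∀ {L k a h} → a ℕ.< k → h ℕ.≤ L → let κ = k ℕ.∸ suc a in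
  ((L ℕ.+ k) C κ) ℕ.* ((L ℕ.+ suc a) C h) ≡ ((L ℕ.+ k) C h) ℕ.* ((L ℕ.∸ h ℕ.+ k) C κ)
C-regroup {L} {k} {a} {h} a<k h≤L = begin
  ((L ℕ.+ k) C κ) ℕ.* ((L ℕ.+ suc a) C h)
    ≡⟨ ≡.cong₂ (λ p q → (p C κ) ℕ.* (q C h)) e₁ e₂ ⟩
  ((κ ℕ.+ (h ℕ.+ r)) C κ) ℕ.* ((h ℕ.+ r) C h)
    ≡⟨ C-trinomial κ h r ⟩
  ((h ℕ.+ (κ ℕ.+ r)) C h) ℕ.* ((κ ℕ.+ r) C κ)
    ≡⟨ ≡.cong₂ (λ p q → (p C h) ℕ.* (q C κ)) e₃ e₄ ⟨
  ((L ℕ.+ k) C h) ℕ.* ((p ℕ.+ k) C κ) ∎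
  where
  open ≡.≡-Reasoning
  open +-*-Solver
  p κ r : ℕ
  p = L ℕ.∸ h
  κ = k ℕ.∸ suc a
  r = p ℕ.+ suc a
  L≡ : L ≡ p ℕ.+ h
  L≡ = ≡.sym (ℕ.m∸n+n≡m h≤L)
  k≡ : k ≡ κ ℕ.+ suc a
  k≡ = ≡.sym (ℕ.m∸n+n≡m a<k)
  e₁ : L ℕ.+ k ≡ κ ℕ.+ (h ℕ.+ r)
  e₁ = ≡.trans (≡.cong₂ ℕ._+_ L≡ k≡) (solve 4 (λ p h κ a →
    (p :+ h) :+ (κ :+ a) := κ :+ (h :+ (p :+ a))) ≡.refl p h κ (suc a))
  e₂ : L ℕ.+ suc a ≡ h ℕ.+ r
  e₂ = ≡.trans (≡.cong (ℕ._+ suc a) L≡) (solve 3 (λ p h a → (p :+ h) :+ a := h :+ (p :+ a)) ≡.refl p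
    h (suc a))
  e₃ : L ℕ.+ k ≡ h ℕ.+ (κ ℕ.+ r)
  e₃ = ≡.trans (≡.cong₂ ℕ._+_ L≡ k≡) (solve 4 (λ p h κ a →
    (p :+ h) :+ (κ :+ a) := h :+ (κ :+ (p :+ a))) ≡.refl p h κ (suc a))
  e₄ : p ℕ.+ k ≡ κ ℕ.+ r
  e₄ = ≡.trans (≡.cong (p ℕ.+_) k≡) (solve 3 (λ p κ a → p :+ (κ :+ a) := κ :+ (p :+ a)) ≡.refl p κ
    (suc a))

-- A pair in a disjoint union has one element in each part or both in the same part. For a = b = k
-- this produces the exponent k².
[a+b]C2 : ∀ a b → (a ℕ.+ b) C 2 ≡ a ℕ.* b ℕ.+ (a C 2 ℕ.+ b C 2)
[a+b]C2 zero    b = ≡.refl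
[a+b]C2 (suc a) b = begin
  suc (a ℕ.+ b) C 2                                ≡⟨ [1+n]C[1+k] (a ℕ.+ b) 1 ⟩
  (a ℕ.+ b) C 1 ℕ.+ (a ℕ.+ b) C 2
    ≡⟨ ≡.cong₂ ℕ._+_ (nC1≡n (a ℕ.+ b)) ([a+b]C2 a b) ⟩
  a ℕ.+ b ℕ.+ (a ℕ.* b ℕ.+ (a C 2 ℕ.+ b C 2))
    ≡⟨ solve 4 (λ a b p q → a :+ b :+ (a :* b :+ (p :+ q)) := b :+ a :* b :+ (a :+ p :+ q)) ≡.refl a
        b (a C 2) (b C 2) ⟩
  b ℕ.+ a ℕ.* b ℕ.+ (a ℕ.+ a C 2 ℕ.+ b C 2)
    ≡⟨ ≡.cong (λ x → b ℕ.+ a ℕ.* b ℕ.+ (x ℕ.+ a C 2 ℕ.+ b C 2)) (nC1≡n a) ⟨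
  b ℕ.+ a ℕ.* b ℕ.+ (a C 1 ℕ.+ a C 2 ℕ.+ b C 2)
    ≡⟨ ≡.cong (λ x → b ℕ.+ a ℕ.* b ℕ.+ (x ℕ.+ b C 2)) ([1+n]C[1+k] a 1) ⟨
  b ℕ.+ a ℕ.* b ℕ.+ (suc a C 2 ℕ.+ b C 2)          ∎
  where
  open ≡.≡-Reasoning
  open +-*-Solver

-- This is the total exponent of `u` spent on rescaling the first `k` rows of one block.
total-descending : ∀ k → total {k} (λ a → k ℕ.∸ suc (toℕ a)) ≡ k C 2
total-descending zero    = ≡.refl
total-descending (suc k) = begin
  k ℕ.+ total {k} (λ a → k ℕ.∸ suc (toℕ a))   ≡⟨ ≡.cong₂ ℕ._+_ (≡.sym (nC1≡n k))
    (total-descending k) ⟩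
  k C 1 ℕ.+ k C 2                             ≡⟨ [1+n]C[1+k] k 1 ⟨
  suc k C 2                                   ∎
  where open ≡.≡-Reasoning

rowOf : ∀ {m} (l : Vector ℕ m) j → Fin (l j) → Fin (total l)
rowOf l zero    i = i ↑ˡ total (tail l)
rowOf l (suc j) i = l zero ↑ʳ rowOf (tail l) j i

rowIndex-rowOf : ∀ {m} (l : Vector ℕ m) j i → rowIndex l (rowOf l j i) ≡ (j , i)
rowIndex-rowOf l zero    i rewrite splitAt-↑ˡ (l zero) i (total (tail l)) = ≡.refl
rowIndex-rowOf {suc m} l (suc j) i
  rewrite splitAt-↑ʳ (l zero) (total (tail l)) (rowOf (tail l) j i)
        | rowIndex-rowOf (tail l) j i = ≡.refl

-- Binomial rows expanded at y and at y + u

module BinomialRows {c ℓ} (R : CommutativeRing c ℓ) where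
  open CommutativeRing R hiding (zero)
  open Determinants R
  open Volumes R
  open Weights R
  open SemiringSum semiring using (sum; sum-cong-≋; ∑-distrib-+; ∑-comm; *-distribˡ-sum;
      *-distribʳ-sum)
  open CommutativeSemiringExp commutativeSemiring using (_^_)
  open SemiringMult semiring using (×-homo-+; ×1-homo-*) renaming (_×_ to _×ₘ_)
  open SetoidReasoning setoid
  open RingSolver commutativeSemiring using (solve; _:+_; _:*_; _:=_; con)

  ν : ℕ → Carrier
  ν n = n ×ₘ 1#

  ν-+ : ∀ m n → ν (m ℕ.+ n) ≈ ν m + ν n
  ν-+ = ×-homo-+ 1#

  ν-* : ∀ m n → ν (m ℕ.* n) ≈ ν m * ν n
  ν-* = ×1-homo-*

  ν≡ : ∀ {m n} → m ≡ n → ν m ≈ ν n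
  ν≡ e = reflexive (≡.cong ν e)

  ν1 : ν 1 ≈ 1#
  ν1 = +-identityʳ 1#

  νC0 : ∀ n → ν (n C 0) ≈ 1#
  νC0 n = trans (ν≡ (nC0≡1 n)) ν1

  νPascal : ∀ n k → ν (suc n C suc k) ≈ ν (n C k) + ν (n C suc k)
  νPascal n k = trans (ν≡ ([1+n]C[1+k] n k)) (ν-+ (n C k) _)


  module Expansions (u : Carrier) where

    -- d κ t is ν ((k C (κ ∸ t))) * u ^ (κ ∸ t) for t ≤ κ, and 0 beyond.
    d : ℕ → ℕ → ℕ → Carrier
    d k κ       zero    = ν (k C κ) * u ^ κ
    d k zero    (suc t) = 0#
    d k (suc κ) (suc t) = d k κ t

    -- Vandermonde's identity C(a+k, κ) = Σ C(k, κ-t) C(a, t), with u^κ split between the weight u^t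
    -- and `d`. Pascal's rule in the upper index gives the induction. `K` is any bound above a, so
    -- that all columns can share the same number of terms.
    vandermonde : ∀ k a κ K → a ℕ.< K →
      u ^ κ * ν ((a ℕ.+ k) C κ) ≈ sum {K} λ t → (u ^ toℕ t * d k κ (toℕ t)) * ν (a C toℕ t)
    vandermonde k zero κ (suc K) _ = begin
      u ^ κ * ν (k C κ)
        ≈⟨ solve 2 (λ x y → x :* y := (con 1 :* (y :* x)) :* con 1) refl (u ^ κ) (ν (k C κ)) ⟩
      (1# * (ν (k C κ) * u ^ κ)) * 1#
        ≈⟨ *-congˡ (νC0 0) ⟨
      (1# * (ν (k C κ) * u ^ κ)) * ν (0 C 0)
        ≈⟨ +-identityʳ _ ⟨
      (1# * (ν (k C κ) * u ^ κ)) * ν (0 C 0) + 0#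
        ≈⟨ +-congˡ (sum-zero {K} λ t → trans (*-congˡ (ν≡ (0C[1+k]≡0 (toℕ t)))) (zeroʳ _)) ⟨
      (1# * (ν (k C κ) * u ^ κ)) * ν (0 C 0) + sum {K}
        (λ t → (u ^ suc (toℕ t) * d k κ (suc (toℕ t))) * ν (0 C suc (toℕ t))) ∎
    vandermonde k (suc a) zero (suc K) _ = begin
      1# * ν ((suc a ℕ.+ k) C 0)
        ≈⟨ *-congˡ (νC0 (suc a ℕ.+ k)) ⟩
      1# * 1#
        ≈⟨ solve 0 (con 1 :* con 1 := (con 1 :* (con 1 :* con 1)) :* con 1) refl ⟩
      (1# * (1# * 1#)) * 1#
        ≈⟨ *-cong (*-congˡ (*-congʳ (νC0 k))) (νC0 (suc a)) ⟨
      (1# * (ν (k C 0) * 1#)) * ν (suc a C 0)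
        ≈⟨ +-identityʳ _ ⟨
      (1# * (ν (k C 0) * 1#)) * ν (suc a C 0) + 0#
        ≈⟨ +-congˡ (sum-zero {K} λ t → trans (*-congʳ (zeroʳ _)) (zeroˡ _)) ⟨
      (1# * (ν (k C 0) * 1#)) * ν (suc a C 0) + sum {K}
        (λ t → (u ^ suc (toℕ t) * 0#) * ν (suc a C suc (toℕ t))) ∎
    vandermonde k (suc a) (suc κ) (suc K) (s≤s a<K) = begin
      u ^ suc κ * ν (suc (a ℕ.+ k) C suc κ)
        ≈⟨ *-congˡ (νPascal (a ℕ.+ k) κ) ⟩
      (u * u ^ κ) * (ν ((a ℕ.+ k) C κ) + ν ((a ℕ.+ k) C suc κ))
        ≈⟨ solve 4 (λ u w p q → (u :* w) :* (p :+ q) := (u :* w) :* q :+ u :* (w :* p)) refl u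
            (u ^ κ) (ν ((a ℕ.+ k) C κ)) (ν ((a ℕ.+ k) C suc κ)) ⟩
      u ^ suc κ * ν ((a ℕ.+ k) C suc κ) + u * (u ^ κ * ν ((a ℕ.+ k) C κ))
        ≈⟨ +-cong (vandermonde k a (suc κ) (suc K) (ℕ.m<n⇒m<1+n a<K))
             (trans (*-congˡ (vandermonde k a κ K a<K)) (*-distribˡ-sum {K} u _)) ⟩
      (f 0 (a C 0) + sum {K} (λ t → f (suc (toℕ t)) (a C suc (toℕ t)))) + sum {K}
        (λ t → u * ((u ^ toℕ t * d k κ (toℕ t)) * ν (a C toℕ t)))
        ≈⟨ trans (+-assoc _ _ _) (+-cong (*-congˡ (trans (νC0 a) (sym (νC0 (suc a)))))
             (trans (sym (∑-distrib-+ {K} (λ t → f (suc (toℕ t)) (a C suc (toℕ t)))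
               (λ t → u * ((u ^ toℕ t * d k κ (toℕ t)) * ν (a C toℕ t)))))
               (sum-cong-≋ {K} λ t → trans
                 (solve 5 (λ u w e p q → ((u :* w) :* e) :* q :+ u :* ((w :* e) :* p) :=
                   ((u :* w) :* e) :* (p :+ q))
                   refl u (u ^ toℕ t) (d k κ (toℕ t)) (ν (a C toℕ t)) (ν (a C suc (toℕ t))))
                 (*-congˡ (sym (νPascal a (toℕ t))))))) ⟩
      f 0 (suc a C 0) + sum {K} (λ t → f (suc (toℕ t)) (suc a C suc (toℕ t))) ∎
      where
      f : ℕ → ℕ → Carrier
      f t n = (u ^ t * d k (suc κ) t) * ν n

    module _ (y : Carrier) where
      x : Carrier
      x = y + u

      -- b a s is ν (a C s) * y ^ (a ∸ s).
      b : ℕ → ℕ → Carrier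
      b zero    zero    = 1#
      b zero    (suc s) = 0#
      b (suc a) zero    = y * b a zero
      b (suc a) (suc s) = b a s + y * b a (suc s)

      -- The factor y^t avoids a truncated exponent: both sides vanish for t > a.
      y^t*b : ∀ a t → y ^ t * b a t ≈ ν (a C t) * y ^ a
      y^t*b zero    zero    = *-congʳ (sym (νC0 0))
      y^t*b zero    (suc t) = trans (zeroʳ _) (sym (trans (*-congʳ (ν≡ (0C[1+k]≡0 t))) (zeroˡ _)))
      y^t*b (suc a) zero    = begin
        1# * (y * b a 0)               ≈⟨ solve 2 (λ y z → con 1 :* (y :* z) := y :* (con 1 :* z))
          refl y (b a 0) ⟩
        y * (1# * b a 0)               ≈⟨ *-congˡ (y^t*b a zero) ⟩
        y * (ν (a C 0) * y ^ a)        ≈⟨ *-congˡ (*-congʳ (trans (νC0 a) (sym (νC0 (suc a))))) ⟩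
        y * (ν (suc a C 0) * y ^ a)    ≈⟨ solve 3 (λ y z w → y :* (z :* w) := z :* (y :* w)) refl y
          (ν (suc a C 0)) (y ^ a) ⟩
        ν (suc a C 0) * y ^ suc a      ∎
      y^t*b (suc a) (suc t) = begin
        (y * y ^ t) * (b a t + y * b a (suc t))
          ≈⟨ solve 4 (λ y w p q → (y :* w) :* (p :+ y :* q) := y :* (w :* p :+ (y :* w) :* q)) refl
              y (y ^ t) (b a t) (b a (suc t)) ⟩
        y * (y ^ t * b a t + y ^ suc t * b a (suc t))
          ≈⟨ *-congˡ (+-cong (y^t*b a t) (y^t*b a (suc t))) ⟩
        y * (ν (a C t) * y ^ a + ν (a C suc t) * y ^ a)
          ≈⟨ solve 4 (λ y w p q → y :* (p :* w :+ q :* w) := (p :+ q) :* (y :* w)) refl y (y ^ a)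
              (ν (a C t)) (ν (a C suc t)) ⟩
        (ν (a C t) + ν (a C suc t)) * y ^ suc a
          ≈⟨ *-congʳ (νPascal a t) ⟨
        ν (suc a C suc t) * y ^ suc a ∎

      -- For K > a this is u^t / t! times the t-th derivative in u of the binomial expansion of (y +
      -- u)^a.
      G : ℕ → ℕ → ℕ → Carrier
      G K a t = sum {K} λ s → (ν (toℕ s C t) * u ^ toℕ s) * b a (toℕ s)

      G-suc : ∀ K a t → G (suc K) (suc a) t ≈
        y * G (suc K) a t + u * sum {K} λ s → (ν (suc (toℕ s) C t) * u ^ toℕ s) * b a (toℕ s)
      G-suc K a t = begin
        (ν (0 C t) * 1#) * (y * b a 0) + sum {K}
          (λ s → (ν (suc (toℕ s) C t) * u ^ suc (toℕ s)) * b (suc a) (suc (toℕ s)))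
          ≈⟨ +-cong (solve 3 (λ n y z → (n :* con 1) :* (y :* z) := y :* ((n :* con 1) :* z)) refl
              (ν (0 C t)) y (b a 0))
               (trans (sum-cong-≋ {K} λ s → solve 6
                 (λ n u w p y q → (n :* (u :* w)) :* (p :+ y :* q) :=
                    y :* ((n :* (u :* w)) :* q) :+ u :* ((n :* w) :* p)) refl (ν (suc (toℕ s) C t))
                      u (u ^ toℕ s) (b a (toℕ s)) y (b a (suc (toℕ s))))
                 (trans (∑-distrib-+ {K} (λ s → y * f (suc (toℕ s))) (λ s → u * g (toℕ s)))
                   (+-cong (sym (*-distribˡ-sum {K} y (λ s → f (suc (toℕ s)))))
                     (sym (*-distribˡ-sum {K} u (λ s → g (toℕ s))))))) ⟩
        y * f 0 + (y * sum {K} (λ s → f (suc (toℕ s))) + u * sum {K} (λ s → g (toℕ s)))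
          ≈⟨ solve 4 (λ y p q r → y :* p :+ (y :* q :+ r) := y :* (p :+ q) :+ r) refl y (f 0)
              (sum {K} (λ s → f (suc (toℕ s)))) (u * sum {K} (λ s → g (toℕ s))) ⟩
        y * (f 0 + sum {K} (λ s → f (suc (toℕ s)))) + u * sum {K} (λ s → g (toℕ s)) ∎
        where
        f g : ℕ → Carrier
        f s = (ν (s C t) * u ^ s) * b a s
        g s = (ν (suc s C t) * u ^ s) * b a s

      -- Differentiating (y + u)^a gives C(a, t) u^t x^(a-t); as in `y^t*b`, the factor x^t clears
      -- the negative exponent. The induction on a uses x = y + u and Pascal's rule for C(s, t).
      x^t*G : ∀ a t K → a ℕ.< K → x ^ t * G K a t ≈ ν (a C t) * (u ^ t * x ^ a)
      x^t*G zero t (suc K) _ = begin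
        x ^ t * ((ν (0 C t) * 1#) * 1# + sum {K}
          (λ s → (ν (suc (toℕ s) C t) * u ^ suc (toℕ s)) * 0#))
          ≈⟨ *-congˡ (+-congˡ (sum-zero {K} λ s → zeroʳ _)) ⟩
        x ^ t * ((ν (0 C t) * 1#) * 1# + 0#)
          ≈⟨ solve 2 (λ w n → w :* ((n :* con 1) :* con 1 :+ con 0) := n :* (w :* con 1)) refl
              (x ^ t) (ν (0 C t)) ⟩
        ν (0 C t) * (x ^ t * 1#)
          ≈⟨ only-0 t ⟩
        ν (0 C t) * (u ^ t * 1#) ∎
        where
        only-0 : ∀ t → ν (0 C t) * (x ^ t * 1#) ≈ ν (0 C t) * (u ^ t * 1#)
        only-0 zero    = refl
        only-0 (suc t) = trans (trans (*-congʳ (ν≡ (0C[1+k]≡0 t))) (zeroˡ _))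
          (sym (trans (*-congʳ (ν≡ (0C[1+k]≡0 t))) (zeroˡ _)))
      x^t*G (suc a) zero (suc K) (s≤s a<K) = begin
        1# * G (suc K) (suc a) 0
          ≈⟨ *-congˡ (G-suc K a 0) ⟩
        1# * (y * G (suc K) a 0 + u * sum {K} (λ s →
          (ν (suc (toℕ s) C 0) * u ^ toℕ s) * b a (toℕ s)))
          ≈⟨ *-congˡ (+-congˡ (*-congˡ (sum-cong-≋ {K} λ s →
              *-congʳ (*-congʳ (trans (νC0 (suc (toℕ s))) (sym (νC0 (toℕ s)))))))) ⟩
        1# * (y * G (suc K) a 0 + u * G K a 0)
          ≈⟨ solve 4 (λ y u p q → con 1 :* (y :* p :+ u :* q) := y :* (con 1 :* p) :+ u :*
              (con 1 :* q)) refl y u (G (suc K) a 0) (G K a 0) ⟩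
        y * (1# * G (suc K) a 0) + u * (1# * G K a 0)
          ≈⟨ +-cong (*-congˡ (x^t*G a 0 (suc K) (ℕ.m<n⇒m<1+n a<K))) (*-congˡ (x^t*G a 0 K a<K)) ⟩
        y * (ν (a C 0) * (1# * x ^ a)) + u * (ν (a C 0) * (1# * x ^ a))
          ≈⟨ solve 4 (λ y u n w → y :* (n :* (con 1 :* w)) :+ u :* (n :* (con 1 :* w)) := n :*
              (con 1 :* ((y :+ u) :* w))) refl y u (ν (a C 0)) (x ^ a) ⟩
        ν (a C 0) * (1# * x ^ suc a)
          ≈⟨ *-congʳ (trans (νC0 a) (sym (νC0 (suc a)))) ⟩
        ν (suc a C 0) * (1# * x ^ suc a) ∎
      x^t*G (suc a) (suc t) (suc K) (s≤s a<K) = begin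
        (x * x ^ t) * G (suc K) (suc a) (suc t)
          ≈⟨ *-congˡ (G-suc K a (suc t)) ⟩
        (x * x ^ t) * (y * G (suc K) a (suc t) + u * sum {K}
          (λ s → (ν (suc (toℕ s) C suc t) * u ^ toℕ s) * b a (toℕ s)))
          ≈⟨ *-congˡ (+-congˡ (*-congˡ (trans (sum-cong-≋ {K} λ s → trans
               (*-congʳ (*-congʳ (νPascal (toℕ s) t)))
               (solve 4 (λ p q w z → ((p :+ q) :* w) :* z := (p :* w) :* z :+ (q :* w) :* z) refl
                 (ν (toℕ s C t)) (ν (toℕ s C suc t)) (u ^ toℕ s) (b a (toℕ s))))
               (∑-distrib-+ {K} (λ s → (ν (toℕ s C t) * u ^ toℕ s) * b a (toℕ s))
                 (λ s → (ν (toℕ s C suc t) * u ^ toℕ s) * b a (toℕ s)))))) ⟩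
        (x * x ^ t) * (y * G (suc K) a (suc t) + u * (G K a t + G K a (suc t)))
          ≈⟨ solve 7 (λ x w y u p q r → (x :* w) :* (y :* p :+ u :* (q :+ r)) :=
               y :* ((x :* w) :* p) :+ u :* ((x :* w) :* r) :+ (u :* x) :* (w :* q)) refl x (x ^ t)
                 y u (G (suc K) a (suc t)) (G K a t) (G K a (suc t)) ⟩
        y * (x ^ suc t * G (suc K) a (suc t)) + u * (x ^ suc t * G K a (suc t)) + (u * x) *
          (x ^ t * G K a t)
          ≈⟨ +-cong (+-cong (*-congˡ (x^t*G a (suc t) (suc K) (ℕ.m<n⇒m<1+n a<K)))
              (*-congˡ (x^t*G a (suc t) K a<K))) (*-congˡ (x^t*G a t K a<K)) ⟩
        y * (ν (a C suc t) * (u ^ suc t * x ^ a)) + u * (ν (a C suc t) * (u ^ suc t * x ^ a)) +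
          (u * x) * (ν (a C t) * (u ^ t * x ^ a))
          ≈⟨ solve 6 (λ y u n m v w → y :* (n :* ((u :* v) :* w)) :+ u :* (n :* ((u :* v) :* w)) :+
              (u :* (y :+ u)) :* (m :* (v :* w)) :=
               (m :+ n) :* ((u :* v) :* ((y :+ u) :* w))) refl y u (ν (a C suc t)) (ν (a C t))
                 (u ^ t) (x ^ a) ⟩
        (ν (a C t) + ν (a C suc t)) * (u ^ suc t * x ^ suc a)
          ≈⟨ *-congʳ (νPascal a t) ⟨
        ν (suc a C suc t) * (u ^ suc t * x ^ suc a) ∎

      module _ (k κ a K : ℕ) (a<K : a ℕ.< K) (n : Carrier) where
        private
          expand : ∀ z → n * ((u ^ κ * ν ((a ℕ.+ k) C κ)) * z ^ a) ≈
            n * sum {K} λ t → (u ^ toℕ t * d k κ (toℕ t)) * (ν (a C toℕ t) * z ^ a)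
          expand z = begin
            n * ((u ^ κ * ν ((a ℕ.+ k) C κ)) * z ^ a)
              ≈⟨ *-congˡ (*-congʳ (vandermonde k a κ K a<K)) ⟩
            n * (sum {K} (λ t → (u ^ toℕ t * d k κ (toℕ t)) * ν (a C toℕ t)) * z ^ a)
              ≈⟨ *-congˡ (trans (*-distribʳ-sum {K} (z ^ a)
                  (λ t → (u ^ toℕ t * d k κ (toℕ t)) * ν (a C toℕ t)))
                   (sum-cong-≋ {K} λ t → *-assoc (u ^ toℕ t * d k κ (toℕ t)) (ν (a C toℕ t))
                     (z ^ a))) ⟩
            n * sum {K} (λ t → (u ^ toℕ t * d k κ (toℕ t)) * (ν (a C toℕ t) * z ^ a)) ∎

        -- Here and in `expand-x` the vectors are the same and carry the weight u^s, and the
        -- coefficients involve neither the exponent a nor the factor n. Hence they are constant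
        -- along a row, as `u^qC2∣` demands.
        expand-y : n * ((u ^ κ * ν ((a ℕ.+ k) C κ)) * y ^ a) ≈
          sum {K} λ s → (u ^ toℕ s * (d k κ (toℕ s) * y ^ toℕ s)) * (n * b a (toℕ s))
        expand-y = trans (expand y) (trans
          (*-distribˡ-sum {K} n (λ t → (u ^ toℕ t * d k κ (toℕ t)) * (ν (a C toℕ t) * y ^ a)))
          (sum-cong-≋ {K} λ t → trans (*-congˡ (*-congˡ (sym (y^t*b a (toℕ t)))))
            (solve 5 (λ n w e v b → n :* ((w :* e) :* (v :* b)) := (w :* (e :* v)) :* (n :* b))
              refl n (u ^ toℕ t) (d k κ (toℕ t)) (y ^ toℕ t) (b a (toℕ t)))))

        -- The powers of x = y + u have to be expanded as well, so the coefficient of u^s collects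
        -- contributions from all t after the two sums are exchanged.
        γ : ℕ → Carrier
        γ s = sum {K} λ t → (d k κ (toℕ t) * x ^ toℕ t) * ν (s C toℕ t)

        expand-x : n * ((u ^ κ * ν ((a ℕ.+ k) C κ)) * x ^ a) ≈
          sum {K} λ s → (u ^ toℕ s * γ (toℕ s)) * (n * b a (toℕ s))
        expand-x = begin
          n * ((u ^ κ * ν ((a ℕ.+ k) C κ)) * x ^ a)
            ≈⟨ expand x ⟩
          n * sum {K} (λ t → (u ^ toℕ t * d k κ (toℕ t)) * (ν (a C toℕ t) * x ^ a))
            ≈⟨ *-congˡ (sum-cong-≋ {K} to-G) ⟩
          n * sum {K} (λ t → sum {K} λ s → f t s)
            ≈⟨ *-congˡ (∑-comm {K} {K} f) ⟩
          n * sum {K} (λ s → sum {K} λ t → f t s)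
            ≈⟨ *-distribˡ-sum {K} n (λ s → sum {K} λ t → f t s) ⟩
          sum {K} (λ s → n * sum {K} λ t → f t s)
            ≈⟨ sum-cong-≋ {K} collect ⟩
          sum {K} (λ s → (u ^ toℕ s * γ (toℕ s)) * (n * b a (toℕ s))) ∎
          where
          f : Fin K → Fin K → Carrier
          f t s = (d k κ (toℕ t) * x ^ toℕ t) * ((ν (toℕ s C toℕ t) * u ^ toℕ s) * b a (toℕ s))
          to-G : ∀ t → (u ^ toℕ t * d k κ (toℕ t)) * (ν (a C toℕ t) * x ^ a) ≈ sum {K} (f t)
          to-G t = begin
            (u ^ toℕ t * d k κ (toℕ t)) * (ν (a C toℕ t) * x ^ a)
              ≈⟨ solve 4 (λ w e p z → (w :* e) :* (p :* z) := e :* (p :* (w :* z))) refl (u ^ toℕ t)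
                  (d k κ (toℕ t)) (ν (a C toℕ t)) (x ^ a) ⟩
            d k κ (toℕ t) * (ν (a C toℕ t) * (u ^ toℕ t * x ^ a))
              ≈⟨ *-congˡ (x^t*G a (toℕ t) K a<K) ⟨
            d k κ (toℕ t) * (x ^ toℕ t * G K a (toℕ t))
              ≈⟨ *-assoc (d k κ (toℕ t)) (x ^ toℕ t) (G K a (toℕ t)) ⟨
            d k κ (toℕ t) * x ^ toℕ t * G K a (toℕ t)
              ≈⟨ *-distribˡ-sum {K} (d k κ (toℕ t) * x ^ toℕ t)
                  (λ s → (ν (toℕ s C toℕ t) * u ^ toℕ s) * b a (toℕ s)) ⟩
            sum {K} (f t) ∎
          collect : ∀ s → n * sum {K} (λ t → f t s) ≈ (u ^ toℕ s * γ (toℕ s)) * (n * b a (toℕ s))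
          collect s = begin
            n * sum {K} (λ t → f t s)
              ≈⟨ *-congˡ (sum-cong-≋ {K} λ t →
                   solve 4 (λ e p w b → e :* ((p :* w) :* b) := (e :* p) :* (w :* b)) refl
                     (d k κ (toℕ t) * x ^ toℕ t) (ν (toℕ s C toℕ t)) (u ^ toℕ s) (b a (toℕ s))) ⟩
            n * sum {K} (λ t → ((d k κ (toℕ t) * x ^ toℕ t) * ν (toℕ s C toℕ t)) *
              (u ^ toℕ s * b a (toℕ s)))
              ≈⟨ *-congˡ (*-distribʳ-sum {K} (u ^ toℕ s * b a (toℕ s))
                  (λ t → (d k κ (toℕ t) * x ^ toℕ t) * ν (toℕ s C toℕ t))) ⟨
            n * (γ (toℕ s) * (u ^ toℕ s * b a (toℕ s)))
              ≈⟨ solve 4 (λ n g w b → n :* (g :* (w :* b)) := (w :* g) :* (n :* b)) refl n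
                  (γ (toℕ s)) (u ^ toℕ s) (b a (toℕ s)) ⟩
            (u ^ toℕ s * γ (toℕ s)) * (n * b a (toℕ s)) ∎

-- Powers of the variables and of their differences

module RowDivisibility {c ℓ} (R : CommutativeRing c ℓ) {m} (l : Vector ℕ m)
  (α : Fin m → CommutativeRing.Carrier R) where
  open CommutativeRing R hiding (zero)
  open Determinants R
  open Volumes R
  open Weights R
  open BinomialRows R
  open IsVolume
  open SemiringSum semiring using (sum)
  open CommutativeMonoidSum *-commutativeMonoid using () renaming
      (sum-replicate-zero to product-replicate-1)
  open CommutativeSemiringExp commutativeSemiring using (_^_; ^-homo-*; ^-congˡ)
  open SemiringDivisibility semiring using (_∣_; ∣ʳ-respʳ-≈; ∣ʳ-respˡ-≈)
  open SetoidReasoning setoid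
  open RingSolver commutativeSemiring using (solve; _:*_; _:=_)

  L : ℕ
  L = total l

  entry : Fin m → ℕ → Row (suc L)
  entry j i h = ν ((L ℕ.+ suc i) C toℕ h) * α j ^ (L ℕ.∸ toℕ h)

  rows : Rows L (suc L)
  rows r = entry (proj₁ (rowIndex l r)) (toℕ (proj₂ (rowIndex l r)))

  rows-rowOf : ∀ j i → rows (rowOf l j i) ≡ entry j (toℕ i)
  rows-rowOf j i = ≡.cong (λ x → entry (proj₁ x) (toℕ (proj₂ x))) (rowIndex-rowOf l j i)

  δ : ∀ {n} → Fin n → Fin n → Carrier
  δ s t = if does (s ≟ t) then 1# else 0#

  sum-δ : ∀ {n} (f : Vector Carrier n) t → sum (λ s → f s * δ s t) ≈ f t
  sum-δ {suc n} f zero    = begin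
    f zero * 1# + sum {n} (λ s → f (suc s) * 0#)
      ≈⟨ +-cong (*-identityʳ _) (sum-zero {n} λ s → zeroʳ (f (suc s))) ⟩
    f zero + 0# ≈⟨ +-identityʳ _ ⟩
    f zero ∎
  sum-δ {suc n} f (suc t) = begin
    f zero * 0# + sum {n} (λ s → f (suc s) * δ s t)
      ≈⟨ +-cong (zeroʳ _) (sum-δ (f ∘ suc) t) ⟩
    0# + f (suc t) ≈⟨ +-identityˡ _ ⟩
    f (suc t) ∎

  rowOf-injective : ∀ {a} {X : Set a} (g : X → Σ (Fin m) λ j → Fin (l j)) → Injective _≡_ _≡_ g →
    Injective _≡_ _≡_ λ x → rowOf l (proj₁ (g x)) (proj₂ (g x))
  rowOf-injective g inj {x} {y} e = inj (≡.trans (≡.sym (rowIndex-rowOf l _ _))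
    (≡.trans (≡.cong (rowIndex l) e) (rowIndex-rowOf l _ _)))

  power-∣ : ∀ {F : Functional L (suc L)} → IsVolume F → ∀ j → α j ^ (l j C 2) ∣ F rows
  power-∣ {F} vol j = ∣ʳ-respʳ-≈ (trans (*-congʳ (product-replicate-1 (l j))) (*-identityˡ _))
    (u^qC2∣ vol (α j) (rowOf l j) (rowOf-injective (j ,_) (toℕ-injective ∘ ≡.cong (toℕ ∘ proj₂)))
      (λ _ → 1#) (λ s h → δ s (opposite h))
      (λ i s → ν ((L ℕ.+ suc (toℕ i)) C (L ℕ.∸ toℕ s))) rows expand)
    where
    expand : ∀ i → (λ h → 1# * rows (rowOf l j i) h) ≐
      λ h → sum {suc L} λ s → (α j ^ toℕ s * ν ((L ℕ.+ suc (toℕ i)) C (L ℕ.∸ toℕ s))) * δ s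
        (opposite h)
    expand i h = begin
      1# * rows (rowOf l j i) h
        ≈⟨ *-identityˡ _ ⟩
      rows (rowOf l j i) h
        ≡⟨ ≡.cong-app (rows-rowOf j i) h ⟩
      ν ((L ℕ.+ suc (toℕ i)) C toℕ h) * α j ^ (L ℕ.∸ toℕ h)
        ≡⟨ ≡.cong₂ (λ p q → ν ((L ℕ.+ suc (toℕ i)) C p) * α j ^ q)
             (≡.trans (≡.cong (L ℕ.∸_) (opposite-prop h)) (ℕ.m∸[m∸n]≡n (toℕ≤pred[n] h)))
               (opposite-prop h) ⟨
      ν ((L ℕ.+ suc (toℕ i)) C (L ℕ.∸ toℕ (opposite h))) * α j ^ toℕ (opposite h)
        ≈⟨ *-comm _ _ ⟩
      α j ^ toℕ (opposite h) * ν ((L ℕ.+ suc (toℕ i)) C (L ℕ.∸ toℕ (opposite h)))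
        ≈⟨ sum-δ {suc L} (λ s → α j ^ toℕ s * ν ((L ℕ.+ suc (toℕ i)) C (L ℕ.∸ toℕ s)))
            (opposite h) ⟨
      sum {suc L} (λ s → (α j ^ toℕ s * ν ((L ℕ.+ suc (toℕ i)) C (L ℕ.∸ toℕ s))) * δ s
        (opposite h)) ∎

  -- `C-regroup` brings the rescaled entry into the form expanded by `expand-x` and `expand-y`, with
  -- C(L+k, h) as the factor n of the column and L - h as the exponent.
  scaled-entry : ∀ {k a} → a ℕ.< k → ∀ u z (h : Fin (suc L)) → let κ = k ℕ.∸ suc a in
    (ν ((L ℕ.+ k) C κ) * u ^ κ) * (ν ((L ℕ.+ suc a) C toℕ h) * z ^ (L ℕ.∸ toℕ h)) ≈
    ν ((L ℕ.+ k) C toℕ h) * ((u ^ κ * ν ((L ℕ.∸ toℕ h ℕ.+ k) C κ)) * z ^ (L ℕ.∸ toℕ h))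
  scaled-entry {k} {a} a<k u z h = begin
    (ν ((L ℕ.+ k) C κ) * u ^ κ) * (ν ((L ℕ.+ suc a) C toℕ h) * z ^ p)
      ≈⟨ solve 4 (λ p w q z → (p :* w) :* (q :* z) := ((p :* q) :* w) :* z) refl (ν ((L ℕ.+ k) C κ))
          (u ^ κ) (ν ((L ℕ.+ suc a) C toℕ h)) (z ^ p) ⟩
    ((ν ((L ℕ.+ k) C κ) * ν ((L ℕ.+ suc a) C toℕ h)) * u ^ κ) * z ^ p
      ≈⟨ *-congʳ (*-congʳ (trans (sym (ν-* ((L ℕ.+ k) C κ) _))
          (trans (ν≡ (C-regroup a<k (toℕ≤pred[n] h))) (ν-* ((L ℕ.+ k) C toℕ h) _)))) ⟩
    ((ν ((L ℕ.+ k) C toℕ h) * ν ((p ℕ.+ k) C κ)) * u ^ κ) * z ^ p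
      ≈⟨ solve 4 (λ p q w z → ((p :* q) :* w) :* z := p :* ((w :* q) :* z)) refl
          (ν ((L ℕ.+ k) C toℕ h)) (ν ((p ℕ.+ k) C κ)) (u ^ κ) (z ^ p) ⟩
    ν ((L ℕ.+ k) C toℕ h) * ((u ^ κ * ν ((p ℕ.+ k) C κ)) * z ^ p) ∎
    where
    p κ : ℕ
    p = L ℕ.∸ toℕ h
    κ = k ℕ.∸ suc a

  product-splitAt : ∀ a {b} (f : Vector Carrier a) (g : Vector Carrier b) →
    product {a ℕ.+ b} (λ p → [ f , g ]′ (splitAt a p)) ≈ product f * product g
  product-splitAt zero    f g = sym (*-identityˡ _)
  product-splitAt (suc a) f g = trans (*-congˡ (trans
    (product-cong {a ℕ.+ _} λ p → reflexive (shift p)) (product-splitAt a (f ∘ suc) g)))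
      (sym (*-assoc _ _ _))
    where
    shift : ∀ p → [ f , g ]′ (splitAt (suc a) (suc p)) ≡ [ f ∘ suc , g ]′ (splitAt a p)
    shift p with splitAt a p
    ... | inj₁ _ = ≡.refl
    ... | inj₂ _ = ≡.refl

  -- The factor by which the first k rows of a block are multiplied, apart
  -- from its power of u.
  N : ℕ → Carrier
  N k = product {k} λ a → ν ((L ℕ.+ k) C (k ℕ.∸ suc (toℕ a)))

  -- The exponent on the left is C(2k, 2). The factors `u ^ e` and `N k` remain on the right because
  -- removing them needs a domain and the primality of `u`, whereas the ring is arbitrary here.
  difference-∣ : ∀ {F : Functional L (suc L)} → IsVolume F → ∀ {i j} → i ≢ j → ∀ u → α i ≈ α j + u →
    let k = l i ℕ.⊓ l j ; e = k C 2 ℕ.+ k C 2 in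
    u ^ (k ℕ.* k ℕ.+ e) ∣ (N k * N k * u ^ e) * F rows
  difference-∣ {F} vol {i} {j} i≢j u αi≈ = ∣ʳ-respʳ-≈ (*-congʳ factor) (∣ʳ-respˡ-≈
    (reflexive (≡.cong (u ^_) ([a+b]C2 k k)))
    (u^qC2∣ vol u ρ ρ-injective scale W coefficient rows expand))
    where
    k = l i ℕ.⊓ l j
    open Expansions u

    W : Fin (suc L) → Row (suc L)
    W s h = ν ((L ℕ.+ k) C toℕ h) * b (α j) (L ℕ.∸ toℕ h) (toℕ s)

    k≤lᵢ : k ℕ.≤ l i
    k≤lᵢ = ℕ.m⊓n≤m (l i) (l j)
    k≤lⱼ : k ℕ.≤ l j
    k≤lⱼ = ℕ.m⊓n≤n (l i) (l j)
    κ : Fin k → ℕ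
    κ a = k ℕ.∸ suc (toℕ a)
    place : Fin k ⊎ Fin k → Σ (Fin m) λ j → Fin (l j)
    place (inj₁ a) = i , inject≤ a k≤lᵢ
    place (inj₂ a) = j , inject≤ a k≤lⱼ
    inject≤-cancel : ∀ {n n′} (a b : Fin k) {p : k ℕ.≤ n} {q : k ℕ.≤ n′} →
      toℕ (inject≤ a p) ≡ toℕ (inject≤ b q) → a ≡ b
    inject≤-cancel a b {p} {q} e = toℕ-injective
      (≡.trans (≡.sym (toℕ-inject≤ a p)) (≡.trans e (toℕ-inject≤ b q)))
    place-injective : Injective _≡_ _≡_ place
    place-injective {inj₁ a} {inj₁ b} e = ≡.cong inj₁
      (inject≤-cancel a b {k≤lᵢ} {k≤lᵢ} (≡.cong (toℕ ∘ proj₂) e))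
    place-injective {inj₁ a} {inj₂ b} e = contradiction (≡.cong proj₁ e) i≢j
    place-injective {inj₂ a} {inj₁ b} e = contradiction (≡.sym (≡.cong proj₁ e)) i≢j
    place-injective {inj₂ a} {inj₂ b} e = ≡.cong inj₂
      (inject≤-cancel a b {k≤lⱼ} {k≤lⱼ} (≡.cong (toℕ ∘ proj₂) e))

    place′ : Fin (k ℕ.+ k) → Σ (Fin m) λ j → Fin (l j)
    place′ = place ∘ splitAt k
    ρ : Fin (k ℕ.+ k) → Fin L
    ρ p = rowOf l (proj₁ (place′ p)) (proj₂ (place′ p))
    splitAt-injective : Injective _≡_ _≡_ (splitAt k {k})
    splitAt-injective {p} {q} e = ≡.trans (≡.sym (join-splitAt k k p))
      (≡.trans (≡.cong (join k k) e) (join-splitAt k k q))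
    ρ-injective : Injective _≡_ _≡_ ρ
    ρ-injective = rowOf-injective place′ (splitAt-injective ∘ place-injective)

    half : Fin k → Carrier
    half a = ν ((L ℕ.+ k) C κ a) * u ^ κ a
    scale : Fin (k ℕ.+ k) → Carrier
    scale p = [ half , half ]′ (splitAt k p)
    coefficient : Fin (k ℕ.+ k) → Fin (suc L) → Carrier
    -- For block `i` this is `γ` written out, because `γ` is formally parametrised by the data of a
    -- column.
    coefficient p s = [ (λ a → sum {suc L} λ t →
      (d k (κ a) (toℕ t) * (α j + u) ^ toℕ t) * ν (toℕ s C toℕ t))
                      , (λ a → d k (κ a) (toℕ s) * α j ^ toℕ s) ]′ (splitAt k p)

    product-half : product half ≈ N k * u ^ (k C 2)
    product-half = trans (product-* {k} _ _) (*-congˡ (trans (product-^ {k} u κ)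
      (reflexive (≡.cong (u ^_) (total-descending k)))))
    factor : product scale ≈ N k * N k * u ^ (k C 2 ℕ.+ k C 2)
    factor = begin
      product scale ≈⟨ product-splitAt k half half ⟩
      product half * product half ≈⟨ *-cong product-half product-half ⟩
      (N k * u ^ (k C 2)) * (N k * u ^ (k C 2))
        ≈⟨ solve 2 (λ n w → (n :* w) :* (n :* w) := (n :* n) :* (w :* w)) refl (N k) (u ^ (k C 2)) ⟩
      N k * N k * (u ^ (k C 2) * u ^ (k C 2)) ≈⟨ *-congˡ (^-homo-* u (k C 2) (k C 2)) ⟨
      N k * N k * u ^ (k C 2 ℕ.+ k C 2) ∎

    entry-inject≤ : ∀ j (a : Fin k) (le : k ℕ.≤ l j) h →
      rows (rowOf l j (inject≤ a le)) h ≡ entry j (toℕ a) h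
    entry-inject≤ j a le h = ≡.cong-app (≡.trans (rows-rowOf j _)
      (≡.cong (entry j) (toℕ-inject≤ a le))) h

    expand : ∀ p → (λ h → scale p * rows (ρ p) h) ≐ λ h → sum {suc L} λ s →
      (u ^ toℕ s * coefficient p s) * W s h
    expand p h with splitAt k p
    ... | inj₁ a = trans (*-congˡ (trans (reflexive (entry-inject≤ i a k≤lᵢ h))
      (*-congˡ (^-congˡ (L ℕ.∸ toℕ h) αi≈))))
      (trans (scaled-entry (toℕ<n a) u _ h) (expand-x (α j) k (κ a) (L ℕ.∸ toℕ h) (suc L)
        (s≤s (ℕ.m∸n≤m L (toℕ h))) (ν ((L ℕ.+ k) C toℕ h))))
    ... | inj₂ a = trans (*-congˡ (reflexive (entry-inject≤ j a k≤lⱼ h)))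
      (trans (scaled-entry (toℕ<n a) u _ h) (expand-y (α j) k (κ a) (L ℕ.∸ toℕ h) (suc L)
        (s≤s (ℕ.m∸n≤m L (toℕ h))) (ν ((L ℕ.+ k) C toℕ h))))

-- Relative primality in a domain

-- The decision of x ≈ 0 allows exact degrees and orders to be found by search, and it drives the
-- case distinction that passes the domain property to polynomials.
record IsDomain {c ℓ} (R : CommutativeRing c ℓ) : Set (c ⊔ ℓ) where
  open CommutativeRing R
  field
    1≉0         : 1# ≉ 0#
    zeroProduct : ∀ {x y} → x * y ≈ 0# → x ≈ 0# ⊎ y ≈ 0#
    _≈0?        : ∀ x → Dec (x ≈ 0#)

module DomainProperties {c ℓ} {R : CommutativeRing c ℓ} (isDomain : IsDomain R) where
  open CommutativeRing R hiding (zero)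
  open IsDomain isDomain
  open RawSemiringDefs (Semiring.rawSemiring semiring) using (Prime)
  open CommutativeMonoidSum *-commutativeMonoid using () renaming (sum to product)
  open CommutativeSemiringExp commutativeSemiring using (_^_)
  open RingProperties ring using (-‿distribˡ-*; x∙y⁻¹≈ε⇒x≈y; x≈y⇒x∙y⁻¹≈ε)
  open SemiringDivisibility semiring using (_∣_; _∤_; _,_; ∣ʳ-respʳ-≈; ∣ʳ-respˡ-≈; ε∣ʳ_)
  open SetoidReasoning setoid
  open RingSolver commutativeSemiring using (solve; _:*_; _:=_)

  *-≉0 : ∀ {x y} → x ≉ 0# → y ≉ 0# → x * y ≉ 0#
  *-≉0 x≉0 y≉0 e with zeroProduct e
  ... | inj₁ x≈0 = x≉0 x≈0
  ... | inj₂ y≈0 = y≉0 y≈0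

  product-≉0 : ∀ {n} (f : Vector Carrier n) → (∀ i → f i ≉ 0#) → product f ≉ 0#
  product-≉0 {zero}  f h = 1≉0
  product-≉0 {suc n} f h = *-≉0 (h zero) (product-≉0 (f ∘ suc) (h ∘ suc))

  ^-≉0 : ∀ {x} n → x ≉ 0# → x ^ n ≉ 0#
  ^-≉0 zero    x≉0 = 1≉0
  ^-≉0 (suc n) x≉0 = *-≉0 x≉0 (^-≉0 n x≉0)

  *-cancelʳ : ∀ {x y z} → z ≉ 0# → x * z ≈ y * z → x ≈ y
  *-cancelʳ {x} {y} {z} z≉0 e with zeroProduct {x - y} {z} (begin
      (x - y) * z         ≈⟨ distribʳ z x (- y) ⟩
      x * z + - y * z     ≈⟨ +-congˡ (-‿distribˡ-* y z) ⟨
      x * z - y * z       ≈⟨ x≈y⇒x∙y⁻¹≈ε e ⟩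
      0#                  ∎)
  ... | inj₁ x-y≈0 = x∙y⁻¹≈ε⇒x≈y x y x-y≈0
  ... | inj₂ z≈0   = contradiction z≈0 z≉0

  ∣-cancelʳ : ∀ {x y z} → z ≉ 0# → x * z ∣ y * z → x ∣ y
  ∣-cancelʳ {x} {y} {z} z≉0 (q , e) = q , *-cancelʳ z≉0 (trans (*-assoc q x z) e)

  -- In a domain with unique factorisation: X and Y have no common factor.
  RelativelyPrime : Carrier → Carrier → Set (c ⊔ ℓ)
  RelativelyPrime X Y = ∀ {Q} → X ∣ Y * Q → X ∣ Q

  relPrime-1ˡ : ∀ {Y} → RelativelyPrime 1# Y
  relPrime-1ˡ _ = ε∣ʳ _

  relPrime-1ʳ : ∀ {X} → RelativelyPrime X 1#
  relPrime-1ʳ = ∣ʳ-respʳ-≈ (*-identityˡ _)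

  relPrime-*ʳ : ∀ {X Y Z} → RelativelyPrime X Y → RelativelyPrime X Z → RelativelyPrime X (Y * Z)
  relPrime-*ʳ {X} {Y} {Z} xy xz {Q} h = xz (xy (∣ʳ-respʳ-≈ (*-assoc Y Z Q) h))

  -- `RelativelyPrime` is not visibly symmetric, so products on the left need their own argument: X
  -- divides Q and is cancelled, after which X′ divides the quotient.
  relPrime-*ˡ : ∀ {X X′ Y} → X ≉ 0# → RelativelyPrime X Y → RelativelyPrime X′ Y →
    RelativelyPrime (X * X′) Y
  relPrime-*ˡ {X} {X′} {Y} X≉0 xy x′y {Q} h@(r , r-eq) with
    xy {Q} (r * X′ , trans (solve 3 (λ r x′ x → (r :* x′) :* x := r :* (x :* x′)) refl r X′ X) r-eq)
  ... | Q′ , Q′X≈Q with x′y {Q′} (∣-cancelʳ X≉0 (∣ʳ-respʳ-≈ (begin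
          Y * Q          ≈⟨ *-congˡ Q′X≈Q ⟨
          Y * (Q′ * X)   ≈⟨ *-assoc Y Q′ X ⟨
          Y * Q′ * X     ∎) (∣ʳ-respˡ-≈ (*-comm X X′) h)))
  ... | q , qX′≈Q′ = q , (begin
    q * (X * X′)      ≈⟨ solve 3 (λ q x x′ → q :* (x :* x′) := (q :* x′) :* x) refl q X X′ ⟩
    (q * X′) * X      ≈⟨ *-congʳ qX′≈Q′ ⟩
    Q′ * X            ≈⟨ Q′X≈Q ⟩
    Q                 ∎)

  relPrime-^ʳ : ∀ {X Y} n → RelativelyPrime X Y → RelativelyPrime X (Y ^ n)
  relPrime-^ʳ zero    h = relPrime-1ʳ
  relPrime-^ʳ (suc n) h = relPrime-*ʳ h (relPrime-^ʳ n h)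

  relPrime-productʳ : ∀ {n X} (f : Vector Carrier n) → (∀ i → RelativelyPrime X (f i)) →
    RelativelyPrime X (product f)
  relPrime-productʳ {zero}  f h = relPrime-1ʳ
  relPrime-productʳ {suc n} f h = relPrime-*ʳ (h zero) (relPrime-productʳ (f ∘ suc) (h ∘ suc))

  relPrime-productˡ : ∀ {n Y} (f : Vector Carrier n) → (∀ i → f i ≉ 0#) →
    (∀ i → RelativelyPrime (f i) Y) → RelativelyPrime (product f) Y
  relPrime-productˡ {zero}  f nz h = relPrime-1ˡ
  relPrime-productˡ {suc n} f nz h = relPrime-*ˡ (nz zero) (h zero)
    (relPrime-productˡ (f ∘ suc) (nz ∘ suc) (h ∘ suc))

  relPrime⇒*-∣ : ∀ {X Y D} → RelativelyPrime X Y → X ∣ D → Y ∣ D → X * Y ∣ D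
  relPrime⇒*-∣ {X} {Y} {D} xy X∣D (Q , QY≈D) with xy {Q}
    (∣ʳ-respʳ-≈ (trans (sym QY≈D) (*-comm Q Y)) X∣D)
  ... | q , qX≈Q = q , trans (sym (*-assoc q X Y)) (trans (*-congʳ qX≈Q) QY≈D)

  relPrime⇒product-∣ : ∀ {n D} (f : Vector Carrier n) →
    (∀ i j → i Fin.< j → RelativelyPrime (f i) (f j)) →
    (∀ i → f i ∣ D) → product f ∣ D
  relPrime⇒product-∣ {zero}  f rp h = ε∣ʳ _
  relPrime⇒product-∣ {suc n} f rp h = relPrime⇒*-∣
    (relPrime-productʳ (f ∘ suc) λ j → rp zero (suc j) (s≤s z≤n)) (h zero)
    (relPrime⇒product-∣ (f ∘ suc) (λ i j i<j → rp (suc i) (suc j) (s≤s i<j)) (h ∘ suc))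

  -- One factor p at a time is moved into Q by primality and then cancelled.
  prime∤⇒relPrime : ∀ {p a} → Prime p → p ∤ a → ∀ e → RelativelyPrime (p ^ e) a
  prime∤⇒relPrime         prime p∤a zero    h = ε∣ʳ _
  prime∤⇒relPrime {p} {a} prime p∤a (suc e) {Q} h@(r , r-eq)
    with RawSemiringDefs.Prime.split-∣ prime {a} {Q}
      (r * p ^ e , trans (solve 3 (λ r w p → (r :* w) :* p := r :* (p :* w)) refl r (p ^ e) p) r-eq)
  ... | inj₁ p∣a = contradiction p∣a p∤a
  ... | inj₂ (Q′ , Q′p≈Q) with prime∤⇒relPrime prime p∤a e {Q′}
    (∣-cancelʳ (RawSemiringDefs.Prime.p≉0 prime)
          (∣ʳ-respʳ-≈ (trans (*-congˡ (sym Q′p≈Q)) (sym (*-assoc a Q′ p)))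
            (∣ʳ-respˡ-≈ (*-comm p (p ^ e)) h)))
  ... | q , eq = q , (begin
    q * (p * p ^ e)    ≈⟨ solve 3 (λ q p w → q :* (p :* w) := (q :* w) :* p) refl q p (p ^ e) ⟩
    (q * p ^ e) * p    ≈⟨ *-congʳ eq ⟩
    Q′ * p             ≈⟨ Q′p≈Q ⟩
    Q                  ∎)

  -- An endomorphism that kills p and moves every element by a multiple of p
  -- identifies the quotient by p with a subring of the domain.
  retraction⇒prime : ∀ {p} (σ : Carrier → Carrier) →
    (∀ {x y} → x ≈ y → σ x ≈ σ y) → (∀ x y → σ (x * y) ≈ σ x * σ y) → σ 1# ≈ 1# → σ 0# ≈ 0# →
    σ p ≈ 0# → (∀ x → p ∣ x - σ x) → p ≉ 0# → Prime p × (∀ {x} → σ x ≉ 0# → p ∤ x)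
  retraction⇒prime {p} σ σ-cong σ-* σ-1 σ-0 σp≈0 moves p≉0 = prime , nondivisible
    where
    σ-∣ : ∀ {x} → p ∣ x → σ x ≈ 0#
    σ-∣ {x} (q , e) = begin
      σ x          ≈⟨ σ-cong e ⟨
      σ (q * p)    ≈⟨ σ-* q p ⟩
      σ q * σ p    ≈⟨ *-congˡ σp≈0 ⟩
      σ q * 0#     ≈⟨ zeroʳ _ ⟩
      0#           ∎
    nondivisible : ∀ {x} → σ x ≉ 0# → p ∤ x
    nondivisible σx≉0 p∣x = σx≉0 (σ-∣ p∣x)
    kernel : ∀ {x} → σ x ≈ 0# → p ∣ x
    kernel {x} e = ∣ʳ-respʳ-≈ (begin
      x - σ x     ≈⟨ +-congˡ (-‿cong e) ⟩
      x - 0#      ≈⟨ +-congˡ (RingProperties.-0#≈0# ring) ⟩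
      x + 0#      ≈⟨ +-identityʳ x ⟩
      x           ∎) (moves x)
    prime : Prime p
    prime = record
      { p≉0     = p≉0
      ; p∤1     = nondivisible λ e → 1≉0 (trans (sym σ-1) e)
      ; split-∣ = split
      }
      where
      split : ∀ {x y} → p ∣ x * y → p ∣ x ⊎ p ∣ y
      split {x} {y} h with zeroProduct (trans (sym (σ-* x y)) (σ-∣ h))
      ... | inj₁ e = inj₁ (kernel e)
      ... | inj₂ e = inj₂ (kernel e)

open import Data.List.Base using (List; []; _∷_; map; tabulate)
open import Data.List.Properties using (tabulate-cong)

-- Polynomial rings

module PolyRing {c ℓ} (R : CommutativeRing c ℓ) where
  open CommutativeRing R hiding (zero; +-rawMonoid)
  open PolyOps rawRing
  open RawRing (Poly rawRing) using () renaming (-_ to neg)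
  open RingProperties ring using (-0#≈0#)
  open SetoidReasoning setoid

  infix 4 _≋_

  -- The equality of `Poly rawRing` wrapped in a record, so that the two
  -- polynomials can be inferred from a proof.
  record _≋_ (p q : List Carrier) : Set ℓ where
    constructor mk
    field at : ∀ n → coeff p n ≈ coeff q n

  open _≋_ public

  coeff-add : ∀ p q n → coeff (add p q) n ≈ coeff p n + coeff q n
  coeff-add []      q       n       = sym (+-identityˡ _)
  coeff-add (a ∷ p) []      n       = sym (+-identityʳ _)
  coeff-add (a ∷ p) (b ∷ q) zero    = refl
  coeff-add (a ∷ p) (b ∷ q) (suc n) = coeff-add p q n

  coeff-scale : ∀ a p n → coeff (map (a *_) p) n ≈ a * coeff p n
  coeff-scale a []      n       = sym (zeroʳ a)
  coeff-scale a (b ∷ p) zero    = refl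
  coeff-scale a (b ∷ p) (suc n) = coeff-scale a p n

  coeff-neg : ∀ p n → coeff (neg p) n ≈ - coeff p n
  coeff-neg []      n       = sym -0#≈0#
  coeff-neg (b ∷ p) zero    = refl
  coeff-neg (b ∷ p) (suc n) = coeff-neg p n

  ≋-refl : ∀ {p} → p ≋ p
  ≋-refl = mk λ n → refl

  ≋-sym : ∀ {p q} → p ≋ q → q ≋ p
  ≋-sym e = mk λ n → sym (at e n)

  ≋-trans : ∀ {p q r} → p ≋ q → q ≋ r → p ≋ r
  ≋-trans e f = mk λ n → trans (at e n) (at f n)

  ≋-setoid : Setoid c ℓ
  ≋-setoid = record
    { _≈_ = _≋_
    ; isEquivalence = record { refl = ≋-refl ; sym = ≋-sym ; trans = ≋-trans }
    }

  module ≋-Reasoning = SetoidReasoning ≋-setoid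

  cons-cong : ∀ {a b p q} → a ≈ b → p ≋ q → (a ∷ p) ≋ (b ∷ q)
  cons-cong e f = mk λ { zero → e ; (suc n) → at f n }

  0∷[]≋[] : (0# ∷ []) ≋ []
  0∷[]≋[] = mk λ { zero → refl ; (suc n) → refl }

  add-cong : ∀ {p p′ q q′} → p ≋ p′ → q ≋ q′ → add p q ≋ add p′ q′
  add-cong {p} {p′} {q} {q′} e f = mk λ n → begin
    coeff (add p q) n         ≈⟨ coeff-add p q n ⟩
    coeff p n + coeff q n     ≈⟨ +-cong (at e n) (at f n) ⟩
    coeff p′ n + coeff q′ n   ≈⟨ coeff-add p′ q′ n ⟨
    coeff (add p′ q′) n       ∎

  add-assoc : ∀ p q r → add (add p q) r ≋ add p (add q r)
  add-assoc p q r = mk λ n → begin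
    coeff (add (add p q) r) n              ≈⟨ coeff-add (add p q) r n ⟩
    coeff (add p q) n + coeff r n          ≈⟨ +-congʳ (coeff-add p q n) ⟩
    (coeff p n + coeff q n) + coeff r n    ≈⟨ +-assoc _ _ _ ⟩
    coeff p n + (coeff q n + coeff r n)    ≈⟨ +-congˡ (coeff-add q r n) ⟨
    coeff p n + coeff (add q r) n          ≈⟨ coeff-add p (add q r) n ⟨
    coeff (add p (add q r)) n              ∎

  add-comm : ∀ p q → add p q ≋ add q p
  add-comm p q = mk λ n → begin
    coeff (add p q) n      ≈⟨ coeff-add p q n ⟩
    coeff p n + coeff q n  ≈⟨ +-comm _ _ ⟩
    coeff q n + coeff p n  ≈⟨ coeff-add q p n ⟨
    coeff (add q p) n      ∎

  add-identityʳ : ∀ p → add p [] ≋ p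
  add-identityʳ p = add-comm p []

  add-inverseˡ : ∀ p → add (neg p) p ≋ []
  add-inverseˡ p = mk λ n → begin
    coeff (add (neg p) p) n     ≈⟨ coeff-add (neg p) p n ⟩
    coeff (neg p) n + coeff p n ≈⟨ +-congʳ (coeff-neg p n) ⟩
    - coeff p n + coeff p n     ≈⟨ -‿inverseˡ _ ⟩
    0#                          ∎

  neg-cong : ∀ {p q} → p ≋ q → neg p ≋ neg q
  neg-cong {p} {q} e = mk λ n →
    trans (coeff-neg p n) (trans (-‿cong (at e n)) (sym (coeff-neg q n)))

  add-interchange : ∀ p q r s → add (add p q) (add r s) ≋ add (add p r) (add q s)
  add-interchange p q r s = ≋R.begin
    add (add p q) (add r s)    ≋R.≈⟨ add-assoc p q (add r s) ⟩
    add p (add q (add r s))    ≋R.≈⟨ add-cong (≋-refl {p}) (add-assoc q r s) ⟨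
    add p (add (add q r) s)    ≋R.≈⟨ add-cong (≋-refl {p}) (add-cong (add-comm q r) ≋-refl) ⟩
    add p (add (add r q) s)    ≋R.≈⟨ add-cong (≋-refl {p}) (add-assoc r q s) ⟩
    add p (add r (add q s))    ≋R.≈⟨ add-assoc p r (add q s) ⟨
    add (add p r) (add q s)    ≋R.∎
    where module ≋R = ≋-Reasoning

  scale-cong : ∀ {a b p q} → a ≈ b → p ≋ q → map (a *_) p ≋ map (b *_) q
  scale-cong {a} {b} {p} {q} e f = mk λ n →
    trans (coeff-scale a p n) (trans (*-cong e (at f n)) (sym (coeff-scale b q n)))

  scale-add : ∀ a p q → map (a *_) (add p q) ≋ add (map (a *_) p) (map (a *_) q)
  scale-add a p q = mk λ n → begin
    coeff (map (a *_) (add p q)) n                      ≈⟨ coeff-scale a (add p q) n ⟩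
    a * coeff (add p q) n                               ≈⟨ *-congˡ (coeff-add p q n) ⟩
    a * (coeff p n + coeff q n)                         ≈⟨ distribˡ _ _ _ ⟩
    a * coeff p n + a * coeff q n
      ≈⟨ +-cong (coeff-scale a p n) (coeff-scale a q n) ⟨
    coeff (map (a *_) p) n + coeff (map (a *_) q) n
      ≈⟨ coeff-add (map (a *_) p) (map (a *_) q) n ⟨
    coeff (add (map (a *_) p) (map (a *_) q)) n         ∎

  scale-+ : ∀ a b p → map ((a + b) *_) p ≋ add (map (a *_) p) (map (b *_) p)
  scale-+ a b p = mk λ n → begin
    coeff (map ((a + b) *_) p) n                  ≈⟨ coeff-scale (a + b) p n ⟩
    (a + b) * coeff p n                           ≈⟨ distribʳ _ _ _ ⟩
    a * coeff p n + b * coeff p n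
      ≈⟨ +-cong (coeff-scale a p n) (coeff-scale b p n) ⟨
    coeff (map (a *_) p) n + coeff (map (b *_) p) n
      ≈⟨ coeff-add (map (a *_) p) (map (b *_) p) n ⟨
    coeff (add (map (a *_) p) (map (b *_) p)) n   ∎

  scale-scale : ∀ a b p → map (a *_) (map (b *_) p) ≋ map ((a * b) *_) p
  scale-scale a b p = mk λ n → begin
    coeff (map (a *_) (map (b *_) p)) n  ≈⟨ coeff-scale a (map (b *_) p) n ⟩
    a * coeff (map (b *_) p) n           ≈⟨ *-congˡ (coeff-scale b p n) ⟩
    a * (b * coeff p n)                  ≈⟨ *-assoc _ _ _ ⟨
    a * b * coeff p n                    ≈⟨ coeff-scale (a * b) p n ⟨
    coeff (map ((a * b) *_) p) n         ∎

  scale-0 : ∀ {a} p → a ≈ 0# → map (a *_) p ≋ []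
  scale-0 {a} p e = mk λ n → trans (coeff-scale a p n) (trans (*-congʳ e) (zeroˡ _))

  scale-1 : ∀ p → map (1# *_) p ≋ p
  scale-1 p = mk λ n → trans (coeff-scale 1# p n) (*-identityˡ _)

  mul-zeroʳ : ∀ p → mul p [] ≋ []
  mul-zeroʳ []      = ≋-refl
  mul-zeroʳ (a ∷ p) = ≋-trans (cons-cong refl (mul-zeroʳ p)) 0∷[]≋[]

  -- `mul` recurses on its left factor; this is the matching recursion on the right factor, from
  -- which commutativity follows.
  mul-cons : ∀ p b q → mul p (b ∷ q) ≋ add (map (b *_) p) (0# ∷ mul p q)
  mul-cons []      b q = ≋-sym 0∷[]≋[]
  mul-cons (a ∷ p) b q = cons-cong (+-congʳ (*-comm a b)) (≋R.begin
    add (map (a *_) q) (mul p (b ∷ q))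
      ≋R.≈⟨ add-cong ≋-refl (mul-cons p b q) ⟩
    add (map (a *_) q) (add (map (b *_) p) (0# ∷ mul p q))
      ≋R.≈⟨ add-assoc (map (a *_) q) _ _ ⟨
    add (add (map (a *_) q) (map (b *_) p)) (0# ∷ mul p q)
      ≋R.≈⟨ add-cong (add-comm (map (a *_) q) _) ≋-refl ⟩
    add (add (map (b *_) p) (map (a *_) q)) (0# ∷ mul p q)
      ≋R.≈⟨ add-assoc (map (b *_) p) _ _ ⟩
    add (map (b *_) p) (add (map (a *_) q) (0# ∷ mul p q)) ≋R.∎)
    where module ≋R = ≋-Reasoning

  mul-comm : ∀ p q → mul p q ≋ mul q p
  mul-comm []      q = ≋-sym (mul-zeroʳ q)
  mul-comm (a ∷ p) q = ≋-trans (add-cong ≋-refl (cons-cong refl (mul-comm p q)))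
    (≋-sym (mul-cons q a p))

  mul-congʳ : ∀ p {q q′} → q ≋ q′ → mul p q ≋ mul p q′
  mul-congʳ []      e = ≋-refl
  mul-congʳ (a ∷ p) e = add-cong (scale-cong refl e) (cons-cong refl (mul-congʳ p e))

  mul-cong : ∀ {p p′ q q′} → p ≋ p′ → q ≋ q′ → mul p q ≋ mul p′ q′
  mul-cong {p} {p′} {q} {q′} e f = ≋-trans (mul-congʳ p f)
    (≋-trans (mul-comm p q′) (≋-trans (mul-congʳ q′ e) (mul-comm q′ p′)))

  mul-distribʳ : ∀ r p q → mul (add p q) r ≋ add (mul p r) (mul q r)
  mul-distribʳ r []      q  = ≋-refl
  mul-distribʳ r (a ∷ p) [] = ≋-sym (add-identityʳ (mul (a ∷ p) r))
  mul-distribʳ r (a ∷ p) (b ∷ q) = ≋-trans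
    (add-cong (scale-+ a b r) (cons-cong (sym (+-identityˡ 0#)) (mul-distribʳ r p q)))
    (add-interchange (map (a *_) r) (map (b *_) r) (0# ∷ mul p r) (0# ∷ mul q r))

  mul-distribˡ : ∀ r p q → mul r (add p q) ≋ add (mul r p) (mul r q)
  mul-distribˡ r p q = ≋-trans (mul-comm r (add p q)) (≋-trans (mul-distribʳ r p q)
    (add-cong (mul-comm p r) (mul-comm q r)))

  mul-scaleˡ : ∀ a p q → mul (map (a *_) p) q ≋ map (a *_) (mul p q)
  mul-scaleˡ a []      q = ≋-refl
  mul-scaleˡ a (b ∷ p) q = ≋-trans
    (add-cong (≋-sym (scale-scale a b q)) (cons-cong (sym (zeroʳ a)) (mul-scaleˡ a p q)))
    (≋-sym (scale-add a (map (b *_) q) (0# ∷ mul p q)))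

  mul-shiftˡ : ∀ p q → mul (0# ∷ p) q ≋ (0# ∷ mul p q)
  mul-shiftˡ p q = add-cong (scale-0 q refl) ≋-refl

  mul-constˡ : ∀ a q → mul (const a) q ≋ map (a *_) q
  mul-constˡ a q = ≋-trans (add-cong ≋-refl 0∷[]≋[]) (add-identityʳ _)

  mul-assoc : ∀ p q r → mul (mul p q) r ≋ mul p (mul q r)
  mul-assoc []      q r = ≋-refl
  mul-assoc (a ∷ p) q r = ≋-trans (mul-distribʳ r (map (a *_) q) (0# ∷ mul p q))
    (add-cong (mul-scaleˡ a q r)
      (≋-trans (mul-shiftˡ (mul p q) r) (cons-cong refl (mul-assoc p q r))))

  mul-identityˡ : ∀ p → mul (const 1#) p ≋ p
  mul-identityˡ p = ≋-trans (mul-constˡ 1# p) (scale-1 p)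

  polyRing : CommutativeRing c ℓ
  polyRing = record
    { Carrier = RawRing.Carrier (Poly rawRing)
    ; _≈_ = RawRing._≈_ (Poly rawRing)
    ; _+_ = add
    ; _*_ = mul
    ; -_  = neg
    ; 0#  = []
    ; 1#  = const 1#
    ; isCommutativeRing = record
      { isRing = record
        { +-isAbelianGroup = record
          { isGroup = record
            { isMonoid = record
              { isSemigroup = record
                { isMagma = record
                  { isEquivalence = record
                    { refl  = λ n → refl
                    ; sym   = λ e n → sym (e n)
                    ; trans = λ e f n → trans (e n) (f n)
                    }
                  ; ∙-cong = λ {p} {p′} e f → at (add-cong {p} {p′} (mk e) (mk f))
                  }
                ; assoc = λ p q r → at (add-assoc p q r)
                }
              ; identity = (λ p n → refl) , λ p → at (add-identityʳ p)
              }
            ; inverse = (λ p → at (add-inverseˡ p))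
                      , λ p → at (≋-trans (add-comm p (neg p)) (add-inverseˡ p))
            ; ⁻¹-cong = λ {p} {q} e → at (neg-cong {p} {q} (mk e))
            }
          ; comm = λ p q → at (add-comm p q)
          }
        ; *-cong = λ {p} {p′} e f → at (mul-cong {p} {p′} (mk e) (mk f))
        ; *-assoc = λ p q r → at (mul-assoc p q r)
        ; *-identity = (λ p → at (mul-identityˡ p))
                     , λ p → at (≋-trans (mul-comm p (const 1#)) (mul-identityˡ p))
        ; distrib = (λ r p q → at (mul-distribˡ r p q)) , λ r p q → at (mul-distribʳ r p q)
        }
      ; *-comm = λ p q → at (mul-comm p q)
      }
    }

-- Ring homomorphisms

module _ {c ℓ c′ ℓ′} (R : CommutativeRing c ℓ) (S : CommutativeRing c′ ℓ′) where
  private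
    module R = CommutativeRing R
    module S = CommutativeRing S

  IsHom : (R.Carrier → S.Carrier) → Set _
  IsHom = IsRingHomomorphism R.rawRing S.rawRing

  module _ {f : R.Carrier → S.Carrier}
    (f-cong : ∀ {x y} → x R.≈ y → f x S.≈ f y)
    (f-+ : ∀ x y → f (x R.+ y) S.≈ f x S.+ f y)
    (f-* : ∀ x y → f (x R.* y) S.≈ f x S.* f y)
    (f-1 : f R.1# S.≈ S.1#) where
    private
      open SetoidReasoning S.setoid
      open RingProperties S.ring using (+-inverseˡ-unique; x+x≈x⇒x≈0)

      f-0 : f R.0# S.≈ S.0#
      f-0 = x+x≈x⇒x≈0 _ (S.trans (S.sym (f-+ R.0# R.0#)) (f-cong (R.+-identityˡ R.0#)))

      f-neg : ∀ x → f (R.- x) S.≈ S.- f x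
      f-neg x = +-inverseˡ-unique _ _ (S.trans (S.sym (f-+ (R.- x) x))
        (S.trans (f-cong (R.-‿inverseˡ x)) f-0))

    mkHom : IsHom f
    mkHom = record
      { isSemiringHomomorphism = record
        { isNearSemiringHomomorphism = record
          { +-isMonoidHomomorphism = record
            { isMagmaHomomorphism = record
              { isRelHomomorphism = record { cong = f-cong }
              ; homo = f-+
              }
            ; ε-homo = f-0
            }
          ; *-homo = f-*
          }
        ; 1#-homo = f-1
        }
      ; -‿homo = f-neg
      }

  module Hom {f : R.Carrier → S.Carrier} (isHom : IsHom f) where
    open IsRingHomomorphism isHom public
    private
      module R^ = CommutativeSemiringExp R.commutativeSemiring
      module S^ = CommutativeSemiringExp S.commutativeSemiring
      module RΣ = SemiringSum R.semiring
      module SΣ = SemiringSum S.semiring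
      module Rν = BinomialRows R
      module Sν = BinomialRows S

    ^-homo : ∀ x n → f (x R^.^ n) S.≈ f x S^.^ n
    ^-homo x zero    = 1#-homo
    ^-homo x (suc n) = S.trans (*-homo x (x R^.^ n)) (S.*-congˡ (^-homo x n))

    sum-homo : ∀ {n} (v : Vector R.Carrier n) → f (RΣ.sum v) S.≈ SΣ.sum (f ∘ v)
    sum-homo {zero}  v = 0#-homo
    sum-homo {suc n} v = S.trans (+-homo (v zero) _) (S.+-congˡ (sum-homo (v ∘ suc)))

    ν-homo : ∀ n → f (Rν.ν n) S.≈ Sν.ν n
    ν-homo zero    = 0#-homo
    ν-homo (suc n) = S.trans (+-homo R.1# (Rν.ν n)) (S.+-cong 1#-homo (ν-homo n))

  hom-resp : ∀ {f g} → (∀ x → f x S.≈ g x) → IsHom f → IsHom g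
  hom-resp {f} {g} e h = mkHom
    (λ {x} {y} x≈y → S.trans (S.sym (e x)) (S.trans (⟦⟧-cong x≈y) (e y)))
    (λ x y → S.trans (S.sym (e _)) (S.trans (+-homo x y) (S.+-cong (e x) (e y))))
    (λ x y → S.trans (S.sym (e _)) (S.trans (*-homo x y) (S.*-cong (e x) (e y))))
    (S.trans (S.sym (e _)) 1#-homo)
    where open IsRingHomomorphism h

∘-hom : ∀ {c₁ ℓ₁ c₂ ℓ₂ c₃ ℓ₃} (R : CommutativeRing c₁ ℓ₁) (S : CommutativeRing c₂ ℓ₂)
  (T : CommutativeRing c₃ ℓ₃)
  {f g} → IsHom R S f → IsHom S T g → IsHom R T (g ∘ f)
∘-hom R S T = Composition.isRingHomomorphism (CommutativeRing.trans T)

-- Evaluation, zero products and degrees of polynomials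

module PolyProperties {c ℓ} (R : CommutativeRing c ℓ) where
  open CommutativeRing R hiding (zero)
  open PolyOps rawRing
  open PolyRing R
  open SetoidReasoning setoid
  open RingSolver commutativeSemiring using (solve; _:+_; _:*_; _:=_)

  const-isHom : IsHom R polyRing const
  const-isHom = mkHom R polyRing
    (λ e → at (cons-cong e ≋-refl))
    (λ a b n → refl)
    (λ a b → at (cons-cong (sym (+-identityʳ _)) ≋-refl))
    (λ n → refl)

  module Horner {c′ ℓ′} (S : CommutativeRing c′ ℓ′)
    {f : Carrier → CommutativeRing.Carrier S} (f-isHom : IsHom R S f)
      (x : CommutativeRing.Carrier S) where
    private
      module S = CommutativeRing S
      module f = IsRingHomomorphism f-isHom
      module SR = SetoidReasoning S.setoid
      open RingSolver S.commutativeSemiring using () renaming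
          (solve to solveS; _:+_ to _⊕_; _:*_ to _⊛_; _:=_ to _⊜_)

    horner : List Carrier → S.Carrier
    horner []      = S.0#
    horner (a ∷ p) = f a S.+ x S.* horner p

    private
      f-≈0 : ∀ {a} → a ≈ 0# → f a S.≈ S.0#
      f-≈0 e = S.trans (f.⟦⟧-cong e) f.0#-homo

      horner-≈0 : ∀ p → p ≋ [] → horner p S.≈ S.0#
      horner-≈0 []      e = S.refl
      horner-≈0 (a ∷ p) e = S.trans
        (S.+-cong (f-≈0 (at e 0)) (S.trans (S.*-congˡ (horner-≈0 p (mk λ n → at e (suc n))))
          (S.zeroʳ x))) (S.+-identityˡ S.0#)

      horner-cong : ∀ p q → p ≋ q → horner p S.≈ horner q
      horner-cong []      q       e = S.sym (horner-≈0 q (≋-sym e))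
      horner-cong (a ∷ p) []      e = horner-≈0 (a ∷ p) e
      horner-cong (a ∷ p) (b ∷ q) e =
        S.+-cong (f.⟦⟧-cong (at e 0)) (S.*-congˡ (horner-cong p q (mk λ n → at e (suc n))))

      horner-add : ∀ p q → horner (add p q) S.≈ horner p S.+ horner q
      horner-add []      q       = S.sym (S.+-identityˡ _)
      horner-add (a ∷ p) []      = S.sym (S.+-identityʳ _)
      horner-add (a ∷ p) (b ∷ q) = S.trans (S.+-cong (f.+-homo a b) (S.*-congˡ (horner-add p q)))
        (solveS 5 (λ a b x p q → (a ⊕ b) ⊕ x ⊛ (p ⊕ q) ⊜ (a ⊕ x ⊛ p) ⊕ (b ⊕ x ⊛ q)) S.refl (f a)
          (f b) x (horner p) (horner q))

      horner-scale : ∀ a p → horner (map (a *_) p) S.≈ f a S.* horner p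
      horner-scale a []      = S.sym (S.zeroʳ _)
      horner-scale a (b ∷ p) = S.trans (S.+-cong (f.*-homo a b) (S.*-congˡ (horner-scale a p)))
        (solveS 4 (λ a b x p → a ⊛ b ⊕ x ⊛ (a ⊛ p) ⊜ a ⊛ (b ⊕ x ⊛ p)) S.refl (f a) (f b) x
          (horner p))

      horner-mul : ∀ p q → horner (mul p q) S.≈ horner p S.* horner q
      horner-mul []      q = S.sym (S.zeroˡ _)
      horner-mul (a ∷ p) q = SR.begin
        horner (add (map (a *_) q) (0# ∷ mul p q))
          SR.≈⟨ horner-add (map (a *_) q) (0# ∷ mul p q) ⟩
        horner (map (a *_) q) S.+ (f 0# S.+ x S.* horner (mul p q))
          SR.≈⟨ S.+-cong (horner-scale a q) (S.trans
            (S.+-cong f.0#-homo (S.*-congˡ (horner-mul p q))) (S.+-identityˡ _)) ⟩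
        f a S.* horner q S.+ x S.* (horner p S.* horner q)
          SR.≈⟨ solveS 4 (λ a x p q → a ⊛ q ⊕ x ⊛ (p ⊛ q) ⊜ (a ⊕ x ⊛ p) ⊛ q) S.refl (f a) x
            (horner p) (horner q) ⟩
        horner (a ∷ p) S.* horner q SR.∎

    horner-const : ∀ a → horner (const a) S.≈ f a
    horner-const a = S.trans (S.+-congˡ (S.zeroʳ x)) (S.+-identityʳ _)

    horner-X : horner X S.≈ x
    horner-X = S.trans (S.+-cong f.0#-homo (S.*-congˡ (S.trans (horner-const 1#) f.1#-homo)))
      (S.trans (S.+-identityˡ _) (S.*-identityʳ x))

    horner-isHom : IsHom polyRing S horner
    horner-isHom = mkHom polyRing S (λ {p} {q} e → horner-cong p q (mk e)) horner-add horner-mul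
      (S.trans (horner-const 1#) f.1#-homo)

  X*-shift : ∀ p → mul X p ≋ (0# ∷ p)
  X*-shift p = ≋-trans (mul-shiftˡ (const 1#) p) (cons-cong refl (mul-identityˡ p))

  cons-split : ∀ a p → add (const a) (mul X p) ≋ (a ∷ p)
  cons-split a p = ≋-trans (add-cong (≋-refl {const a}) (X*-shift p))
    (cons-cong (+-identityʳ a) ≋-refl)

  module _ (isDomain : IsDomain R) where
    open IsDomain isDomain

    private
      ≋[]? : ∀ p → Dec (p ≋ [])
      ≋[]? []      = yes ≋-refl
      ≋[]? (a ∷ p) = map′ (λ (e , f) → ≋-trans (cons-cong e f) 0∷[]≋[])
        (λ e → at e 0 , mk λ n → at e (suc n)) (a ≈0? ×-dec ≋[]? p)

      tail≋[] : ∀ {a p} → (a ∷ p) ≋ [] → p ≋ []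
      tail≋[] e = mk λ n → at e (suc n)

      -- The argument looks at the lowest coefficients, since trailing zeros hide the leading ones.
      -- A vanishing constant term means that the variable can be split off that factor; two
      -- non-zero constant terms give a non-zero constant term of the product.
      zero-product-cons : ∀ {a b p q} → Dec (a ≈ 0#) → Dec (b ≈ 0#) →
        (mul p (b ∷ q) ≋ [] → p ≋ [] ⊎ (b ∷ q) ≋ []) →
          (mul (a ∷ p) q ≋ [] → (a ∷ p) ≋ [] ⊎ q ≋ []) →
        mul (a ∷ p) (b ∷ q) ≋ [] → (a ∷ p) ≋ [] ⊎ (b ∷ q) ≋ []
      zero-product-cons {a} {b} {p} {q} (yes a≈0) _ ih _ e =
        map₁ (λ p≋[] → ≋-trans (cons-cong a≈0 p≋[]) 0∷[]≋[])
          (ih (tail≋[] (≋-trans (≋-sym (≋-trans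
            (mul-cong (cons-cong a≈0 (≋-refl {p})) (≋-refl {b ∷ q})) (mul-shiftˡ p (b ∷ q)))) e)))
      zero-product-cons {a} {b} {p} {q} (no a≉0) (yes b≈0) _ ih e =
        map₂ (λ q≋[] → ≋-trans (cons-cong b≈0 q≋[]) 0∷[]≋[])
          (ih (tail≋[] (≋-trans (≋-sym (≋-trans (mul-comm (a ∷ p) (b ∷ q))
            (≋-trans (mul-cong (cons-cong b≈0 (≋-refl {q})) (≋-refl {a ∷ p}))
              (≋-trans (mul-shiftˡ q (a ∷ p)) (cons-cong refl (mul-comm q (a ∷ p))))))) e)))
      zero-product-cons (no a≉0) (no b≉0) _ _ e with zeroProduct
        (trans (sym (+-identityʳ _)) (at e 0))
      ... | inj₁ a≈0 = contradiction a≈0 a≉0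
      ... | inj₂ b≈0 = contradiction b≈0 b≉0

      zero-product : ∀ p q → mul p q ≋ [] → p ≋ [] ⊎ q ≋ []
      zero-product []      q       e = inj₁ ≋-refl
      zero-product (a ∷ p) []      e = inj₂ ≋-refl
      zero-product (a ∷ p) (b ∷ q) e =
        zero-product-cons (a ≈0?) (b ≈0?) (zero-product p (b ∷ q)) (zero-product (a ∷ p) q) e

    poly-isDomain : IsDomain polyRing
    poly-isDomain = record
      { 1≉0         = λ e → 1≉0 (e 0)
      ; zeroProduct = λ {p} {q} e → Sum.map at at (zero-product p q (mk e))
      ; _≈0?        = λ p → map′ at mk (≋[]? p)
      }

  -- A bound instead of an exact degree: the coefficient at the bound may vanish, so it passes
  -- through products and sums without case distinctions.
  DegreeAtMost : List Carrier → ℕ → Set ℓ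
  DegreeAtMost p d = ∀ n → d ℕ.< n → coeff p n ≈ 0#

  coeff-mul-cons : ∀ a p q n → coeff (mul (a ∷ p) q) n ≈ a * coeff q n + coeff (0# ∷ mul p q) n
  coeff-mul-cons a p q n = trans (coeff-add (map (a *_) q) (0# ∷ mul p q) n)
    (+-congʳ (coeff-scale a q n))

  DegreeAtMost-mul : ∀ p q {d e} → DegreeAtMost p d → DegreeAtMost q e →
    DegreeAtMost (mul p q) (d ℕ.+ e)
  DegreeAtMost-mul []      q dp dq n lt = refl
  DegreeAtMost-mul (a ∷ p) q {zero} {e} dp dq n lt = begin
    coeff (mul (a ∷ p) q) n       ≈⟨ at (mul-cong {a ∷ p} {const a} {q}
      (cons-cong refl (mk λ i → dp (suc i) (s≤s z≤n))) ≋-refl) n ⟩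
    coeff (mul (const a) q) n     ≈⟨ at (mul-constˡ a q) n ⟩
    coeff (map (a *_) q) n        ≈⟨ coeff-scale a q n ⟩
    a * coeff q n                 ≈⟨ *-congˡ (dq n lt) ⟩
    a * 0#                        ≈⟨ zeroʳ a ⟩
    0#                            ∎
  DegreeAtMost-mul (a ∷ p) q {suc d} {e} dp dq (suc n) (s≤s lt) = begin
    coeff (mul (a ∷ p) q) (suc n)                ≈⟨ coeff-mul-cons a p q (suc n) ⟩
    a * coeff q (suc n) + coeff (mul p q) n
      ≈⟨ +-cong (*-congˡ (dq (suc n) (s≤s (ℕ.≤-trans (ℕ.m≤n+m e d) (ℕ.<⇒≤ lt)))))
           (DegreeAtMost-mul p q (λ i lt′ → dp (suc i) (s≤s lt′)) dq n lt) ⟩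
    a * 0# + 0#                                  ≈⟨ trans (+-identityʳ _) (zeroʳ a) ⟩
    0#                                           ∎

  coeff-mul-top : ∀ p q {d e} → DegreeAtMost p d → DegreeAtMost q e →
    coeff (mul p q) (d ℕ.+ e) ≈ coeff p d * coeff q e
  coeff-mul-top []      q dp dq = sym (zeroˡ _)
  coeff-mul-top (a ∷ p) q {zero} {e} dp dq = begin
    coeff (mul (a ∷ p) q) e       ≈⟨ at (mul-cong {a ∷ p} {const a} {q}
      (cons-cong refl (mk λ i → dp (suc i) (s≤s z≤n))) ≋-refl) e ⟩
    coeff (mul (const a) q) e     ≈⟨ at (mul-constˡ a q) e ⟩
    coeff (map (a *_) q) e        ≈⟨ coeff-scale a q e ⟩
    a * coeff q e                 ∎
  coeff-mul-top (a ∷ p) q {suc d} {e} dp dq = begin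
    coeff (mul (a ∷ p) q) (suc (d ℕ.+ e))
      ≈⟨ coeff-mul-cons a p q (suc (d ℕ.+ e)) ⟩
    a * coeff q (suc (d ℕ.+ e)) + coeff (mul p q) (d ℕ.+ e)
      ≈⟨ +-cong (trans (*-congˡ (dq (suc (d ℕ.+ e)) (s≤s (ℕ.m≤n+m e d)))) (zeroʳ a))
           (coeff-mul-top p q (λ i lt → dp (suc i) (s≤s lt)) dq) ⟩
    0# + coeff p d * coeff q e                                 ≈⟨ +-identityˡ _ ⟩
    coeff p d * coeff q e                                      ∎

  private
    module Poly = CommutativeRing polyRing
    module PolySum = SemiringSum Poly.semiring
    module PolyDet = Determinants polyRing
    open SemiringSum semiring using (sum; sum-cong-≋)
    open Determinants R using (sum-zero; sign)

  coeff-sum : ∀ {n} (f : Vector (List Carrier) n) d → coeff (PolySum.sum f) d ≈ sum λ i →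
    coeff (f i) d
  coeff-sum {zero}  f d = refl
  coeff-sum {suc n} f d = trans (coeff-add (f zero) _ d) (+-congˡ (coeff-sum (f ∘ suc) d))

  coeff-sign-mul : ∀ {n} (k : Fin n) p d → coeff (mul (PolyDet.sign k) p) d ≈ sign k * coeff p d
  coeff-sign-mul k p d = trans (at (mul-cong {PolyDet.sign k} {const (sign k)} {p}
    (mk λ i → sym (sign-const k i)) ≋-refl) d)
    (trans (at (mul-constˡ (sign k) p) d) (coeff-scale (sign k) p d))
    where
    open Hom R polyRing const-isHom
    sign-const : ∀ {n} (k : Fin n) → const (sign k) Poly.≈ PolyDet.sign k
    sign-const k = ^-homo (- 1#) (toℕ k)

  DegreeAtMost-det : ∀ {n} (M : Fin n → Fin n → List Carrier) (d : Fin n → ℕ) →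
    (∀ r i → DegreeAtMost (M r i) (d r)) → DegreeAtMost (det (Poly rawRing) M) (total d)
  DegreeAtMost-det {zero}  M d h (suc n) lt = refl
  DegreeAtMost-det {suc n} M d h e lt = trans
    (coeff-sum {suc n} (λ k → mul (PolyDet.sign k) (mul (M zero k) (D k))) e)
    (sum-zero {suc n} λ k → trans (coeff-sign-mul k (mul (M zero k) (D k)) e)
      (trans (*-congˡ (DegreeAtMost-mul (M zero k) (D k) (h zero k)
        (DegreeAtMost-det _ (d ∘ suc) λ r i → h (suc r) (punchIn k i)) e lt))
        (zeroʳ _)))
    where D = λ k → det (Poly rawRing) (λ r i → M (suc r) (punchIn k i))

  -- Every term of the determinant takes one entry from each row, so all terms share the bound
  -- `total d`, and only the coefficients at the bounds of the rows contribute there.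
  coeff-det-top : ∀ {n} (M : Fin n → Fin n → List Carrier) (d : Fin n → ℕ) →
    (∀ r i → DegreeAtMost (M r i) (d r)) →
    coeff (det (Poly rawRing) M) (total d) ≈ det rawRing λ r i → coeff (M r i) (d r)
  coeff-det-top {zero}  M d h = refl
  coeff-det-top {suc n} M d h = trans
    (coeff-sum {suc n} (λ k → mul (PolyDet.sign k) (mul (M zero k) (D k))) (total d))
    (sum-cong-≋ {suc n} λ k → trans (coeff-sign-mul k (mul (M zero k) (D k)) (total d))
      (*-congˡ (trans (coeff-mul-top (M zero k) (D k) (h zero k)
        (DegreeAtMost-det _ (d ∘ suc) λ r i → h (suc r) (punchIn k i)))
        (*-congˡ (coeff-det-top _ (d ∘ suc) λ r i → h (suc r) (punchIn k i))))))
    where D = λ k → det (Poly rawRing) (λ r i → M (suc r) (punchIn k i))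

-- Iterated polynomial rings and substitutions

module _ {c ℓ} (R : CommutativeRing c ℓ) where
  private
    module R = CommutativeRing R

  -- Defined through MPoly so that the underlying raw ring is MPoly itself.
  mpoly-isCommutativeRing : ∀ m → let open RawRing (MPoly R.rawRing m) in
    IsCommutativeRing _≈_ _+_ _*_ -_ 0# 1#

  mpolyRing : ℕ → CommutativeRing c ℓ
  mpolyRing m = record
    { Carrier = RawRing.Carrier (MPoly R.rawRing m)
    ; isCommutativeRing = mpoly-isCommutativeRing m
    }

  mpoly-isCommutativeRing zero    = R.isCommutativeRing
  mpoly-isCommutativeRing (suc m) =
    CommutativeRing.isCommutativeRing (PolyRing.polyRing (mpolyRing m))

  mpoly-isDomain : IsDomain R → ∀ m → IsDomain (mpolyRing m)
  mpoly-isDomain d zero    = d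
  mpoly-isDomain d (suc m) = PolyProperties.poly-isDomain (mpolyRing m) (mpoly-isDomain d m)

  scalar-isHom : ∀ m → IsHom R (mpolyRing m) (scalar R.rawRing m)
  scalar-isHom zero    = mkHom R R id (λ _ _ → R.refl) (λ _ _ → R.refl) R.refl
  scalar-isHom (suc m) = ∘-hom R (mpolyRing m) (mpolyRing (suc m)) (scalar-isHom m)
    (PolyProperties.const-isHom (mpolyRing m))

  scalar-≉0 : ∀ m {a} → a R.≉ R.0# → let open CommutativeRing (mpolyRing m) in scalar R.rawRing m a ≉ 0#
  scalar-≉0 zero    a≉0   = a≉0
  scalar-≉0 (suc m) a≉0 e = scalar-≉0 m a≉0 (e 0)

  module _ (1≉0 : R.1# R.≉ R.0#) where
    private
      1≉0ₘ : ∀ m → let open CommutativeRing (mpolyRing m) in 1# ≉ 0#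
      1≉0ₘ zero    e = 1≉0 e
      1≉0ₘ (suc m) e = 1≉0ₘ m (e 0)

    var-≉0 : ∀ m j → let open CommutativeRing (mpolyRing m) in var R.rawRing m j ≉ 0#
    var-≉0 (suc m) zero    e = 1≉0ₘ m (e 1)
    var-≉0 (suc m) (suc j) e = var-≉0 m j (e 0)

    var-distinct : ∀ m {i j} → i ≢ j → let open CommutativeRing (mpolyRing m) in var R.rawRing m i ≉ var R.rawRing m j
    var-distinct (suc m) {zero}  {zero}  i≢j e = i≢j ≡.refl
    var-distinct (suc m) {zero}  {suc j} i≢j e = 1≉0ₘ m (e 1)
    var-distinct (suc m) {suc i} {zero}  i≢j e = 1≉0ₘ m (CommutativeRing.sym (mpolyRing m) (e 1))
    var-distinct (suc m) {suc i} {suc j} i≢j e = var-distinct m (i≢j ∘ ≡.cong suc) (e 0)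

  module Evaluation {c′ ℓ′} (S : CommutativeRing c′ ℓ′) where
    private module S = CommutativeRing S

    module _ {f : R.Carrier → S.Carrier} (f-isHom : IsHom R S f) where
      eval : ∀ m → (Fin m → S.Carrier) → RawRing.Carrier (MPoly R.rawRing m) → S.Carrier
      eval-isHom : ∀ m x → IsHom (mpolyRing m) S (eval m x)

      eval zero    x = f
      eval (suc m) x = PolyProperties.Horner.horner (mpolyRing m) S (eval-isHom m (x ∘ suc))
        (x zero)
      eval-isHom zero    x = f-isHom
      eval-isHom (suc m) x = PolyProperties.Horner.horner-isHom (mpolyRing m) S
        (eval-isHom m (x ∘ suc)) (x zero)

      eval-var : ∀ m x j → eval m x (var R.rawRing m j) S.≈ x j
      eval-var (suc m) x zero    =
        PolyProperties.Horner.horner-X (mpolyRing m) S (eval-isHom m (x ∘ suc)) (x zero)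
      eval-var (suc m) x (suc j) = S.trans
        (PolyProperties.Horner.horner-const (mpolyRing m) S (eval-isHom m (x ∘ suc)) (x zero) _)
        (eval-var m (x ∘ suc) j)

      open SemiringDivisibility S.semiring using (_∣_; _,_; ∣ʳ-respʳ-≈; _∣0)
      open SetoidReasoning S.setoid
      open RingProperties S.ring using (-‿+-comm; x≈y⇒x∙y⁻¹≈ε; -‿distribʳ-*)
      open RingSolver S.commutativeSemiring using (solve; _:+_; _:=_)

      private
        ∣-+ : ∀ {p x y} → p ∣ x → p ∣ y → p ∣ x S.+ y
        ∣-+ {p} (q , e) (q′ , e′) = q S.+ q′ , S.trans (S.distribʳ p q q′) (S.+-cong e e′)

        ∣-* : ∀ {p y} x → p ∣ y → p ∣ x S.* y
        ∣-* {p} x (q , e) = x S.* q , S.trans (S.*-assoc x q p) (S.*-congˡ e)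

      -- In a Horner step u B - v B′ = u (B - B′) + B′ (u - v), so congruent arguments give
      -- congruent values.
      eval-congruent : ∀ {p} m x y → (∀ j → p ∣ x j S.- y j) → ∀ P → p ∣ eval m x P S.- eval m y P
      eval-congruent zero    x y h P       = ∣ʳ-respʳ-≈ (S.sym (x≈y⇒x∙y⁻¹≈ε S.refl)) (_ ∣0)
      eval-congruent (suc m) x y h []      = ∣ʳ-respʳ-≈ (S.sym (x≈y⇒x∙y⁻¹≈ε S.refl)) (_ ∣0)
      eval-congruent {p} (suc m) x y h (a ∷ P) = ∣ʳ-respʳ-≈ (begin
        (A S.- A′) S.+ (u S.* (B S.- B′) S.+ B′ S.* (u S.- v))
          ≈⟨ S.+-congˡ (S.+-cong (S.distribˡ u B (S.- B′)) (S.distribˡ B′ u (S.- v))) ⟩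
        (A S.- A′) S.+ ((u S.* B S.+ u S.* (S.- B′)) S.+ (B′ S.* u S.+ B′ S.* (S.- v)))
          ≈⟨ S.+-congˡ (S.+-cong (S.+-congˡ (S.sym (-‿distribʳ-* u B′)))
              (S.+-cong (S.*-comm B′ u) (S.trans (S.sym (-‿distribʳ-* B′ v))
              (S.-‿cong (S.*-comm B′ v))))) ⟩
        (A S.- A′) S.+ ((u S.* B S.+ (S.- (u S.* B′))) S.+ (u S.* B′ S.+ (S.- (v S.* B′))))
          ≈⟨ solve 6 (λ a a′ b c c′ d → (a :+ a′) :+ ((b :+ c′) :+ (c :+ d)) :=
              ((a :+ b) :+ (a′ :+ d)) :+ (c :+ c′)) S.refl A (S.- A′) (u S.* B) (u S.* B′)
              (S.- (u S.* B′)) (S.- (v S.* B′)) ⟩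
        ((A S.+ u S.* B) S.+ ((S.- A′) S.+ (S.- (v S.* B′)))) S.+ (u S.* B′ S.- u S.* B′)
          ≈⟨ S.+-cong (S.+-congˡ (-‿+-comm A′ (v S.* B′))) (S.-‿inverseʳ (u S.* B′)) ⟩
        ((A S.+ u S.* B) S.- (A′ S.+ v S.* B′)) S.+ S.0#
          ≈⟨ S.+-identityʳ _ ⟩
        (A S.+ u S.* B) S.- (A′ S.+ v S.* B′) ∎)
        (∣-+ (eval-congruent m (x ∘ suc) (y ∘ suc) (h ∘ suc) a)
             (∣-+ (∣-* u (eval-congruent (suc m) x y h P)) (∣-* B′ (h zero))))
        where
        A = eval m (x ∘ suc) a
        A′ = eval m (y ∘ suc) a
        u = x zero
        v = y zero
        B = eval (suc m) x P
        B′ = eval (suc m) y P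

  eval-natural : ∀ {c₁ ℓ₁ c₂ ℓ₂} (S : CommutativeRing c₁ ℓ₁) (T : CommutativeRing c₂ ℓ₂)
    {f g} (f-isHom : IsHom R S f) (g-isHom : IsHom S T g) m x P →
    CommutativeRing._≈_ T (g (Evaluation.eval S f-isHom m x P))
      (Evaluation.eval T (∘-hom R S T f-isHom g-isHom) m (g ∘ x) P)
  eval-natural S T f-isHom g-isHom zero    x P       = CommutativeRing.refl T
  eval-natural S T f-isHom g-isHom (suc m) x []      = IsRingHomomorphism.0#-homo g-isHom
  eval-natural S T {f} {g} f-isHom g-isHom (suc m) x (a ∷ P) = T.trans (G.+-homo _ _)
    (T.+-cong (eval-natural S T f-isHom g-isHom m (x ∘ suc) a)
      (T.trans (G.*-homo _ _) (T.*-congˡ (eval-natural S T f-isHom g-isHom (suc m) x P))))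
    where
    module T = CommutativeRing T
    module G = IsRingHomomorphism g-isHom

  -- Combined with `eval-congruent`, this shows that a substitution moves every polynomial by a
  -- multiple of p as soon as it does so with the variables.
  eval-identity : ∀ m P → let open CommutativeRing (mpolyRing m) in
    Evaluation.eval (mpolyRing m) (scalar-isHom m) m (var R.rawRing m) P ≈ P
  eval-identity zero    P       = R.refl
  eval-identity (suc m) []      n = CommutativeRing.refl (mpolyRing m)
  eval-identity (suc m) (a ∷ P) = at (≋-trans (add-cong constant-part (mul-congʳ X higher-part))
    (cons-split a P))
    where
    open PolyRing (mpolyRing m)
    open PolyProperties (mpolyRing m)
    open PolyOps (MPoly R.rawRing m)
    module M = CommutativeRing (mpolyRing (suc m))
    eval₀ = Evaluation.eval (mpolyRing m) (scalar-isHom m) m (var R.rawRing m)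
    eval₁ = Evaluation.eval (mpolyRing (suc m)) (scalar-isHom (suc m)) m
      (var R.rawRing (suc m) ∘ suc)
    eval₂ = Evaluation.eval (mpolyRing (suc m)) (scalar-isHom (suc m)) (suc m)
      (var R.rawRing (suc m))
    constant-part : eval₁ a ≋ const a
    constant-part = mk {eval₁ a} {const a} (M.trans {eval₁ a} {const (eval₀ a)} {const a}
      (M.sym {const (eval₀ a)} {eval₁ a} (eval-natural (mpolyRing m) (mpolyRing (suc m))
        (scalar-isHom m) const-isHom m (var R.rawRing m) a))
      (at (cons-cong (eval-identity m a) ≋-refl)))
    higher-part : eval₂ P ≋ P
    higher-part = mk {eval₂ P} {P} (eval-identity (suc m) P)

-- The common factor T

ℤ-isDomain : IsDomain ℤ.+-*-commutativeRing
ℤ-isDomain = record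
  { 1≉0         = λ ()
  ; zeroProduct = λ {i} → ℤ.i*j≡0⇒i≡0∨j≡0 i
  ; _≈0?        = ℤ._≟ ℤ.0ℤ
  }

νℤ : ∀ n → BinomialRows.ν ℤ.+-*-commutativeRing n ≡ + n
νℤ zero    = ≡.refl
νℤ (suc n) = ≡.cong (ℤ._+_ ℤ.1ℤ) (νℤ n)

[a+b]Ca≢0 : ∀ a b → (a ℕ.+ b) C a ≢ 0
[a+b]Ca≢0 a b e = ℕ.≢-nonZero⁻¹ _ {{(a ℕ.+ b) ℕ.!≢0}}
  (≡.trans (≡.sym ([a+b]Ca*a!*b!≡[a+b]! a b)) (≡.cong (ℕ._* (a ℕ.! ℕ.* b ℕ.!)) e))

⊓-square : ∀ a b → (a ℕ.⊓ b) ℕ.* (a ℕ.⊓ b) ≡ (a ℕ.* a) ℕ.⊓ (b ℕ.* b)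
⊓-square a b with ℕ.≤-total a b
... | inj₁ a≤b rewrite ℕ.m≤n⇒m⊓n≡m a≤b = ≡.sym (ℕ.m≤n⇒m⊓n≡m (ℕ.*-mono-≤ a≤b a≤b))
... | inj₂ b≤a rewrite ℕ.m≥n⇒m⊓n≡n b≤a = ≡.sym (ℕ.m≥n⇒m⊓n≡n (ℕ.*-mono-≤ b≤a b≤a))

module IntegerPolynomials (m : ℕ) where
  A : CommutativeRing _ _
  A = mpolyRing ℤ.+-*-commutativeRing m

  A-isDomain : IsDomain A
  A-isDomain = mpoly-isDomain ℤ.+-*-commutativeRing ℤ-isDomain m

  open CommutativeRing A hiding (zero)
  open BinomialRows A using (ν)
  open DomainProperties A-isDomain
  open RawSemiringDefs (Semiring.rawSemiring semiring) using (Prime)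
  open CommutativeSemiringExp commutativeSemiring using (_^_; ^-homo-*)
  open SemiringDivisibility semiring using (_∣_; _∤_; _,_; ∣ʳ-respʳ-≈; ∣ʳ-respˡ-≈; _∣0; ∣ʳ-refl;
      ε∣ʳ_)
  open RingProperties ring using (x∙y⁻¹≈ε⇒x≈y)
  open SetoidReasoning setoid

  α : Fin m → Carrier
  α = var ℤ.+-*-rawRing m

  α≉0 : ∀ j → α j ≉ 0#
  α≉0 = var-≉0 ℤ.+-*-commutativeRing (λ ()) m

  α-α≉0 : ∀ {i j} → i ≢ j → α i - α j ≉ 0#
  α-α≉0 i≢j e = var-distinct ℤ.+-*-commutativeRing (λ ()) m i≢j (x∙y⁻¹≈ε⇒x≈y _ _ e)

  scalar-ν : ∀ n → scalar ℤ.+-*-rawRing m (+ n) ≈ ν n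
  scalar-ν n = trans (reflexive (≡.cong (scalar ℤ.+-*-rawRing m) (≡.sym (νℤ n))))
    (Hom.ν-homo ℤ.+-*-commutativeRing A (scalar-isHom ℤ.+-*-commutativeRing m) n)

  ν≉0 : ∀ {n} → n ≢ 0 → ν n ≉ 0#
  ν≉0 {n} n≢0 e = scalar-≉0 ℤ.+-*-commutativeRing m {+ n} (n≢0 ∘ ℤ.+-injective)
    (trans (scalar-ν n) e)

  module Substitution (y : Fin m → Carrier) where
    private module E = Evaluation ℤ.+-*-commutativeRing A

    σ : Carrier → Carrier
    σ = E.eval (scalar-isHom ℤ.+-*-commutativeRing m) m y

    σ-isHom : IsHom A A σ
    σ-isHom = E.eval-isHom (scalar-isHom ℤ.+-*-commutativeRing m) m y

    open Hom A A σ-isHom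

    σ-α : ∀ j → σ (α j) ≈ y j
    σ-α = E.eval-var (scalar-isHom ℤ.+-*-commutativeRing m) m y

    σ-α-α : ∀ i j → σ (α i - α j) ≈ y i - y j
    σ-α-α i j = trans (+-homo (α i) (- α j)) (+-cong (σ-α i)
      (trans (-‿homo (α j)) (-‿cong (σ-α j))))

    module _ {p} (p≉0 : p ≉ 0#) (σp≈0 : σ p ≈ 0#) (moves : ∀ j → p ∣ α j - y j) where
      private
        result = retraction⇒prime σ (λ {x} {y} → ⟦⟧-cong {x} {y}) *-homo 1#-homo 0#-homo σp≈0
          (λ x → ∣ʳ-respʳ-≈ (+-congʳ (eval-identity ℤ.+-*-commutativeRing m x))
            (E.eval-congruent (scalar-isHom ℤ.+-*-commutativeRing m) m α y moves x)) p≉0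

      prime : Prime p
      prime = proj₁ result

      nondivisible : ∀ {x} → σ x ≉ 0# → p ∤ x
      nondivisible = proj₂ result

      -- The substitution fixes the integers, so a non-zero integer is not in its kernel.
      ∤ν : ∀ {n} → n ≢ 0 → p ∤ ν n
      ∤ν {n} n≢0 = nondivisible λ e → ν≉0 n≢0 (trans (sym (ν-homo n)) e)

  module Variable (j : Fin m) where
    private
      image : ∀ k → Dec (k ≡ j) → Carrier
      image k (yes _) = 0#
      image k (no _)  = α k

      open Substitution (λ k → image k (k ≟ j))

      image-j : image j (j ≟ j) ≈ 0#
      image-j with j ≟ j
      ... | yes _  = refl
      ... | no j≢j = contradiction ≡.refl j≢j

      image-k : ∀ {k} → k ≢ j → image k (k ≟ j) ≈ α k
      image-k {k} k≢j with k ≟ j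
      ... | yes k≡j = contradiction k≡j k≢j
      ... | no _    = refl

      moves : ∀ k → α j ∣ α k - image k (k ≟ j)
      moves k with k ≟ j
      ... | yes ≡.refl = ∣ʳ-respʳ-≈ (trans (sym (+-identityʳ _))
        (+-congˡ (sym (RingProperties.-0#≈0# ring)))) ∣ʳ-refl
      ... | no _       = ∣ʳ-respʳ-≈ (sym (-‿inverseʳ _)) (_ ∣0)

    prime-α : Prime (α j)
    prime-α = prime (α≉0 j) (trans (σ-α j) image-j) moves

    α∤α : ∀ {k} → k ≢ j → α j ∤ α k
    α∤α {k} k≢j = nondivisible (α≉0 j) (trans (σ-α j) image-j) moves
      λ e → α≉0 k (trans (sym (trans (σ-α k) (image-k k≢j))) e)

  module Difference {i j : Fin m} (i<j : i Fin.< j) where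
    private
      -- Merging the variable `α i` into `α j` realises the quotient by their difference inside the
      -- ring itself.
      target : ∀ k → Dec (k ≡ i) → Fin m
      target k (yes _) = j
      target k (no _)  = k

      open Substitution (λ k → α (target k (k ≟ i)))

      p≉0 : α i - α j ≉ 0#
      p≉0 = α-α≉0 (<⇒≢ i<j)

      σp≈0 : σ (α i - α j) ≈ 0#
      σp≈0 = trans (σ-α-α i j) (trans (+-cong (reflexive (≡.cong α image-i))
        (-‿cong (reflexive (≡.cong α image-j)))) (-‿inverseʳ _))
        where
        image-i : target i (i ≟ i) ≡ j
        image-i with i ≟ i
        ... | yes _  = ≡.refl
        ... | no i≢i = contradiction ≡.refl i≢i
        image-j : target j (j ≟ i) ≡ j
        image-j with j ≟ i
        ... | yes _ = ≡.refl
        ... | no _  = ≡.refl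

      moves : ∀ k → α i - α j ∣ α k - α (target k (k ≟ i))
      moves k with k ≟ i
      ... | yes ≡.refl = ∣ʳ-refl
      ... | no _       = ∣ʳ-respʳ-≈ (sym (-‿inverseʳ _)) (_ ∣0)

      -- Merging i into j can identify only the pair of i and j. If l is i, then k < i < j keeps k
      -- away from j; if k is i, the remaining hypothesis says that l is not j.
      distinct : ∀ {k l} → k Fin.< l → (k ≢ i ⊎ l ≢ j) → target k (k ≟ i) ≢ target l (l ≟ i)
      distinct {k} {l} k<l other with k ≟ i | l ≟ i
      ... | yes k≡i | yes l≡i = contradiction (≡.trans k≡i (≡.sym l≡i)) (<⇒≢ k<l)
      distinct {k} {l} k<l (inj₁ k≢i) | yes k≡i | no _ = contradiction k≡i k≢i
      distinct {k} {l} k<l (inj₂ l≢j) | yes k≡i | no _ = l≢j ∘ ≡.sym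
      ... | no _ | yes ≡.refl = <⇒≢ (Fin.<-trans k<l i<j)
      ... | no _ | no _ = <⇒≢ k<l

    prime-α-α : Prime (α i - α j)
    prime-α-α = prime p≉0 σp≈0 moves

    α-α∤α : ∀ k → α i - α j ∤ α k
    α-α∤α k = nondivisible p≉0 σp≈0 moves λ e → α≉0 (target k (k ≟ i)) (trans (sym (σ-α k)) e)

    α-α∤α-α : ∀ {k l} → k Fin.< l → (k ≢ i ⊎ l ≢ j) → α i - α j ∤ α k - α l
    α-α∤α-α {k} {l} k<l other = nondivisible p≉0 σp≈0 moves λ e →
      α-α≉0 (distinct k<l other) (trans (sym (σ-α-α k l)) e)

    α-α∤ν : ∀ {n} → n ≢ 0 → α i - α j ∤ ν n
    α-α∤ν = ∤ν p≉0 σp≈0 moves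

  module CommonFactor (l : Vector ℕ m) where
    open Determinants A using (_≐₂_; minor; minor-volume; det-cong; product; IsVolume; Functional)
    open RowDivisibility A l α

    𝒱≈rows : 𝒱 l ≐₂ rows
    𝒱≈rows r h with rowIndex l r
    ... | j , i = *-congʳ (scalar-ν ((L ℕ.+ suc (toℕ i)) C toℕ h))

    -- The factors of `N k` are binomial coefficients with lower index at most the upper one, hence
    -- non-zero integers; this allows the rescaling of the rows to be undone.
    N-relPrime : ∀ {p} e k → Prime p → (∀ {n} → n ≢ 0 → p ∤ ν n) → RelativelyPrime (p ^ e) (N k)
    N-relPrime e k prime p∤ν = relPrime-productʳ {k} _ λ a → prime∤⇒relPrime prime
      (p∤ν λ z → [a+b]Ca≢0 (k ℕ.∸ suc (toℕ a)) (L ℕ.+ k ℕ.∸ (k ℕ.∸ suc (toℕ a)))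
        (≡.trans (≡.cong (_C (k ℕ.∸ suc (toℕ a)))
          (ℕ.m+[n∸m]≡n (ℕ.≤-trans (ℕ.m∸n≤m k (suc (toℕ a))) (ℕ.m≤n+m k L)))) z)) e

    -- Stated for an arbitrary decision, since the type checker unfolds
    -- does (i <? j) and a with-abstraction would not find it.
    factorOf : ∀ i j → Dec (i Fin.< j) → Carrier
    factorOf i j d = if does d then (α i - α j) ^ ((l i ℕ.* l i) ℕ.⊓ (l j ℕ.* l j)) else 1#

    factorOf-≉0 : ∀ i j d → factorOf i j d ≉ 0#
    factorOf-≉0 i j (yes i<j) = ^-≉0 ((l i ℕ.* l i) ℕ.⊓ (l j ℕ.* l j)) (α-α≉0 (<⇒≢ i<j))
    factorOf-≉0 i j (no _)    = IsDomain.1≉0 A-isDomain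

    factorOf-relPrime : ∀ i j k n d d′ → (k ≢ i ⊎ n ≢ j) →
      RelativelyPrime (factorOf i j d) (factorOf k n d′)
    factorOf-relPrime i j k n (no _)    _         other = relPrime-1ˡ
    factorOf-relPrime i j k n (yes _)   (no _)    other = relPrime-1ʳ
    factorOf-relPrime i j k n (yes i<j) (yes k<n) other =
      relPrime-^ʳ ((l k ℕ.* l k) ℕ.⊓ (l n ℕ.* l n))
      (prime∤⇒relPrime (Difference.prime-α-α i<j) (Difference.α-α∤α-α i<j k<n other)
        ((l i ℕ.* l i) ℕ.⊓ (l j ℕ.* l j)))

    factorOf-relPrime-α : ∀ i j d k e → RelativelyPrime (factorOf i j d) (α k ^ e)
    factorOf-relPrime-α i j (no _)    k e = relPrime-1ˡ
    factorOf-relPrime-α i j (yes i<j) k e = relPrime-^ʳ e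
      (prime∤⇒relPrime (Difference.prime-α-α i<j) (Difference.α-α∤α i<j k)
        ((l i ℕ.* l i) ℕ.⊓ (l j ℕ.* l j)))

    factor : Fin m → Fin m → Carrier
    factor i j = factorOf i j (i <? j)

    factor-≉0 : ∀ i j → factor i j ≉ 0#
    factor-≉0 i j = factorOf-≉0 i j (i <? j)

    factor-relPrime : ∀ i j k n → (k ≢ i ⊎ n ≢ j) → RelativelyPrime (factor i j) (factor k n)
    factor-relPrime i j k n = factorOf-relPrime i j k n (i <? j) (k <? n)

    module _ {F : Functional L (suc L)} (vol : IsVolume F) where
      factorOf-∣ : ∀ i j d → factorOf i j d ∣ F rows
      factorOf-∣ i j (no _)    = ε∣ʳ (F rows)
      -- `N k` occurs twice, once for each of the two blocks.
      factorOf-∣ i j (yes i<j) = N-prime (N-prime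
        (∣ʳ-respʳ-≈ (*-assoc (N k) (N k) (F rows)) reduced))
        where
        k e s : ℕ
        k = l i ℕ.⊓ l j
        e = k C 2 ℕ.+ k C 2
        s = (l i ℕ.* l i) ℕ.⊓ (l j ℕ.* l j)
        u = α i - α j
        N-prime : RelativelyPrime (u ^ s) (N k)
        N-prime = N-relPrime s k (Difference.prime-α-α i<j) (Difference.α-α∤ν i<j)
        α≈ : α i ≈ α j + u
        α≈ = sym (trans (sym (+-assoc (α j) (α i) (- α j))) (trans (+-congʳ (+-comm (α j) (α i)))
          (trans (+-assoc (α i) (α j) (- α j))
            (trans (+-congˡ (-‿inverseʳ (α j))) (+-identityʳ (α i))))))
        reduced : u ^ s ∣ (N k * N k) * F rows
        reduced = ∣-cancelʳ (^-≉0 e (α-α≉0 (<⇒≢ i<j)))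
          (∣ʳ-respʳ-≈ (trans (*-assoc (N k * N k) (u ^ e) (F rows))
            (trans (*-congˡ (*-comm (u ^ e) (F rows)))
            (sym (*-assoc (N k * N k) (F rows) (u ^ e)))))
            (∣ʳ-respˡ-≈ (trans (^-homo-* u (k ℕ.* k) e)
              (*-congʳ (reflexive (≡.cong (u ^_) (⊓-square (l i) (l j))))))
              (difference-∣ vol (<⇒≢ i<j) u α≈)))

      T-∣ : T l ∣ F rows
      -- The differences come first because relative primality was shown in this direction only:
      -- differences of variables divide no variable.
      T-∣ = ∣ʳ-respˡ-≈ (*-comm differences powers) (relPrime⇒*-∣
        (relPrime-productˡ _ (λ i → product-≉0 (factor i) (factor-≉0 i)) λ i →
          relPrime-productˡ _ (factor-≉0 i) λ j → relPrime-productʳ _ λ k →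
            factorOf-relPrime-α i j (i <? j) k (l k C 2))
        (relPrime⇒product-∣ _
          (λ i k i<k → relPrime-productˡ _ (factor-≉0 i) λ j → relPrime-productʳ _ λ n →
            factor-relPrime i j k n (inj₁ (<⇒≢ i<k ∘ ≡.sym)))
          λ i → relPrime⇒product-∣ _ (λ j n j<n → factor-relPrime i j i n (inj₂ (<⇒≢ j<n ∘ ≡.sym)))
            λ j → factorOf-∣ i j (i <? j))
        (relPrime⇒product-∣ _
          (λ i j i<j → relPrime-^ʳ (l j C 2) (prime∤⇒relPrime (Variable.prime-α i)
            (Variable.α∤α i (<⇒≢ i<j ∘ ≡.sym)) (l i C 2)))
          (power-∣ vol)))
        where
        powers differences : Carrier
        powers = product λ j → α j ^ (l j C 2)
        differences = product λ i → product λ j → factor i j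

    T≉0 : T l ≉ 0#
    T≉0 = *-≉0 (product-≉0 _ λ j → ^-≉0 (l j C 2) (α≉0 j))
      (product-≉0 _ λ i → product-≉0 _ (factor-≉0 i))

    minor≈ : ∀ h → minor (punchIn h) rows ≈ 𝒱-minor l h
    minor≈ h = det-cong λ r k → sym (𝒱≈rows r (punchIn h k))

    T∣𝒱-minor : ∀ h → T l ∣ 𝒱-minor l h
    T∣𝒱-minor h = ∣ʳ-respʳ-≈ (minor≈ h) (T-∣ (minor-volume (punchIn h)))

-- The last minor

-- The falling factorial z (z - 1) ⋯ (z - h + 1). Unlike the binomial coefficient it factors when h
-- grows, see `fall-+`.
fall : ℕ → ℕ → ℕ
fall z       zero    = 1
fall zero    (suc h) = 0
fall (suc z) (suc h) = suc z ℕ.* fall z h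

fall-difference : ∀ z h → fall (suc z) (suc h) ≡ fall z (suc h) ℕ.+ suc h ℕ.* fall z h
fall-difference zero    zero    = ≡.refl
fall-difference zero    (suc h) = ≡.sym (ℕ.*-zeroʳ (suc (suc h)))
fall-difference (suc z) zero    = ≡.trans (ℕ.+-comm 1 (suc z ℕ.* 1)) ≡.refl
fall-difference (suc z) (suc h) = begin
  suc (suc z) ℕ.* (suc z ℕ.* F)
    ≡⟨ solve 2 (λ z f → (con 2 :+ z) :* ((con 1 :+ z) :* f) := (con 1 :+ z) :* ((con 1 :+ z) :* f)
        :+ (con 1 :+ z) :* f) ≡.refl z F ⟩
  suc z ℕ.* (suc z ℕ.* F) ℕ.+ suc z ℕ.* F
    ≡⟨ ≡.cong (λ x → suc z ℕ.* x ℕ.+ suc z ℕ.* F) (fall-difference z h) ⟩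
  suc z ℕ.* (fall z (suc h) ℕ.+ suc h ℕ.* F) ℕ.+ suc z ℕ.* F
    ≡⟨ solve 4 (λ z h f g → (con 1 :+ z) :* (g :+ (con 1 :+ h) :* f) :+ (con 1 :+ z) :* f :=
         (con 1 :+ z) :* g :+ (con 2 :+ h) :* ((con 1 :+ z) :* f)) ≡.refl z h F (fall z (suc h)) ⟩
  suc z ℕ.* fall z (suc h) ℕ.+ suc (suc h) ℕ.* (suc z ℕ.* F) ∎
  where
  open ≡.≡-Reasoning
  open +-*-Solver
  F = fall z h

fall≡h!*zCh : ∀ z h → fall z h ≡ h ! ℕ.* (z C h)
fall≡h!*zCh z       zero    = ≡.sym (≡.trans (ℕ.*-identityˡ _) (nC0≡1 z))
fall≡h!*zCh zero    (suc h) = ≡.sym (≡.trans (≡.cong (suc h ! ℕ.*_) (0C[1+k]≡0 h))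
  (ℕ.*-zeroʳ (suc h !)))
fall≡h!*zCh (suc z) (suc h) = begin
  fall (suc z) (suc h)
    ≡⟨ fall-difference z h ⟩
  fall z (suc h) ℕ.+ suc h ℕ.* fall z h
    ≡⟨ ≡.cong₂ (λ p q → p ℕ.+ suc h ℕ.* q) (fall≡h!*zCh z (suc h)) (fall≡h!*zCh z h) ⟩
  suc h ! ℕ.* (z C suc h) ℕ.+ suc h ℕ.* (h ! ℕ.* (z C h))
    ≡⟨ solve 4 (λ s f p q → (s :* f) :* p :+ s :* (f :* q) := (s :* f) :* (q :+ p)) ≡.refl (suc h)
        (h !) (z C suc h) (z C h) ⟩
  suc h ! ℕ.* (z C h ℕ.+ z C suc h)
    ≡⟨ ≡.cong (suc h ! ℕ.*_) ([1+n]C[1+k] z h) ⟨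
  suc h ! ℕ.* (suc z C suc h) ∎
  where
  open ≡.≡-Reasoning
  open +-*-Solver

-- When the first `a` columns are deleted, the first `a` factors are common to all remaining entries
-- of the row; what is left belongs to the argument lowered by `a`.
fall-+ : ∀ a y h → fall (a ℕ.+ y) (a ℕ.+ h) ≡ fall (a ℕ.+ y) a ℕ.* fall y h
fall-+ zero    y h = ≡.sym (ℕ.+-identityʳ (fall y h))
fall-+ (suc a) y h = ≡.trans (≡.cong (suc (a ℕ.+ y) ℕ.*_) (fall-+ a y h))
  (≡.sym (ℕ.*-assoc (suc (a ℕ.+ y)) (fall (a ℕ.+ y) a) (fall y h)))

fall≢0 : ∀ a y → fall (a ℕ.+ y) a ≢ 0
fall≢0 (suc a) y e with ℕ.m*n≡0⇒m≡0∨n≡0 (suc (a ℕ.+ y)) e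
... | inj₂ e′ = fall≢0 a y e′

-- The k-th forward difference of z ↦ fall z h.
fallΔ : ℕ → ℕ → ℕ → ℕ
fallΔ zero    h       z = fall z h
fallΔ (suc k) zero    z = 0
fallΔ (suc k) (suc h) z = suc h ℕ.* fallΔ k h z

fallΔ-difference : ∀ k h z → fallΔ k h (suc z) ≡ fallΔ k h z ℕ.+ fallΔ (suc k) h z
fallΔ-difference zero    zero    z = ≡.refl
fallΔ-difference zero    (suc h) z = fall-difference z h
fallΔ-difference (suc k) zero    z = ≡.refl
fallΔ-difference (suc k) (suc h) z =
  ≡.trans (≡.cong (suc h ℕ.*_) (fallΔ-difference k h z))
    (ℕ.*-distribˡ-+ (suc h) (fallΔ k h z) (fallΔ (suc k) h z))

-- A polynomial of degree h has vanishing k-th differences for k > h. The k-th row of the first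
-- block therefore starts in column k.
fallΔ-below : ∀ {k h} z → h ℕ.< k → fallΔ k h z ≡ 0
fallΔ-below {suc k} {zero}  z lt       = ≡.refl
fallΔ-below {suc k} {suc h} z (s≤s lt) =
  ≡.trans (≡.cong (suc h ℕ.*_) (fallΔ-below z lt)) (ℕ.*-zeroʳ (suc h))

fallΔ-diagonal : ∀ k z → fallΔ k k z ≡ k !
fallΔ-diagonal zero    z = ≡.refl
fallΔ-diagonal (suc k) z = ≡.cong (suc k ℕ.*_) (fallΔ-diagonal k z)

k!≢0 : ∀ k → k ! ≢ 0
k!≢0 k = ℕ.≢-nonZero⁻¹ _ {{k ℕ.!≢0}}

-- The two cases of `rowIndex` become a function of `splitAt`, which can be compared with
-- `stack-splitAt`.
rowIndex-splitAt : ∀ {m} (l : Vector ℕ (suc m)) r →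
  rowIndex l r ≡ [ (λ i → zero , i) , (λ r′ → suc (proj₁ (rowIndex (tail l) r′)) , proj₂
    (rowIndex (tail l) r′)) ]′ (splitAt (l zero) r)
rowIndex-splitAt l r with splitAt (l zero) r
... | inj₁ i  = ≡.refl
... | inj₂ r′ = ≡.refl

-- One bound suffices: n ∸ h is positive, so n ∸ i is positive as well.
∸-injective : ∀ {n h i} → h ℕ.< n → n ℕ.∸ h ≡ n ℕ.∸ i → h ≡ i
∸-injective {n} {h} {i} h<n e = ℕ.∸-cancelˡ-≡ (ℕ.<⇒≤ h<n) (ℕ.<⇒≤ i<n) e
  where
  i<n : i ℕ.< n
  i<n = ℕ.m∸n≢0⇒n<m λ z → ℕ.m<n⇒n≢0 (ℕ.m<n⇒0<n∸m h<n) (≡.trans e z)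

module PolyCoefficients {c ℓ} (R : CommutativeRing c ℓ) where
  open CommutativeRing R hiding (zero)
  open PolyOps rawRing
  open PolyRing R
  open PolyProperties R
  open BinomialRows R using (ν)
  open CommutativeSemiringExp commutativeSemiring using (_^_)
  private
    module P = CommutativeRing polyRing
    module Pν = BinomialRows polyRing
    module P^ = CommutativeSemiringExp P.commutativeSemiring
    module const = Hom R polyRing const-isHom

  coeff-X^-same : ∀ e → coeff (X P^.^ e) e ≈ 1#
  coeff-X^-same zero    = refl
  coeff-X^-same (suc e) = trans (at (X*-shift (X P^.^ e)) (suc e)) (coeff-X^-same e)

  coeff-X^-other : ∀ e n → n ≢ e → coeff (X P^.^ e) n ≈ 0#
  coeff-X^-other zero    zero    n≢e = contradiction ≡.refl n≢e
  coeff-X^-other zero    (suc n) n≢e = refl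
  coeff-X^-other (suc e) zero    n≢e = at (X*-shift (X P^.^ e)) zero
  coeff-X^-other (suc e) (suc n) n≢e = trans (at (X*-shift (X P^.^ e)) (suc n))
    (coeff-X^-other e n (n≢e ∘ ≡.cong suc))

  coeff-ν* : ∀ a p n → coeff (mul (Pν.ν a) p) n ≈ ν a * coeff p n
  coeff-ν* a p n = trans (at (mul-cong {Pν.ν a} {const (ν a)} {p} (mk λ i → sym (const.ν-homo a i))
    ≋-refl) n)
    (trans (at (mul-constˡ (ν a) p) n) (coeff-scale (ν a) p n))

  coeff-const^ : ∀ a e n → coeff (const a P^.^ e) n ≈ coeff (const (a ^ e)) n
  coeff-const^ a e n = sym (const.^-homo a e n)

-- Determinants of falling factorials and their leading coefficients

module FallRows {c ℓ} (R : CommutativeRing c ℓ) where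
  open CommutativeRing R hiding (zero)
  open BinomialRows R using (ν; ν≡; ν-+; ν-*)
  open CommutativeSemiringExp commutativeSemiring using (_^_)
  open Determinants R
  open Volumes R

  -- For n = L and the right z this is a row of `𝒱` without its last column, with column h
  -- multiplied by h!.
  fallRow : ∀ {n} → ℕ → Carrier → Row n
  fallRow {n} z x h = ν (fall z (toℕ h)) * x ^ (n ℕ.∸ toℕ h)

  fallΔRow : ∀ {n} → Carrier → ℕ → ℕ → Row n
  fallΔRow {n} x k z h = ν (fallΔ k (toℕ h) z) * x ^ (n ℕ.∸ toℕ h)

  -- The shift `N` and the number of columns are independent of `l`, because the rows left after
  -- splitting off a block still have the shift and the columns of the full matrix.
  fallRows : ∀ {m} (l : Vector ℕ m) (x : Fin m → Carrier) N {n} → Rows (total l) n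
  fallRows l x N r = fallRow (N ℕ.+ suc (toℕ (proj₂ (rowIndex l r)))) (x (proj₁ (rowIndex l r)))

  fallRows≐stack : ∀ {m} (l : Vector ℕ (suc m)) x N {n} →
    fallRows l x N {n} ≐₂ stack (l zero) (λ i → fallΔRow (x zero) 0 (i ℕ.+ suc N))
      (fallRows (tail l) (x ∘ suc) N)
  fallRows≐stack l x N r h = reflexive (≡.trans
    (≡.cong (λ p → row p h) (rowIndex-splitAt l r))
    (≡.trans (cases (splitAt (l zero) r)) (≡.sym
      (≡.cong-app (stack-splitAt (l zero) _ (fallRows (tail l) (x ∘ suc) N) r) h))))
    where
    row : (Σ (Fin _) λ j → Fin (l j)) → Row _
    row p = fallRow (N ℕ.+ suc (toℕ (proj₂ p))) (x (proj₁ p))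
    cases : ∀ s → row ([ (λ i → zero , i) , (λ r′ →
      suc (proj₁ (rowIndex (tail l) r′)) , proj₂ (rowIndex (tail l) r′)) ]′ s) h
      ≡ [ (λ i → fallΔRow (x zero) 0 (toℕ i ℕ.+ suc N)) , fallRows (tail l) (x ∘ suc) N ]′ s h
    cases (inj₁ i)  = ≡.cong (λ z → fallRow z (x zero) h)
      (≡.trans (ℕ.+-suc N (toℕ i)) (≡.trans (≡.cong suc (ℕ.+-comm N (toℕ i)))
        (≡.sym (ℕ.+-suc (toℕ i) N))))
    cases (inj₂ r′) = ≡.refl

  -- The differences are taken at `suc N`, the argument of the first row of the block.
  det-fallRows : ∀ {m} (l : Vector ℕ (suc m)) x N → det rawRing (fallRows l x N) ≈
    det rawRing (stack (l zero) (λ i → fallΔRow (x zero) i (suc N)) (fallRows (tail l) (x ∘ suc) N))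
  det-fallRows l x N = trans (det-cong (fallRows≐stack l x N))
    (iterated-differences (l zero) (minor-volume id) (fallΔRow (x zero))
      (fallRows (tail l) (x ∘ suc) N)
      (λ i z h → trans (*-congʳ (trans (ν≡ (fallΔ-difference i (toℕ h) z))
        (ν-+ (fallΔ i (toℕ h) z) _)))
        (distribʳ _ (ν (fallΔ i (toℕ h) z)) (ν (fallΔ (suc i) (toℕ h) z)))) (suc N))

  fallRow-shift : ∀ a {n} y x (h : Fin n) →
    fallRow (a ℕ.+ y) x (a ↑ʳ h) ≈ ν (fall (a ℕ.+ y) a) * fallRow {n} y x h
  fallRow-shift a {n} y x h = trans
    (*-cong (trans (ν≡ (≡.trans (≡.cong (fall (a ℕ.+ y)) (toℕ-↑ʳ a h)) (fall-+ a y (toℕ h))))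
      (ν-* (fall (a ℕ.+ y) a) (fall y (toℕ h))))
      (reflexive (≡.cong (x ^_) (≡.trans (≡.cong (a ℕ.+ n ℕ.∸_) (toℕ-↑ʳ a h))
        (ℕ.[m+n]∸[m+o]≡n∸o a n (toℕ h))))))
    (*-assoc (ν (fall (a ℕ.+ y) a)) (ν (fall y (toℕ h))) (x ^ (n ℕ.∸ toℕ h)))

module LeadingCoefficient {c ℓ} (R : CommutativeRing c ℓ) {m} (l : Vector ℕ (suc m))
  (x : Fin m → CommutativeRing.Carrier R) where
  open CommutativeRing R hiding (zero)
  open PolyOps rawRing
  open PolyProperties R
  open PolyCoefficients R
  open BinomialRows R using (ν; ν≡)
  open Determinants R
  open Volumes R
  open FallRows R
  open CommutativeSemiringExp commutativeSemiring using (_^_)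
  open SetoidReasoning setoid
  private
    P = PolyRing.polyRing R
    module P = CommutativeRing P
    module PV = Volumes P
    module PF = FallRows P
    a n n′ : ℕ
    a = l zero
    n = total l
    n′ = total (tail l)

    A : ℕ → Fin n → List Carrier
    A i = PF.fallΔRow X i (suc n)

    N : Fin n′ → Fin n → List Carrier
    N = PF.fallRows (tail l) (const ∘ x) n

    M : Fin n → Fin n → List Carrier
    M = PV.stack a A N

    degree : Fin n → ℕ
    degree r = [ (λ i → n ℕ.∸ toℕ i) , (λ _ → 0) ]′ (splitAt a r)

    A-coeff : ∀ i h e → coeff (A i h) e ≈ ν (fallΔ i (toℕ h) (suc n)) * coeff
      (CommutativeSemiringExp._^_ P.commutativeSemiring X (n ℕ.∸ toℕ h)) e
    A-coeff i h e = coeff-ν* (fallΔ i (toℕ h) (suc n)) _ e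

    y : Fin n′ → Carrier
    y r = x (proj₁ (rowIndex (tail l) r))

    z : Fin n′ → ℕ
    z r = suc (toℕ (proj₂ (rowIndex (tail l) r)))

    N-coeff : ∀ r h e → coeff (N r h) e ≈ ν (fall (n ℕ.+ z r) (toℕ h)) * coeff
      (const (y r ^ (n ℕ.∸ toℕ h))) e
    N-coeff r h e = trans (coeff-ν* (fall (n ℕ.+ z r) (toℕ h)) _ e)
      (*-congˡ (coeff-const^ (y r) (n ℕ.∸ toℕ h) e))

    A-degree : ∀ i h → DegreeAtMost (A i h) (n ℕ.∸ i)
    A-degree i h e lt with toℕ h ℕ.<? i
    ... | yes h<i = trans (A-coeff i h e) (trans (*-congʳ (ν≡ (fallΔ-below (suc n) h<i))) (zeroˡ _))
    ... | no  h≮i = trans (A-coeff i h e) (trans (*-congˡ (coeff-X^-other (n ℕ.∸ toℕ h) e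
      λ eq → ℕ.<⇒≱ lt (ℕ.≤-trans (ℕ.≤-reflexive eq) (ℕ.∸-monoʳ-≤ n (ℕ.≮⇒≥ h≮i))))) (zeroʳ _))

    M-degree : ∀ r h → DegreeAtMost (M r h) (degree r)
    M-degree r h = ≡.subst (λ row → DegreeAtMost (row h) (degree r))
      (≡.sym (PV.stack-splitAt a A N r)) (cases (splitAt a r))
      where
      cases : ∀ s → DegreeAtMost ([ A ∘ toℕ , N ]′ s h) ([ (λ i → n ℕ.∸ toℕ i) , (λ _ → 0) ]′ s)
      cases (inj₁ i) = A-degree (toℕ i) h
      cases (inj₂ r′) (suc e) lt = trans (N-coeff r′ h (suc e)) (zeroʳ _)

    top : Rows n n
    top = stack a (λ i h → coeff (A i h) (n ℕ.∸ i)) (fallRows (tail l) x n)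

    M-top : (λ r h → coeff (M r h) (degree r)) ≐₂ top
    M-top r h = trans (reflexive (≡.cong (λ row → coeff (row h) (degree r))
      (PV.stack-splitAt a A N r)))
      (trans (cases (splitAt a r)) (reflexive (≡.cong-app
        (≡.sym (stack-splitAt a _ (fallRows (tail l) x n) r)) h)))
      where
      cases : ∀ s → coeff ([ A ∘ toℕ , N ]′ s h) ([ (λ i → n ℕ.∸ toℕ i) , (λ _ → 0) ]′ s) ≈
        [ (λ i h → coeff (A (toℕ i) h) (n ℕ.∸ toℕ i)) , fallRows (tail l) x n ]′ s h
      cases (inj₁ i)  = refl
      cases (inj₂ r′) = N-coeff r′ h 0

    scale : Fin n′ → Carrier
    scale r = ν (fall (a ℕ.+ (n′ ℕ.+ z r)) a)

  -- In degree n - i the i-th difference row has only its entry in column i: the columns h < i were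
  -- killed by the differences, and the columns h > i carry lower powers of `X`. The other blocks
  -- are constant in `X`, and without the first `a` columns they form the matrix for `tail l` up to
  -- row factors.
  coeff-det-fallRows :
    coeff (det (Poly rawRing) (PF.fallRows l (X Vector.∷ (const ∘ x)) n)) (total degree) ≈
    product {a} (λ i → ν (toℕ i !)) * (product scale * det rawRing (fallRows (tail l) x n′))
  coeff-det-fallRows = begin
    coeff (det (Poly rawRing) (PF.fallRows l (X Vector.∷ (const ∘ x)) n)) (total degree)
      ≈⟨ PF.det-fallRows l (X Vector.∷ (const ∘ x)) n (total degree) ⟩
    coeff (det (Poly rawRing) M) (total degree)
      ≈⟨ coeff-det-top M degree M-degree ⟩
    det rawRing (λ r h → coeff (M r h) (degree r))
      ≈⟨ det-cong M-top ⟩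
    det rawRing top
      ≈⟨ det-diagonal-block a _ (fallRows (tail l) x n) (λ i → ν (i !)) off on ⟩
    product {a} (λ i → ν (toℕ i !)) * det rawRing (λ r i → fallRow (n ℕ.+ z r) (y r) (a ↑ʳ i))
      ≈⟨ *-congˡ (det-cong λ r h → trans (reflexive
          (≡.cong (λ w → fallRow w (y r) (a ↑ʳ h)) (ℕ.+-assoc a n′ (z r))))
           (fallRow-shift a (n′ ℕ.+ z r) (y r) h)) ⟩
    product {a} (λ i → ν (toℕ i !)) * det rawRing (λ r i → scale r * fallRows (tail l) x n′ r i)
      ≈⟨ *-congˡ (scale-rows (minor-volume id) scale (fallRows (tail l) x n′)) ⟩
    product {a} (λ i → ν (toℕ i !)) * (product scale * det rawRing (fallRows (tail l) x n′)) ∎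
    where
    off : ∀ i h → toℕ h ≢ i → coeff (A i h) (n ℕ.∸ i) ≈ 0#
    off i h h≢i = trans (A-coeff i h (n ℕ.∸ i))
      (trans (*-congˡ (coeff-X^-other (n ℕ.∸ toℕ h) (n ℕ.∸ i)
      λ e → h≢i (∸-injective (toℕ<n h) (≡.sym e)))) (zeroʳ _))
    on : ∀ i h → toℕ h ≡ i → coeff (A i h) (n ℕ.∸ i) ≈ ν (i !)
    on i h ≡.refl = trans (A-coeff i h (n ℕ.∸ i))
      (trans (*-cong (ν≡ (fallΔ-diagonal i (suc n))) (coeff-X^-same (n ℕ.∸ i))) (*-identityʳ _))

  det-fallRows-≉0 : IsDomain R → (∀ {k} → k ≢ 0 → ν k ≉ 0#) →
    det rawRing (fallRows (tail l) x n′) ≉ 0# →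
    det (Poly rawRing) (PF.fallRows l (X Vector.∷ (const ∘ x)) n) P.≉ []
  det-fallRows-≉0 isDomain ν≉0 det≉0 e = *-≉0 (product-≉0 {a} _ λ i → ν≉0 (k!≢0 (toℕ i)))
    (*-≉0 (product-≉0 scale λ r → ν≉0 (fall≢0 a (n′ ℕ.+ z r))) det≉0)
    (trans (sym coeff-det-fallRows) (e (total degree)))
    where open DomainProperties isDomain

-- The first variable is the outermost one of the iterated polynomial ring, so the leading
-- coefficient lies in the ring of the remaining variables and induction on `m` applies.
fallRows-nonsingular : ∀ m (l : Vector ℕ m) → let open IntegerPolynomials m in
  let open CommutativeRing A in
  det rawRing (FallRows.fallRows A l α (total l)) ≉ 0#
fallRows-nonsingular zero    l = λ ()
fallRows-nonsingular (suc m) l e = LeadingCoefficient.det-fallRows-≉0 A l α A-isDomain ν≉0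
  (fallRows-nonsingular m (tail l))
  (B.trans {det B.rawRing (fallRows l (X Vector.∷ (const ∘ α)) n)} {det B.rawRing (fallRows l β n)}
    {[]}
    (Determinants.det-cong (IntegerPolynomials.A (suc m))
      {M = fallRows l (X Vector.∷ (const ∘ α)) n} {fallRows l β n}
      λ r h → B.reflexive (≡.cong (λ y → fallRow (n ℕ.+ suc (toℕ (proj₂ (rowIndex l r)))) y h)
        (same (proj₁ (rowIndex l r))))) e)
  where
  open IntegerPolynomials m
  module B = CommutativeRing (IntegerPolynomials.A (suc m))
  open IntegerPolynomials (suc m) using () renaming (α to β)
  open PolyOps (ℤ[α] m)
  open FallRows (IntegerPolynomials.A (suc m))
  n = total l
  same : ∀ j → (X Vector.∷ (const ∘ α)) j ≡ β j
  same zero    = ≡.refl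
  same (suc j) = ≡.refl

punchIn-fromℕ : ∀ n (k : Fin n) → toℕ (punchIn (fromℕ n) k) ≡ toℕ k
punchIn-fromℕ (suc n) zero    = ≡.refl
punchIn-fromℕ (suc n) (suc k) = ≡.cong suc (punchIn-fromℕ n k)

-- Multiplying column k by k! turns the binomial coefficients into falling factorials. Deleting the
-- last column leaves the others at their own index, which makes this minor the convenient one.
𝒱-minor-last-≉0 : ∀ m (l : Vector ℕ m) → let open CommutativeRing (IntegerPolynomials.A m) in
  𝒱-minor l (fromℕ (total l)) ≉ 0#
𝒱-minor-last-≉0 m l e = fallRows-nonsingular m l (begin
  det rawRing (fallRows l α n)
    ≈⟨ det-cong entries ⟩
  det rawRing (λ r k → ν (toℕ k !) * rows r (punchIn (fromℕ n) k))
    ≈⟨ scale-columns (λ k → ν (toℕ k !)) (λ r k → rows r (punchIn (fromℕ n) k)) ⟩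
  product (λ (k : Fin n) → ν (toℕ k !)) * minor (punchIn (fromℕ n)) rows
    ≈⟨ *-congˡ (trans (minor≈ (fromℕ n)) e) ⟩
  product (λ (k : Fin n) → ν (toℕ k !)) * 0#
    ≈⟨ zeroʳ _ ⟩
  0# ∎)
  where
  open IntegerPolynomials m
  open CommutativeRing A hiding (zero)
  open BinomialRows A using (ν; ν≡; ν-*)
  open CommutativeSemiringExp commutativeSemiring using (_^_)
  open Determinants A
  open Volumes A
  open FallRows A
  open CommonFactor l
  open RowDivisibility A l α using (rows)
  open SetoidReasoning setoid
  n = total l
  entries : fallRows l α n ≐₂ λ r k → ν (toℕ k !) * rows r (punchIn (fromℕ n) k)
  entries r k = begin
    ν (fall z (toℕ k)) * x ^ (n ℕ.∸ toℕ k)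
      ≈⟨ *-congʳ (trans (ν≡ (fall≡h!*zCh z (toℕ k))) (ν-* (toℕ k !) (z C toℕ k))) ⟩
    (ν (toℕ k !) * ν (z C toℕ k)) * x ^ (n ℕ.∸ toℕ k)
      ≈⟨ *-assoc (ν (toℕ k !)) (ν (z C toℕ k)) _ ⟩
    ν (toℕ k !) * (ν (z C toℕ k) * x ^ (n ℕ.∸ toℕ k))
      ≡⟨ ≡.cong (λ i → ν (toℕ k !) * (ν (z C i) * x ^ (n ℕ.∸ i))) (punchIn-fromℕ n k) ⟨
    ν (toℕ k !) * rows r (punchIn (fromℕ n) k) ∎
    where
    z = n ℕ.+ suc (toℕ (proj₂ (rowIndex l r)))
    x = α (proj₁ (rowIndex l r))

-- From integral to rational coefficients

ℚ-isDomain : IsDomain ℚ.+-*-commutativeRing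
ℚ-isDomain = record
  { 1≉0         = λ ()
  ; zeroProduct = zero-product
  ; _≈0?        = ℚ._≟ ℚ.0ℚ
  }
  where
  zero-product : ∀ {p q} → p ℚ.* q ≡ ℚ.0ℚ → p ≡ ℚ.0ℚ ⊎ q ≡ ℚ.0ℚ
  zero-product {p} {q} e with p ℚ.≟ ℚ.0ℚ
  ... | yes p≡0 = inj₁ p≡0
  ... | no  p≢0 = inj₂ (begin
    q                    ≡⟨ ℚ.*-identityˡ q ⟨
    ℚ.1ℚ ℚ.* q           ≡⟨ ≡.cong (ℚ._* q) (ℚ.*-inverseˡ p) ⟨
    (ℚ.1/ p ℚ.* p) ℚ.* q ≡⟨ ℚ.*-assoc (ℚ.1/ p) p q ⟩
    ℚ.1/ p ℚ.* (p ℚ.* q) ≡⟨ ≡.cong (ℚ.1/ p ℚ.*_) e ⟩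
    ℚ.1/ p ℚ.* ℚ.0ℚ      ≡⟨ ℚ.*-zeroʳ (ℚ.1/ p) ⟩
    ℚ.0ℚ                 ∎)
    where
    open ≡.≡-Reasoning
    instance _ = ℚ.≢-nonZero p≢0

toℚᵘ-/ : ∀ i d .{{_ : ℕ.NonZero d}} → ℚ.toℚᵘ (i ℚ./ d) ℚᵘ.≃ (i ℚᵘ./ d)
toℚᵘ-/ i (suc d) = ℚ.toℚᵘ-fromℚᵘ (mkℚᵘ i d)

-- Normalised fractions involve a gcd; among unnormalised fractions both laws become identities of
-- integers.
/1-isHom : IsHom ℤ.+-*-commutativeRing ℚ.+-*-commutativeRing (ℚ._/ 1)
/1-isHom = mkHom ℤ.+-*-commutativeRing ℚ.+-*-commutativeRing (≡.cong (ℚ._/ 1)) +-homo *-homo ≡.refl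
  where
  open SetoidReasoning ℚᵘ.≃-setoid
  +-homo : ∀ i j → (i ℤ.+ j) ℚ./ 1 ≡ i ℚ./ 1 ℚ.+ j ℚ./ 1
  +-homo i j = ℚ.toℚᵘ-injective (begin
    ℚ.toℚᵘ ((i ℤ.+ j) ℚ./ 1)                       ≈⟨ toℚᵘ-/ (i ℤ.+ j) 1 ⟩
    mkℚᵘ (i ℤ.+ j) 0
      ≈⟨ *≡* (solve 2 (λ i j → (i :+ j) :* con ℤ.1ℤ := (i :* con ℤ.1ℤ :+ j :* con ℤ.1ℤ) :* con ℤ.1ℤ)
      ≡.refl i j) ⟩
    mkℚᵘ i 0 ℚᵘ.+ mkℚᵘ j 0                         ≈⟨ ℚᵘ.+-cong (toℚᵘ-/ i 1) (toℚᵘ-/ j 1) ⟨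
    ℚ.toℚᵘ (i ℚ./ 1) ℚᵘ.+ ℚ.toℚᵘ (j ℚ./ 1)         ≈⟨ ℚ.toℚᵘ-homo-+ (i ℚ./ 1) (j ℚ./ 1) ⟨
    ℚ.toℚᵘ (i ℚ./ 1 ℚ.+ j ℚ./ 1)                   ∎)
    where open ℤSolver
  *-homo : ∀ i j → (i ℤ.* j) ℚ./ 1 ≡ (i ℚ./ 1) ℚ.* (j ℚ./ 1)
  *-homo i j = ℚ.toℚᵘ-injective (begin
    ℚ.toℚᵘ ((i ℤ.* j) ℚ./ 1)                       ≈⟨ toℚᵘ-/ (i ℤ.* j) 1 ⟩
    mkℚᵘ i 0 ℚᵘ.* mkℚᵘ j 0                         ≈⟨ ℚᵘ.*-cong (toℚᵘ-/ i 1) (toℚᵘ-/ j 1) ⟨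
    ℚ.toℚᵘ (i ℚ./ 1) ℚᵘ.* ℚ.toℚᵘ (j ℚ./ 1)         ≈⟨ ℚ.toℚᵘ-homo-* (i ℚ./ 1) (j ℚ./ 1) ⟨
    ℚ.toℚᵘ ((i ℚ./ 1) ℚ.* (j ℚ./ 1))                   ∎)

/1-≡0 : ∀ {i} → i ℚ./ 1 ≡ ℚ.0ℚ → i ≡ ℤ.0ℤ
/1-≡0 {i} e with ℚᵘ.≃-trans (ℚᵘ.≃-sym (toℚᵘ-/ i 1)) (ℚᵘ.≃-reflexive (≡.cong ℚ.toℚᵘ e))
... | *≡* eq = ≡.trans (≡.sym (ℤ.*-identityʳ i)) eq

/-*-cancel : ∀ i d .{{_ : ℕ.NonZero d}} → (i ℚ./ d) ℚ.* (+ d ℚ./ 1) ≡ i ℚ./ 1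
/-*-cancel i (suc d) = ℚ.toℚᵘ-injective (begin
  ℚ.toℚᵘ ((i ℚ./ suc d) ℚ.* (+ suc d ℚ./ 1))
    ≈⟨ ℚ.toℚᵘ-homo-* (i ℚ./ suc d) (+ suc d ℚ./ 1) ⟩
  ℚ.toℚᵘ (i ℚ./ suc d) ℚᵘ.* ℚ.toℚᵘ (+ suc d ℚ./ 1)
    ≈⟨ ℚᵘ.*-cong (toℚᵘ-/ i (suc d)) (toℚᵘ-/ (+ suc d) 1) ⟩
  mkℚᵘ i d ℚᵘ.* mkℚᵘ (+ suc d) 0
    ≈⟨ *≡* (≡.trans (ℤ.*-identityʳ (i ℤ.* + suc d))
        (≡.cong (λ x → i ℤ.* + suc x) (≡.sym (ℕ.*-identityʳ d)))) ⟩
  mkℚᵘ i 0                                              ≈⟨ toℚᵘ-/ i 1 ⟨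
  ℚ.toℚᵘ (i ℚ./ 1)                                      ∎)
  where open SetoidReasoning ℚᵘ.≃-setoid

/!-*-cancel : ∀ a n → (a /! n) ℚ.* (+ (n !) ℚ./ 1) ≡ + a ℚ./ 1
/!-*-cancel a n = /-*-cancel (+ a) (n !)
  where instance _ = n ℕ.!≢0

/!-≢0 : ∀ {a} n → a ≢ 0 → a /! n ≢ ℚ.0ℚ
/!-≢0 {a} n a≢0 e = a≢0 (ℤ.+-injective (/1-≡0 (≡.trans (≡.sym (/!-*-cancel a n))
  (≡.trans (≡.cong (ℚ._* (+ (n !) ℚ./ 1)) e) (ℚ.*-zeroˡ (+ (n !) ℚ./ 1))))))

module _ {c ℓ c′ ℓ′} (R : CommutativeRing c ℓ) (S : CommutativeRing c′ ℓ′) where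
  open PolyRing S
  open PolyProperties S
  private
    module R = CommutativeRing R
    module S = CommutativeRing S
    PR = PolyRing.polyRing R
    PS = PolyRing.polyRing S
    open PolyOps S.rawRing

  -- `map f` is evaluation at `X` with the coefficients sent through `const ∘ f`, so it inherits the
  -- laws from `horner`.
  map-isHom : ∀ {f : R.Carrier → S.Carrier} → IsHom R S f → IsHom PR PS (map f)
  map-isHom {f} f-isHom = hom-resp PR PS (λ p → at (horner≋map p)) H.horner-isHom
    where
    module H = PolyProperties.Horner R PS (∘-hom R S PS f-isHom const-isHom) X
    horner≋map : ∀ p → H.horner p ≋ map f p
    horner≋map []      = ≋-refl
    horner≋map (a ∷ p) = ≋-trans (add-cong (≋-refl {const (f a)}) (mul-congʳ X (horner≋map p)))
      (cons-split (f a) (map f p))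

ι-isHom : ∀ m → IsHom (mpolyRing ℤ.+-*-commutativeRing m) (mpolyRing ℚ.+-*-commutativeRing m) (ι m)
ι-isHom zero    = /1-isHom
ι-isHom (suc m) = map-isHom (mpolyRing ℤ.+-*-commutativeRing m) (mpolyRing ℚ.+-*-commutativeRing m)
  (ι-isHom m)

-- A trivial kernel is all that is needed to carry the non-vanishing of the last minor over to
-- rational coefficients.
ι-≈0 : ∀ m {x} → CommutativeRing._≈_ (mpolyRing ℚ.+-*-commutativeRing m) (ι m x)
  (CommutativeRing.0# (mpolyRing ℚ.+-*-commutativeRing m)) →
  CommutativeRing._≈_ (mpolyRing ℤ.+-*-commutativeRing m) x
    (CommutativeRing.0# (mpolyRing ℤ.+-*-commutativeRing m))
ι-≈0 zero        e         = /1-≡0 e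
ι-≈0 (suc m) {[]}    e n       = CommutativeRing.refl (mpolyRing ℤ.+-*-commutativeRing m)
ι-≈0 (suc m) {a ∷ p} e zero    = ι-≈0 m (e 0)
ι-≈0 (suc m) {a ∷ p} e (suc n) = ι-≈0 (suc m) {p} (λ i → e (suc i)) n

ι-var : ∀ m j → CommutativeRing._≈_ (mpolyRing ℚ.+-*-commutativeRing m)
  (ι m (var ℤ.+-*-rawRing m j)) (var ℚ.+-*-rawRing m j)
ι-var (suc m) zero    = at (cons-cong 0#-homo (cons-cong 1#-homo ≋-refl))
  where
  open IsRingHomomorphism (ι-isHom m)
  open PolyRing (mpolyRing ℚ.+-*-commutativeRing m)
ι-var (suc m) (suc j) = at (cons-cong (ι-var m j) ≋-refl)
  where open PolyRing (mpolyRing ℚ.+-*-commutativeRing m)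

-- Coefficient lists, bounded search and finite differences

module Tabulate {c ℓ} (R : CommutativeRing c ℓ) where
  open CommutativeRing R hiding (zero)
  open PolyOps rawRing
  open PolyRing R
  open PolyProperties R
  private
    module P = CommutativeRing polyRing
    module PΣ = SemiringSum P.semiring
    module P^ = CommutativeSemiringExp P.commutativeSemiring

  coeff-tabulate : ∀ {n} (v : Vector Carrier n) i → coeff (tabulate v) (toℕ i) ≡ v i
  coeff-tabulate v zero    = ≡.refl
  coeff-tabulate v (suc i) = coeff-tabulate (v ∘ suc) i

  coeff-tabulate-beyond : ∀ {n} (v : Vector Carrier n) {i} → n ℕ.≤ i → coeff (tabulate v) i ≡ 0#
  coeff-tabulate-beyond {zero}  v {i}     le       = ≡.refl
  coeff-tabulate-beyond {suc n} v {suc i} (s≤s le) = coeff-tabulate-beyond (v ∘ suc) le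

  -- `X` is factored out of all terms but the first. This yields the explicit formula for the
  -- denominator.
  sum-monomials : ∀ {n} (v : Vector Carrier n) →
    PΣ.sum (λ i → mul (const (v i)) (X P^.^ toℕ i)) ≋ tabulate v
  sum-monomials {zero}  v = ≋-refl
  sum-monomials {suc n} v = ≋-trans
    (add-cong (≋-trans (mul-comm (const (v zero)) (const 1#)) (mul-identityˡ (const (v zero))))
      (≋-trans (mk {PΣ.sum {n} (λ i → mul (const (v (suc i))) (mul X (X P^.^ toℕ i)))}
        {PΣ.sum {n} (λ i → mul X (mul (const (v (suc i))) (X P^.^ toℕ i)))}
          (PΣ.sum-cong-≋ {n} λ i → at (pull (v (suc i)) (X P^.^ toℕ i))))
        (≋-trans (≋-sym (mk {mul X (PΣ.sum {n} (λ i → mul (const (v (suc i))) (X P^.^ toℕ i)))}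
          {PΣ.sum {n} (λ i → mul X (mul (const (v (suc i))) (X P^.^ toℕ i)))}
            (PΣ.*-distribˡ-sum {n} X (λ i → mul (const (v (suc i))) (X P^.^ toℕ i)))))
          (mul-congʳ X (sum-monomials (v ∘ suc))))))
    (cons-split (v zero) (tabulate (v ∘ suc)))
    where
    pull : ∀ a p → mul (const a) (mul X p) ≋ mul X (mul (const a) p)
    pull a p = ≋-trans (≋-sym (mul-assoc (const a) X p))
      (≋-trans (mul-cong (mul-comm (const a) X) ≋-refl) (mul-assoc X (const a) p))

module _ {p} {P : ℕ → Set p} (P? : Decidable P) where
  -- Finds the order of a remainder; the bound `K` is what makes the search possible without
  -- deciding whether a whole series vanishes.
  least-failure : ∀ {K} → ¬ (∀ n → n ℕ.< K → P n) → ∃ λ d → d ℕ.< K × ¬ P d × (∀ n → n ℕ.< d → P n)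
  least-failure {zero}  h = contradiction (λ n ()) h
  least-failure {suc K} h with ℕ.allUpTo? P? K
  ... | no some = Product.map₂ (Product.map₁ ℕ.m<n⇒m<1+n)
    (least-failure {K} λ all → some λ {n} → all n)
  ... | yes all = K , ℕ.n<1+n K , (λ PK → h λ n n<1+K → upTo PK n (ℕ.m<1+n⇒m<n∨m≡n n<1+K)) ,
    (λ n → all)
    where
    upTo : P K → ∀ n → n ℕ.< K ⊎ n ≡ K → P n
    upTo PK n (inj₁ n<K)    = all n<K
    upTo PK n (inj₂ ≡.refl) = PK

  -- Finds the exact degree of a coefficient list, which may end in zeros.
  greatest-failure : ∀ {K} → ¬ (∀ n → n ℕ.< K → P n) → ∃ λ d →
    d ℕ.< K × ¬ P d × (∀ n → d ℕ.< n → n ℕ.< K → P n)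
  greatest-failure {zero}  h = contradiction (λ n ()) h
  greatest-failure {suc K} h with P? K
  ... | no ¬PK = K , ℕ.n<1+n K , ¬PK , λ n K<n n<1+K → contradiction K<n (ℕ.≤⇒≯ (ℕ.≤-pred n<1+K))
  ... | yes PK with greatest-failure {K} (λ all → h λ n n<1+K → upTo all n (ℕ.m<1+n⇒m<n∨m≡n n<1+K))
    where
    upTo : (∀ n → n ℕ.< K → P n) → ∀ n → n ℕ.< K ⊎ n ≡ K → P n
    upTo all n (inj₁ n<K)    = all n n<K
    upTo all n (inj₂ ≡.refl) = PK
  ...   | d , d<K , ¬Pd , above = d , ℕ.m<n⇒m<1+n d<K , ¬Pd , λ n d<n n<1+K →
    beyond n d<n (ℕ.m<1+n⇒m<n∨m≡n n<1+K)
    where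
    beyond : ∀ n → d ℕ.< n → n ℕ.< K ⊎ n ≡ K → P n
    beyond n d<n (inj₁ n<K)    = above n d<n n<K
    beyond n d<n (inj₂ ≡.refl) = PK

module FiniteDifferences {c ℓ} (R : CommutativeRing c ℓ) where
  open CommutativeRing R hiding (zero)
  open BinomialRows R using (ν; νC0; νPascal)
  open SemiringSum semiring using (sum; sum-cong-≋; ∑-distrib-+)
  open Determinants R using (sum-zero)
  open SetoidReasoning setoid

  -- Newton's form of a polynomial function of degree less than K. For h < K, `w h` is its h-th
  -- forward difference at 0.
  newton : ℕ → (ℕ → Carrier) → ℕ → Carrier
  newton K w z = sum {K} λ h → ν (z C toℕ h) * w (toℕ h)

  newton-difference : ∀ K w z → newton (suc K) w (suc z) ≈ newton (suc K) w z + newton K (w ∘ suc) z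
  newton-difference K w z = begin
    ν (suc z C 0) * w 0 + sum {K} (λ h → ν (suc z C suc (toℕ h)) * w (suc (toℕ h)))
      ≈⟨ +-cong (*-congʳ (trans (νC0 (suc z)) (sym (νC0 z))))
           (sum-cong-≋ {K} λ h → trans (*-congʳ (trans (νPascal z (toℕ h)) (+-comm _ _)))
             (distribʳ _ _ _)) ⟩
    ν (z C 0) * w 0 + sum {K} (λ h → ν (z C suc (toℕ h)) * w (suc (toℕ h)) + ν (z C toℕ h) * w
      (suc (toℕ h)))
      ≈⟨ +-congˡ (∑-distrib-+ {K} (λ h → ν (z C suc (toℕ h)) * w (suc (toℕ h)))
          (λ h → ν (z C toℕ h) * w (suc (toℕ h)))) ⟩
    ν (z C 0) * w 0 + (sum {K} (λ h → ν (z C suc (toℕ h)) * w (suc (toℕ h))) + newton K (w ∘ suc) z)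
      ≈⟨ +-assoc _ _ _ ⟨
    newton (suc K) w z + newton K (w ∘ suc) z ∎

  -- Differences of neighbouring values form the Newton series of `w ∘ suc` with one term less, so
  -- recursion kills the higher coefficients, and the value at z reduces to `w 0`. No division is
  -- involved.
  newton-unique : ∀ K w z → (∀ k → k ℕ.< K → newton K w (k ℕ.+ z) ≈ 0#) → ∀ h → h ℕ.< K → w h ≈ 0#
  newton-unique (suc K) w z vanish = coefficients
    where
    higher : ∀ h → h ℕ.< K → w (suc h) ≈ 0#
    higher = newton-unique K (w ∘ suc) z λ k k<K → begin
      newton K (w ∘ suc) (k ℕ.+ z)
        ≈⟨ +-identityˡ _ ⟨
      0# + newton K (w ∘ suc) (k ℕ.+ z)
        ≈⟨ +-congʳ (vanish k (ℕ.m<n⇒m<1+n k<K)) ⟨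
      newton (suc K) w (k ℕ.+ z) + newton K (w ∘ suc) (k ℕ.+ z)
        ≈⟨ newton-difference K w (k ℕ.+ z) ⟨
      newton (suc K) w (suc (k ℕ.+ z))
        ≈⟨ vanish (suc k) (s≤s k<K) ⟩
      0# ∎
    coefficients : ∀ h → h ℕ.< suc K → w h ≈ 0#
    coefficients (suc h) (s≤s h<K) = higher h h<K
    coefficients zero    _         = begin
      w 0
        ≈⟨ trans (*-congʳ (νC0 z)) (*-identityˡ _) ⟨
      ν (z C 0) * w 0
        ≈⟨ +-identityʳ _ ⟨
      ν (z C 0) * w 0 + 0#
        ≈⟨ +-congˡ (sum-zero {K} λ h → trans (*-congˡ (higher (toℕ h) (toℕ<n h))) (zeroʳ _)) ⟨
      newton (suc K) w z
        ≈⟨ vanish 0 (s≤s z≤n) ⟩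
      0# ∎
      where open import Data.Fin.Properties using (toℕ<n)

open import Data.Nat.Base using (_+_; _≤_)

-- Padé approximants

-- Both sides become a after multiplication by i! k!, because (i+k)! = C(i+k, i) i! k!.
/!-product : ∀ a i k → (a /! i) ℚ.* (1 /! k) ≡ (a /! (i + k)) ℚ.* (+ ((i + k) C i) ℚ./ 1)
/!-product a i k = *-cancelʳ {(a /! i) ℚ.* (1 /! k)} {(a /! (i + k)) ℚ.* n ((i + k) C i)}
  {n (i !) ℚ.* n (k !)} nonzero (begin
  ((a /! i) ℚ.* (1 /! k)) ℚ.* (n (i !) ℚ.* n (k !))
    ≡⟨ solve 4 (λ x y u v → (x :* y) :* (u :* v) := (x :* u) :* (y :* v)) ≡.refl (a /! i) (1 /! k)
        (n (i !)) (n (k !)) ⟩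
  ((a /! i) ℚ.* n (i !)) ℚ.* ((1 /! k) ℚ.* n (k !))
    ≡⟨ ≡.cong₂ ℚ._*_ (/!-*-cancel a i) (/!-*-cancel 1 k) ⟩
  n a ℚ.* ℚ.1ℚ
    ≡⟨ ℚ.*-identityʳ (n a) ⟩
  n a
    ≡⟨ /!-*-cancel a (i + k) ⟨
  (a /! (i + k)) ℚ.* n ((i + k) !)
    ≡⟨ ≡.cong (λ x → (a /! (i + k)) ℚ.* n x) ([a+b]Ca*a!*b!≡[a+b]! i k) ⟨
  (a /! (i + k)) ℚ.* n (((i + k) C i) ℕ.* (i ! ℕ.* k !))
    ≡⟨ ≡.cong ((a /! (i + k)) ℚ.*_) (≡.trans (n-* ((i + k) C i) (i ! ℕ.* k !))
        (≡.cong (n ((i + k) C i) ℚ.*_) (n-* (i !) (k !)))) ⟩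
  (a /! (i + k)) ℚ.* (n ((i + k) C i) ℚ.* (n (i !) ℚ.* n (k !)))
    ≡⟨ ℚ.*-assoc (a /! (i + k)) (n ((i + k) C i)) (n (i !) ℚ.* n (k !)) ⟨
  ((a /! (i + k)) ℚ.* n ((i + k) C i)) ℚ.* (n (i !) ℚ.* n (k !)) ∎)
  where
  open ≡.≡-Reasoning
  open DomainProperties ℚ-isDomain
  open RingSolver (CommutativeRing.commutativeSemiring ℚ.+-*-commutativeRing) using
      (solve; _:*_; _:=_)
  n : ℕ → ℚ
  n x = + x ℚ./ 1
  n-* : ∀ x y → n (x ℕ.* y) ≡ n x ℚ.* n y
  n-* x y = ≡.trans (≡.cong (ℚ._/ 1) (ℤ.pos-* x y)) (IsRingHomomorphism.*-homo /1-isHom (+ x) (+ y))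
  n≢0 : ∀ {x} → x ≢ 0 → n x ≢ ℚ.0ℚ
  n≢0 x≢0 e = x≢0 (ℤ.+-injective (/1-≡0 e))
  nonzero : n (i !) ℚ.* n (k !) ≢ ℚ.0ℚ
  nonzero = *-≉0 {n (i !)} {n (k !)} (n≢0 (k!≢0 i)) (n≢0 (k!≢0 k))

module Fractions {c ℓ} (R : CommutativeRing c ℓ)
  {q : ℚ → CommutativeRing.Carrier R} (q-isHom : IsHom ℚ.+-*-commutativeRing R q) where
  open CommutativeRing R hiding (zero; _+_)
  open BinomialRows R using (ν)
  private module q = IsRingHomomorphism q-isHom

  qν : ∀ n → q (+ n ℚ./ 1) ≈ ν n
  qν n = trans (reflexive (≡.cong (λ x → q (x ℚ./ 1)) (≡.sym (νℤ n))))
    (Hom.ν-homo ℤ.+-*-commutativeRing R (∘-hom ℤ.+-*-commutativeRing ℚ.+-*-commutativeRing R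
      /1-isHom q-isHom) n)

  q/!-product : ∀ a i k → q (a /! i) * q (1 /! k) ≈ q (a /! (i + k)) * ν ((i + k) C i)
  q/!-product a i k = trans (sym (q.*-homo (a /! i) (1 /! k)))
    (trans (reflexive (≡.cong q (/!-product a i k)))
      (trans (q.*-homo (a /! (i + k)) (+ ((i + k) C i) ℚ./ 1)) (*-congˡ (qν ((i + k) C i)))))

-- Here frac a n stands for the scalar a / n!.
module Pade {c ℓ} (R : CommutativeRing c ℓ) (isDomain : IsDomain R)
  (frac : ℕ → ℕ → CommutativeRing.Carrier R)
  (frac-≉0 : ∀ {a} n → a ≢ 0 → CommutativeRing._≉_ R (frac a n) (CommutativeRing.0# R))
  (frac-product : ∀ a i k → CommutativeRing._≈_ R
    (CommutativeRing._*_ R (frac a i) (frac 1 k))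
    (CommutativeRing._*_ R (frac a (i + k)) (BinomialRows.ν R ((i + k) C i))))
  where
  open CommutativeRing R hiding (zero; _+_)
  open CommutativeRing R using () renaming (_+_ to _⊕_)
  open IsDomain isDomain
  open DomainProperties isDomain
  open PolyOps rawRing using (coeff)
  open BinomialRows R using (ν)
  open FiniteDifferences R
  open Tabulate R
  open Determinants R using (sum-zero)
  open CommutativeSemiringExp commutativeSemiring using (_^_; ^-homo-*)
  open SemiringSum semiring using (sum; sum-cong-≋; *-distribˡ-sum)
  open RingProperties ring using (-0#≈0#)
  open SetoidReasoning setoid
  open RingSolver commutativeSemiring using (solve; _:*_; _:=_)

  sum-truncate : ∀ a k (f : ℕ → Carrier) → (∀ i → a ≤ i → f i ≈ 0#) →
    sum {a + k} (f ∘ toℕ) ≈ sum {a} (f ∘ toℕ)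
  sum-truncate zero    k f h = sum-zero {k} λ i → h (toℕ i) z≤n
  sum-truncate (suc a) k f h = +-congˡ (sum-truncate a k (f ∘ suc) λ i a≤i → h (suc i) (s≤s a≤i))

  sum-last : ∀ n (f : ℕ → Carrier) → (∀ i → i ℕ.< n → f i ≈ 0#) → sum {suc n} (f ∘ toℕ) ≈ f n
  sum-last zero    f h = +-identityʳ (f 0)
  sum-last (suc n) f h = trans (+-cong (h 0 (s≤s z≤n))
    (sum-last n (f ∘ suc) λ i i<n → h (suc i) (s≤s i<n))) (+-identityˡ _)

  coeff-tabulate-toℕ : ∀ {L} (u : ℕ → Carrier) {n} → n ℕ.< suc L →
    coeff (tabulate {n = suc L} (u ∘ toℕ)) n ≈ u n
  coeff-tabulate-toℕ {L} u lt = reflexive (≡.subst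
    (λ k → coeff (tabulate {n = suc L} (u ∘ toℕ)) k ≡ u k) (toℕ-fromℕ< lt)
    (coeff-tabulate (u ∘ toℕ) (fromℕ< lt)))

  tabulate-degree : ∀ {L} (u : ℕ → Carrier) → ¬ (∀ n → n ℕ.< suc L → u n ≈ 0#) →
    ∃ λ d → IsDegree rawRing (tabulate {n = suc L} (u ∘ toℕ)) d × d ≤ L
  tabulate-degree {L} u nonzero with greatest-failure (λ n → u n ≈0?) nonzero
  ... | d , d<1+L , ud≉0 , above = d , ((λ e → ud≉0 (trans (sym (coeff-tabulate-toℕ u d<1+L)) e)) ,
    vanish) , ℕ.≤-pred d<1+L
    where
    vanish : ∀ n → d ℕ.< n → coeff (tabulate {n = suc L} (u ∘ toℕ)) n ≈ 0#
    vanish n d<n with n ℕ.<? suc L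
    ... | yes lt = trans (coeff-tabulate-toℕ u lt) (above n d<n lt)
    ... | no  ge = reflexive (coeff-tabulate-beyond (u ∘ toℕ) (ℕ.≮⇒≥ ge))

  module _ (L : ℕ) (v : Vector Carrier (suc L)) where
    -- `v` continued by 0, so that Newton series and searches can use indices in ℕ.
    c₀ : ℕ → Carrier
    c₀ = coeff (tabulate v)

    b₀ : ℕ → Carrier
    b₀ n = frac (L !) n * c₀ n

    scaled : Vector Carrier (suc L)
    scaled i = frac (L !) (toℕ i) * v i

    denominator : List Carrier
    denominator = tabulate scaled

    denominator≡ : denominator ≡ tabulate {n = suc L} (b₀ ∘ toℕ)
    denominator≡ = tabulate-cong λ i → ≡.cong (frac (L !) (toℕ i) *_) (≡.sym (coeff-tabulate v i))

    c₀-beyond : ∀ {n} → L ℕ.< n → c₀ n ≈ 0#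
    c₀-beyond lt = reflexive (coeff-tabulate-beyond v lt)

    coeff-denominator : ∀ n → coeff denominator n ≈ b₀ n
    coeff-denominator n with n ℕ.<? suc L
    ... | yes lt = trans (reflexive (≡.cong (λ p → coeff p n) denominator≡))
      (coeff-tabulate-toℕ b₀ lt)
    ... | no  ge = trans (reflexive (coeff-tabulate-beyond scaled (ℕ.≮⇒≥ ge)))
      (sym (trans (*-congˡ (c₀-beyond (ℕ.≮⇒≥ ge))) (zeroʳ _)))

    b₀≈0⇒c₀≈0 : ∀ n → b₀ n ≈ 0# → c₀ n ≈ 0#
    b₀≈0⇒c₀≈0 n e = *-cancelʳ (frac-≉0 n (k!≢0 L))
      (trans (*-comm _ _) (trans e (sym (zeroˡ _))))

    denominator-degree : ¬ (∀ n → n ℕ.< suc L → c₀ n ≈ 0#) → ∃ λ d →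
      IsDegree rawRing denominator d × d ≤ L
    denominator-degree v≉0 = ≡.subst (λ p → ∃ λ d → IsDegree rawRing p d × d ≤ L)
      (≡.sym denominator≡)
      (tabulate-degree b₀ λ h → v≉0 λ n lt → b₀≈0⇒c₀≈0 n (h n lt))

    module _ (α : Carrier) (α≉0 : α ≉ 0#) where
      expCoeff : ℕ → Carrier
      expCoeff n = frac 1 n * α ^ n

      -- Written exactly as the product of power series unfolds, so that the approximation identity
      -- holds by definition.
      productCoeff : ℕ → Carrier
      productCoeff N = sum {suc N} λ i → coeff denominator (toℕ i) * expCoeff (N ℕ.∸ toℕ i)

      -- For N = L + k this is what remains of the term with α^(N-n) once α^k has been taken out.
      w : ℕ → Carrier
      w n = α ^ (L ℕ.∸ n) * c₀ n

      term : ∀ N i → i ≤ N → coeff denominator i * expCoeff (N ℕ.∸ i) ≈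
        frac (L !) N * (ν (N C i) * (α ^ (N ℕ.∸ i) * c₀ i))
      term N i i≤N = begin
        coeff denominator i * (frac 1 k * α ^ k)
          ≈⟨ *-congʳ (coeff-denominator i) ⟩
        (frac (L !) i * c₀ i) * (frac 1 k * α ^ k)
          ≈⟨ solve 4 (λ x y z u → (x :* y) :* (z :* u) := (x :* z) :* (u :* y)) refl
              (frac (L !) i) (c₀ i) (frac 1 k) (α ^ k) ⟩
        (frac (L !) i * frac 1 k) * (α ^ k * c₀ i)
          ≈⟨ *-congʳ (trans (frac-product (L !) i k)
               (reflexive (≡.cong (λ M → frac (L !) M * ν (M C i)) (ℕ.m+[n∸m]≡n i≤N)))) ⟩
        (frac (L !) N * ν (N C i)) * (α ^ k * c₀ i)
          ≈⟨ *-assoc _ _ _ ⟩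
        frac (L !) N * (ν (N C i) * (α ^ k * c₀ i)) ∎
        where k = N ℕ.∸ i

      -- Beyond index L the whole denominator takes part, so the number of terms is fixed and the
      -- factors that depend only on k come out of the sum.
      productCoeff-beyond : ∀ k → productCoeff (L + k)
        ≈ (frac (L !) (L + k) * α ^ k) * newton (suc L) w (L + k)
      productCoeff-beyond k = begin
        productCoeff (L + k)
          ≈⟨ sum-truncate (suc L) k (λ i → coeff denominator i * expCoeff (L + k ℕ.∸ i))
               (λ i L<i → trans (*-congʳ (reflexive (coeff-tabulate-beyond scaled L<i))) (zeroˡ _)) ⟩
        sum {suc L} (λ i → coeff denominator (toℕ i) * expCoeff (L + k ℕ.∸ toℕ i))
          ≈⟨ sum-cong-≋ {suc L} (λ i → trans (term (L + k) (toℕ i)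
              (ℕ.≤-trans (toℕ≤pred[n] i) (ℕ.m≤m+n L k))) (split i)) ⟩
        sum {suc L} (λ i → (frac (L !) (L + k) * α ^ k) * (ν ((L + k) C toℕ i) * w (toℕ i)))
          ≈⟨ *-distribˡ-sum {suc L} (frac (L !) (L + k) * α ^ k)
              (λ i → ν ((L + k) C toℕ i) * w (toℕ i)) ⟨
        (frac (L !) (L + k) * α ^ k) * newton (suc L) w (L + k) ∎
        where
        split : ∀ (i : Fin (suc L)) → frac (L !) (L + k) *
          (ν ((L + k) C toℕ i) * (α ^ (L + k ℕ.∸ toℕ i) * c₀ (toℕ i))) ≈
          (frac (L !) (L + k) * α ^ k) * (ν ((L + k) C toℕ i) * w (toℕ i))
        split i = trans (*-congˡ (*-congˡ (*-congʳ (trans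
          (reflexive (≡.cong (α ^_) (≡.trans (≡.cong (ℕ._∸ toℕ i) (ℕ.+-comm L k))
            (ℕ.+-∸-assoc k (toℕ≤pred[n] i)))))
          (^-homo-* α k (L ℕ.∸ toℕ i))))))
          (solve 5 (λ x n a b y → x :* (n :* ((a :* b) :* y)) := (x :* a) :* (n :* (b :* y))) refl
            (frac (L !) (L + k)) (ν ((L + k) C toℕ i)) (α ^ k) (α ^ (L ℕ.∸ toℕ i)) (c₀ (toℕ i)))

      productCoeff-all-zero-above : (∀ k → k ℕ.< suc L → productCoeff (k + suc L) ≈ 0#) → ∀ n →
        n ℕ.< suc L → c₀ n ≈ 0#
      productCoeff-all-zero-above h n n<1+L = cancel
        (newton-unique (suc L) w (suc L) newton≈0 n n<1+L)
        where
        cancel : w n ≈ 0# → c₀ n ≈ 0#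
        cancel e = *-cancelʳ (^-≉0 (L ℕ.∸ n) α≉0) (trans (*-comm _ _) (trans e (sym (zeroˡ _))))
        newton≈0 : ∀ k → k ℕ.< suc L → newton (suc L) w (k + suc L) ≈ 0#
        newton≈0 k k<1+L = ≡.subst (λ N → newton (suc L) w N ≈ 0#) shift
          (*-cancelʳ (*-≉0 (frac-≉0 (L + suc k) (k!≢0 L)) (^-≉0 (suc k) α≉0))
            (trans (*-comm _ _) (trans (sym (productCoeff-beyond (suc k)))
              (trans (reflexive (≡.cong productCoeff shift)) (trans (h k k<1+L) (sym (zeroˡ _)))))))
          where
          shift : L + suc k ≡ k + suc L
          shift = ≡.trans (ℕ.+-suc L k) (≡.trans (≡.cong suc (ℕ.+-comm L k)) (≡.sym (ℕ.+-suc k L)))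

      -- The exponential has the non-zero constant term `frac 1 0`, so the coefficients of the
      -- denominator vanish one after the other. This is what makes the numerators non-zero.
      productCoeff-all-zero-below : (∀ n → n ℕ.< suc L → productCoeff n ≈ 0#) → ∀ n → n ℕ.< suc L →
        c₀ n ≈ 0#
      productCoeff-all-zero-below h n n<1+L = below (suc n) n<1+L n (ℕ.n<1+n n)
        where
        below : ∀ n → n ≤ suc L → ∀ i → i ℕ.< n → c₀ i ≈ 0#
        below (suc n) n<1+L i i<1+n with ℕ.m<1+n⇒m<n∨m≡n i<1+n
        ... | inj₁ i<n    = below n (ℕ.<⇒≤ n<1+L) i i<n
        ... | inj₂ ≡.refl = b₀≈0⇒c₀≈0 n (*-cancelʳ (frac-≉0 {1} 0 λ ()) (begin
          b₀ n * frac 1 0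
            ≈⟨ *-cong (coeff-denominator n) (*-identityʳ _) ⟨
          coeff denominator n * (frac 1 0 * 1#)
            ≡⟨ ≡.cong (λ k → coeff denominator n * expCoeff k) (ℕ.n∸n≡0 n) ⟨
          coeff denominator n * expCoeff (n ℕ.∸ n)
            ≈⟨ sum-last n (λ i → coeff denominator i * expCoeff (n ℕ.∸ i))
                (λ i i<n → trans (*-congʳ (trans (coeff-denominator i)
                 (trans (*-congˡ (below n (ℕ.<⇒≤ n<1+L) i i<n)) (zeroʳ _)))) (zeroˡ _)) ⟨
          productCoeff n
            ≈⟨ h n n<1+L ⟩
          0#
            ≈⟨ zeroˡ _ ⟨
          0# * frac 1 0 ∎))

      numerator : List Carrier
      numerator = tabulate {n = suc L} (productCoeff ∘ toℕ)

      remainder : ℕ → Carrier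
      remainder n = productCoeff n ⊕ - coeff numerator n

      remainder-below : ∀ {n} → n ≤ L → remainder n ≈ 0#
      remainder-below {n} n≤L = trans (+-congˡ (-‿cong (coeff-tabulate-toℕ productCoeff (s≤s n≤L))))
        (-‿inverseʳ _)

      remainder-above : ∀ {n} → L ℕ.< n → remainder n ≈ productCoeff n
      remainder-above L<n = trans (+-congˡ (trans (-‿cong (reflexive (coeff-tabulate-beyond (productCoeff ∘ toℕ) L<n)))
        -0#≈0#)) (+-identityʳ _)

      module _ (v≉0 : ¬ (∀ n → n ℕ.< suc L → c₀ n ≈ 0#)) where
        numerator-degree : ∃ λ d → IsDegree rawRing numerator d × d ≤ L
        numerator-degree = tabulate-degree productCoeff (v≉0 ∘ productCoeff-all-zero-below)

        -- Up to index L the numerator cancels the product, and the next k coefficients vanish by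
        -- hypothesis, so the first non-zero coefficient comes later.
        remainder-order : ∀ k → (∀ i → i ℕ.< k → newton (suc L) w (L + suc i) ≈ 0#) →
          ∃ λ d → IsOrder rawRing remainder d × L + k + 1 ≤ d
        remainder-order k vanish = d , (rd≉0 , below) , ℕ.≮⇒≥ λ d< →
          rd≉0 (small d (≡.subst (d ℕ.<_) (ℕ.+-comm (L + k) 1) d<))
          where
          -- The search stops below 2L + 2: the indices L + 1, ..., 2L + 1 are L + 1 consecutive
          -- ones and cannot all give zero.
          nonzero : ¬ (∀ n → n ℕ.< suc L + suc L → remainder n ≈ 0#)
          nonzero h = v≉0 (productCoeff-all-zero-above λ i i<1+L →
            trans (sym (remainder-above (ℕ.m≤n+m (suc L) i)))
              (h (i + suc L) (ℕ.+-monoˡ-< (suc L) i<1+L)))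
          found : ∃ λ d → d ℕ.< suc L + suc L × remainder d ≉ 0# × (∀ n → n ℕ.< d → remainder n ≈ 0#)
          found = least-failure (λ n → remainder n ≈0?) nonzero
          d : ℕ
          d = proj₁ found
          rd≉0 : remainder d ≉ 0#
          rd≉0 = proj₁ (proj₂ (proj₂ found))
          below : ∀ n → n ℕ.< d → remainder n ≈ 0#
          below = proj₂ (proj₂ (proj₂ found))
          above : ∀ i → i ℕ.< k → remainder (L + suc i) ≈ 0#
          above i i<k = trans (remainder-above (ℕ.m<m+n L (s≤s z≤n)))
            (trans (productCoeff-beyond (suc i)) (trans (*-congˡ (vanish i i<k)) (zeroʳ _)))
          small : ∀ n → n ℕ.< suc (L + k) → remainder n ≈ 0#
          small n n< with n ℕ.≤? L
          ... | yes n≤L = remainder-below n≤L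
          ... | no  n≰L = ≡.subst (λ x → remainder x ≈ 0#) n≡ (above i
            (ℕ.+-cancelˡ-≤ L (suc i) k (ℕ.≤-trans (ℕ.≤-reflexive n≡) (ℕ.≤-pred n<))))
            where
            i : ℕ
            i = n ℕ.∸ suc L
            n≡ : L + suc i ≡ n
            n≡ = ≡.trans (ℕ.+-suc L i) (ℕ.m+[n∸m]≡n (ℕ.≰⇒> n≰L))

-- The kernel vector and the approximants

module KernelVector {m} (l : Vector ℕ m) where
  open IntegerPolynomials m
  open CommonFactor l
  open CommutativeRing A hiding (zero; _+_)
  open DomainProperties A-isDomain
  open Determinants A
  open Volumes A using (maximal-minors-in-kernel)
  open BinomialRows A using (ν)
  open RowDivisibility A l α using (rows; rows-rowOf)
  open CommutativeSemiringExp commutativeSemiring using (_^_)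
  open SemiringSum semiring using (sum; sum-cong-≋; *-distribʳ-sum)
  open SemiringDivisibility semiring using (module _∣ʳ_)
  open RingProperties ring using (-‿involutive; -0#≈0#)
  open SetoidReasoning setoid
  open RingSolver commutativeSemiring using (solve; _:*_; _:=_)

  private
    L : ℕ
    L = total l

    quotient : Fin (suc L) → Carrier
    quotient h = _∣ʳ_.quotient (T∣𝒱-minor h)

    quotient-T : ∀ h → quotient h * T l ≈ 𝒱-minor l h
    quotient-T h = _∣ʳ_.equality (T∣𝒱-minor h)

  τ : Fin (suc L) → Carrier
  τ h = sign h * quotient h

  τ-isQuotient : ∀ h → IsQuotient (ℤ[α] m) (τ h) (sign h * 𝒱-minor l h) (T l)
  τ-isQuotient h = T≉0 , trans (*-assoc (sign h) (quotient h) (T l)) (*-congˡ (quotient-T h))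

  -- After multiplication by `T l` this is the kernel relation of the maximal minors, and `T l`
  -- cancels in the domain.
  τ-kernel : ∀ j (i : Fin (l j)) →
    sum {suc L} (λ h → (ν ((L + suc (toℕ i)) C toℕ h) * α j ^ (L ℕ.∸ toℕ h)) * τ h) ≈ 0#
  τ-kernel j i = trans (sum-cong-≋ {suc L} λ h →
    *-congʳ {τ h} (reflexive (≡.cong-app (≡.sym (rows-rowOf j i)) h)))
    (*-cancelʳ T≉0 (begin
      sum {suc L} (λ h → rows r h * τ h) * T l
        ≈⟨ *-distribʳ-sum {suc L} (T l) (λ h → rows r h * τ h) ⟩
      sum {suc L} (λ h → (rows r h * τ h) * T l)
        ≈⟨ sum-cong-≋ {suc L} (λ h → trans
             (solve 4 (λ e s q t → (e :* (s :* q)) :* t := s :* (e :* (q :* t))) refl (rows r h)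
               (sign h) (quotient h) (T l))
             (*-congˡ {sign h} (*-congˡ {rows r h} (trans (quotient-T h) (sym (minor≈ h)))))) ⟩
      sum {suc L} (λ h → sign h * (rows r h * minor (punchIn h) rows))
        ≈⟨ maximal-minors-in-kernel rows r ⟩
      0#
        ≈⟨ zeroˡ (T l) ⟨
      0# * T l ∎))
    where r = rowOf l j i

  -- This single coordinate shows that the kernel vector is not zero, on which all exact degrees and
  -- orders rest.
  τ-last-≉0 : τ (fromℕ L) ≉ 0#
  τ-last-≉0 = *-≉0 (^-≉0 (toℕ (fromℕ L)) -1≉0) λ e → 𝒱-minor-last-≉0 m l
    (trans (sym (quotient-T (fromℕ L))) (trans (*-congʳ e) (zeroˡ (T l))))
    where
    -1≉0 : - 1# ≉ 0#
    -1≉0 e = IsDomain.1≉0 A-isDomain (trans (sym (-‿involutive 1#)) (trans (-‿cong e) -0#≈0#))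

module Approximants {m} (l : Vector ℕ m) where
  open KernelVector l
  private
    module Z where
      open IntegerPolynomials m public
      open CommutativeRing A public using (_≈_; _*_; 0#; semiring; commutativeSemiring)
    Q = mpolyRing ℚ.+-*-commutativeRing m
    module Q = CommutativeRing Q
    L = total l
    q-isHom = scalar-isHom ℚ.+-*-commutativeRing m
    module P = Pade Q (mpoly-isDomain ℚ.+-*-commutativeRing ℚ-isDomain m)
      (λ a n → scalar ℚ.+-*-rawRing m (a /! n))
      (λ n a≢0 → scalar-≉0 ℚ.+-*-commutativeRing m (/!-≢0 n a≢0))
      (Fractions.q/!-product Q q-isHom)
    module ι = Hom Z.A Q (ι-isHom m)
    module QV = BinomialRows Q
    module ZV = BinomialRows Z.A
    module Z^ = CommutativeSemiringExp Z.commutativeSemiring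
    module Q^ = CommutativeSemiringExp Q.commutativeSemiring
    module ZΣ = SemiringSum Z.semiring
    module QΣ = SemiringSum Q.semiring
    open FiniteDifferences Q using (newton)
    open SetoidReasoning Q.setoid

  β : Fin m → Q.Carrier
  β = var ℚ.+-*-rawRing m

  β≉0 : ∀ j → β j Q.≉ Q.0#
  β≉0 = var-≉0 ℚ.+-*-commutativeRing (λ ()) m

  v : Vector Q.Carrier (suc L)
  v h = ι m (τ h)

  v≉0 : ¬ (∀ n → n ℕ.< suc L → P.c₀ L v n Q.≈ Q.0#)
  v≉0 h = τ-last-≉0 (ι-≈0 m (Q.trans
    (Q.reflexive (≡.sym (Tabulate.coeff-tabulate Q v (fromℕ L))))
      (h (toℕ (fromℕ L)) (toℕ<n (fromℕ L)))))

  -- Here `i` stands for the row index i + 1, so it governs the coefficient of t^(L+i+1). The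
  -- homomorphism `ι` carries the relation 𝒱 τ = 0 over to rational coefficients.
  newton-vanishes : ∀ j i → i ℕ.< l j → newton (suc L) (P.w L v (β j) (β≉0 j)) (L + suc i) Q.≈ Q.0#
  newton-vanishes j i i<l = begin
    QΣ.sum {suc L} (λ h → QV.ν ((L + suc i) C toℕ h) Q.*
      (β j Q^.^ (L ℕ.∸ toℕ h) Q.* P.c₀ L v (toℕ h)))
      ≈⟨ QΣ.sum-cong-≋ {suc L} entrywise ⟩
    QΣ.sum {suc L} (λ h → ι m (e h))
      ≈⟨ ι.sum-homo {suc L} e ⟨
    ι m (ZΣ.sum {suc L} e)
      ≈⟨ ι.⟦⟧-cong {ZΣ.sum {suc L} e} {Z.0#} (≡.subst
          (λ i → ZΣ.sum {suc L} (λ h → (ZV.ν ((L + suc i) C toℕ h) Z.* Z.α j Z^.^ (L ℕ.∸ toℕ h)) Z.*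
          τ h) Z.≈ Z.0#)
           (toℕ-fromℕ< i<l) (τ-kernel j (fromℕ< i<l))) ⟩
    ι m Z.0#
      ≈⟨ ι.0#-homo ⟩
    Q.0# ∎
    where
    e : Fin (suc L) → CommutativeRing.Carrier Z.A
    e h = (ZV.ν ((L + suc i) C toℕ h) Z.* Z.α j Z^.^ (L ℕ.∸ toℕ h)) Z.* τ h
    entrywise : ∀ h → QV.ν ((L + suc i) C toℕ h) Q.* (β j Q^.^ (L ℕ.∸ toℕ h) Q.* P.c₀ L v (toℕ h))
      Q.≈ ι m (e h)
    entrywise h = Q.sym (begin
      ι m (e h)
        ≈⟨ ι.*-homo _ (τ h) ⟩
      ι m (ZV.ν ((L + suc i) C toℕ h) Z.* Z.α j Z^.^ (L ℕ.∸ toℕ h)) Q.* v h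
        ≈⟨ Q.*-congʳ (ι.*-homo (ZV.ν ((L + suc i) C toℕ h)) _) ⟩
      (ι m (ZV.ν ((L + suc i) C toℕ h)) Q.* ι m (Z.α j Z^.^ (L ℕ.∸ toℕ h))) Q.* v h
        ≈⟨ Q.*-cong (Q.*-cong (ι.ν-homo ((L + suc i) C toℕ h))
             (Q.trans (ι.^-homo (Z.α j) (L ℕ.∸ toℕ h)) (Q^.^-congˡ (L ℕ.∸ toℕ h) (ι-var m j))))
             (Q.reflexive (≡.sym (Tabulate.coeff-tabulate Q v h))) ⟩
      (QV.ν ((L + suc i) C toℕ h) Q.* β j Q^.^ (L ℕ.∸ toℕ h)) Q.* P.c₀ L v (toℕ h)
        ≈⟨ Q.*-assoc _ _ _ ⟩
      QV.ν ((L + suc i) C toℕ h) Q.* (β j Q^.^ (L ℕ.∸ toℕ h) Q.* P.c₀ L v (toℕ h)) ∎)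

  B : Fin (suc m) → RawRing.Carrier (ℚ[t,α] m)
  B zero    = P.denominator L v
  B (suc j) = P.numerator L v (β j) (β≉0 j)

  B-zero-monomials = Tabulate.sum-monomials Q (P.scaled L v)

  B-degree : ∀ j → ∃ λ d → IsDegree (ℚ[α] m) (B j) d × d ≤ L
  B-degree zero    = P.denominator-degree L v v≉0
  B-degree (suc j) = P.numerator-degree L v (β j) (β≉0 j) v≉0

  S : Fin m → RawRing.Carrier (ℚ[α]⟦t⟧ m)
  S j = P.remainder L v (β j) (β≉0 j)

  S-order : ∀ j → ∃ λ d → IsOrder (ℚ[α] m) (S j) d × L + l j + 1 ≤ d
  S-order j = P.remainder-order L v (β j) (β≉0 j) v≉0 (l j) (newton-vanishes j)

theorem2p2 : (m : ℕ) → 1 ≤ m →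
    (l : Vector ℕ m) → (∀ j → 1 ≤ l j) →
    let L = total l
        module Zα  = RawRing (ℤ[α] m)
        module Qα  = RawRing (ℚ[α] m)
        module Qtα = RawRing (ℚ[t,α] m)
        module Qαt = RawRing (ℚ[α]⟦t⟧ m)
        module Zα′  = RawSemiringDefs Zα.rawSemiring
        module Qtα′ = RawSemiringDefs Qtα.rawSemiring
        const = PolyOps.const (ℚ[α] m)
        t     = PolyOps.X (ℚ[α] m)
    in
    ∃ λ (B : Fin (suc m) → Qtα.Carrier) →
    ∃ λ (S : Fin m → Qαt.Carrier) →
      (∀ j → B j Qtα.≉ Qtα.0#) ×
      (∀ j → (toSeries m (B zero) Qαt.* exp m j) Qαt.+ (Qαt.- toSeries m (B (suc j))) Qαt.≈ S j) ×
      (∀ j → ∃ λ d → IsDegree (ℚ[α] m) (B j) d × d ≤ L) ×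
      (∀ j → ∃ λ d → IsOrder (ℚ[α] m) (S j) d × L + l j + 1 ≤ d) ×
      (∃ λ (τ : Fin (suc L) → Zα.Carrier) →
        (∀ i → IsQuotient (ℤ[α] m) (τ i) (((Zα.- Zα.1#) Zα′.^ toℕ i) Zα.* 𝒱-minor l i) (T l)) ×
        (B zero Qtα.≈ Qtα′.sum (λ (i : Fin (suc L)) →
          const (scalar ℚ.+-*-rawRing m ((L !) /! toℕ i) Qα.* ι m (τ i)) Qtα.* (t Qtα′.^ toℕ i)))) ×
      (∀ i → T l Zα′.∣ 𝒱-minor l i)
theorem2p2 m _ l _ =
  B , S
  , (λ j B≈0 → let d , (Bd≉0 , _) , _ = B-degree j in Bd≉0 (B≈0 d))
  , (λ j n → CommutativeRing.refl (mpolyRing ℚ.+-*-commutativeRing m))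
  , B-degree
  , S-order
  , (τ , τ-isQuotient , λ n → CommutativeRing.sym (mpolyRing ℚ.+-*-commutativeRing m)
      (PolyRing.at B-zero-monomials n))
  , IntegerPolynomials.CommonFactor.T∣𝒱-minor m l
  where
  open Approximants l
  open KernelVector l
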